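{- Let $n\geq 2$ be an integer and $p$ a prime. Then the flasque class $\rho_{A_n}(J_{A_n/A_{n-1}})$ is $p$-invertible if and only if either $n$ is a prime, or $n$ is composite and $p$ does not divide $n$.
   Context: $A_n$ is the alternating group on $\{1,\dots,n\}$ and $A_{n-1}\leq A_n$ is the stabilizer of the letter $n$. A $G$-lattice is a finitely generated $\mathbb{Z}[G]$-module that is free as an abelian group. It is permutation if it has a $\mathbb{Z}$-basis permuted by $G$; flasque if $\hat{H}^{ -1}(H',M)=0$ for all subgroups $H'\leq G$ (Tate cohomology). Two $G$-lattices $M_1,M_2$ are similar if $M_1\oplus P_1\cong M_2\oplus P_2$ for permutation $G$-lattices $P_1,P_2$. Every $G$-lattice $M$ has a flasque resolution $0\to M\to P\to F\to 0$ with $P$ permutation and $F$ flasque, and the similarity class of $F$ depends only on that of $M$; it is denoted $\rho_G(M)$ (the flasque class). For a prime $p$, a $G$-lattice $M$ is $p$-invertible if there is a permutation $G$-lattice $P$ such that $M\otimes\mathbb{Z}_{(p)}$ is a direct summand of $P\otimes\mathbb{Z}_{(p)}$ as $\mathbb{Z}_{(p)}[G]$-modules; a similarity class is $p$-invertible if some (equivalently every) lattice in it is $p$-invertible. For $H\leq G$, $J_{G/H}$ is the $\mathbb{Z}$-dual lattice of the kernel of the augmentation map $\mathbb{Z}[G/H]\to\mathbb{Z}$, $gH\mapsto 1$. -}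

module Defs where

open import Data.Bool using (Bool; true; false; T; _∧_; _∨_; not; if_then_else_)
open import Data.Nat as ℕ using (ℕ; zero; suc; _%_; _≡ᵇ_; _<ᵇ_)
open import Data.Nat.Divisibility using (_∣_)
open import Data.Integer as ℤ using (ℤ)
open import Data.Rational as ℚ using (ℚ)
open import Data.Fin as Fin using (Fin; toℕ; fromℕ; _≟_)
open import Data.Fin.Properties using (all?)
open import Data.Vec as Vec using (Vec; lookup; tabulate)
open import Data.List as List using (List; []; _∷_; filter; concatMap; allFin; length)
open import Data.Bool.ListAction using (all; any)
open import Data.Nat.ListAction using (sum)
open import Data.List.Membership.Propositional using (_∈_)
open import Data.List.Relation.Unary.Unique.Propositional using (Unique)
open import Data.Product using (Σ; ∃; _×_; _,_)
open import Relation.Nullary using (¬_; Dec; yes; no)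
open import Data.Unit using (tt)
open import Relation.Nullary.Decidable using (⌊_⌋)
open import Relation.Binary.PropositionalEquality using (_≡_)
open import Relation.Unary using (Pred)

module LinAlg {A : Set} (0# 1# : A) (_+_ _*_ : A → A → A) where
  ∑ : ∀ {m} → (Fin m → A) → A
  ∑ {zero}  f = 0#
  ∑ {suc m} f = f Fin.zero + ∑ (λ i → f (Fin.suc i))

  Vect : ℕ → Set
  Vect r = Fin r → A

  Mat : ℕ → ℕ → Set
  Mat r c = Fin r → Fin c → A

  _·_ : ∀ {r c d} → Mat r c → Mat c d → Mat r d
  (M · N) i k = ∑ (λ j → M i j * N j k)

  _⊛_ : ∀ {r c} → Mat r c → Vect c → Vect r
  (M ⊛ v) i = ∑ (λ j → M i j * v j)

  1M : ∀ {r} → Mat r r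
  1M i j = if ⌊ i ≟ j ⌋ then 1# else 0#

  0V : ∀ {r} → Vect r
  0V i = 0#

  _+V_ : ∀ {r} → Vect r → Vect r → Vect r
  (u +V v) i = u i + v i

  ∑V : ∀ {m r} → (Fin m → Vect r) → Vect r
  ∑V f i = ∑ (λ k → f k i)

  transpose : ∀ {r c} → Mat r c → Mat c r
  transpose M i j = M j i

  _≈V_ : ∀ {r} → Vect r → Vect r → Set
  u ≈V v = ∀ i → u i ≡ v i

  _≈M_ : ∀ {r c} → Mat r c → Mat r c → Set
  M ≈M N = ∀ i j → M i j ≡ N i j

module Zℤ = LinAlg (ℤ.+ 0) (ℤ.+ 1) ℤ._+_ ℤ._*_
module Qℚ = LinAlg ℚ.0ℚ ℚ.1ℚ ℚ._+_ ℚ._*_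
open Zℤ public

ℤ→ℚ : ℤ → ℚ
ℤ→ℚ z = z ℚ./ 1

castM : ∀ {r c} → Mat r c → Qℚ.Mat r c
castM M i j = ℤ→ℚ (M i j)

-- Permutations of {1,…,n} (letters are Fin n; letter k+1 is the
-- element k of Fin n), and the alternating group A_n

Perm : ℕ → Set
Perm n = Vec (Fin n) n

idP : ∀ {n} → Perm n
idP = tabulate (λ i → i)

_∘P_ : ∀ {n} → Perm n → Perm n → Perm n
g ∘P h = tabulate (λ i → lookup g (lookup h i))

_==_ : ∀ {n} → Fin n → Fin n → Bool
i == j = ⌊ i ≟ j ⌋

isBijective : ∀ {n} → Perm n → Bool
isBijective {n} g =
  all (λ i → all (λ j → (i == j) ∨ not (lookup g i == lookup g j)) (allFin n)) (allFin n)

inversions : ∀ {n} → Perm n → ℕ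
inversions {n} g = sum (List.map (λ i → sum (List.map (λ j →
  if (toℕ i <ᵇ toℕ j) ∧ (toℕ (lookup g j) <ᵇ toℕ (lookup g i)) then 1 else 0)
  (allFin n))) (allFin n))

isEven : ∀ {n} → Perm n → Bool
isEven g = inversions g % 2 ≡ᵇ 0

isAlt : ∀ {n} → Perm n → Bool
isAlt g = isBijective g ∧ isEven g

InA : ∀ {n} → Perm n → Set
InA g = T (isAlt g)

-- the inverse permutation (for g a bijection)
invP : ∀ {n} → Perm n → Perm n
invP {n} g = tabulate (λ j → search j (allFin n))
  where
  search : Fin n → List (Fin n) → Fin n
  search j []       = j
  search j (i ∷ is) = if lookup g i == j then i else search j is

allTables : ∀ n k → List (Vec (Fin n) k)
allTables n zero    = Vec.[] ∷ []
allTables n (suc k) = concatMap (λ i → List.map (i Vec.∷_) (allTables n k)) (allFin n)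

T? : (b : Bool) → Dec (T b)
T? true  = yes tt
T? false = no (λ ())

altList : ∀ n → List (Perm n)
altList n = filter (λ g → T? (isAlt g)) (allTables n n)

record RawLattice (n : ℕ) : Set where
  field
    rank : ℕ
    act  : Perm n → Mat rank rank
open RawLattice public

IsGLattice : ∀ {n} → RawLattice n → Set
IsGLattice M = (act M idP ≈M 1M)
  × (∀ g h → InA g → InA h → act M (g ∘P h) ≈M (act M g · act M h))

IsHom : ∀ {n} (M N : RawLattice n) → Mat (rank N) (rank M) → Set
IsHom M N f = ∀ g → InA g → (f · act M g) ≈M (act N g · f)

ShortExact : ∀ {n} (M P F : RawLattice n) → Set
ShortExact M P F =
  Σ (Mat (rank P) (rank M)) λ i → Σ (Mat (rank F) (rank P)) λ π →
    IsHom M P i × IsHom P F π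
  × (∀ x → (i ⊛ x) ≈V 0V → x ≈V 0V)
  × (∀ y → ∃ λ x → (π ⊛ x) ≈V y)
  × (∀ x → (π ⊛ (i ⊛ x)) ≈V 0V)
  × (∀ y → (π ⊛ y) ≈V 0V → ∃ λ x → (i ⊛ x) ≈V y)

IsPermutation : ∀ {n} → RawLattice n → Set
IsPermutation M =
  Σ (Mat (rank M) (rank M)) λ B → Σ (Mat (rank M) (rank M)) λ C →
    (C · B) ≈M 1M × (B · C) ≈M 1M
  × (∀ g → InA g → Σ (Fin (rank M) → Fin (rank M)) λ σ →
       ∀ j → (act M g ⊛ (λ i → B i j)) ≈V (λ i → B i (σ j)))

record Subgroup (n : ℕ) : Set where
  field
    elts   : List (Perm n)
    unique : Unique elts
    inA    : ∀ {g} → g ∈ elts → InA g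
    hasId  : idP ∈ elts
    closed : ∀ {g h} → g ∈ elts → h ∈ elts → (g ∘P h) ∈ elts
open Subgroup public

-- Ĥ^{-1}(H, M) = ker(N_H) / I_H M vanishes, where N_H = ∑_{h∈H} h and
-- I_H M is generated by the elements (h - 1) m
H⁻¹Vanishes : ∀ {n} → Subgroup n → RawLattice n → Set
H⁻¹Vanishes H M =
  ∀ (x : Vect (rank M)) →
    ∑V (λ k → act M (List.lookup (elts H) k) ⊛ x) ≈V 0V →
    ∃ λ (y : Fin (length (elts H)) → Vect (rank M)) →
      x ≈V ∑V (λ k → (act M (List.lookup (elts H) k) ⊛ y k) +V (λ i → ℤ.- (y k i)))

IsFlasque : ∀ {n} → RawLattice n → Set
IsFlasque {n} M = ∀ (H : Subgroup n) → H⁻¹Vanishes H M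

InZp : ℕ → ℚ → Set
InZp p q = ¬ (p ∣ ℚ.denominatorℕ q)

-- M ⊗ ℤ_(p) is a direct summand of P ⊗ ℤ_(p) as ℤ_(p)[A_n]-modules,
-- for some permutation A_n-lattice P: there are ℤ_(p)[A_n]-linear maps
-- ι : M_(p) → P_(p) and ρ : P_(p) → M_(p) with ρ ∘ ι = id
IsPInvertible : ∀ {n} → ℕ → RawLattice n → Set
IsPInvertible {n} p M =
  Σ (RawLattice n) λ P → IsGLattice P × IsPermutation P
  × Σ (Qℚ.Mat (rank P) (rank M)) λ ι → Σ (Qℚ.Mat (rank M) (rank P)) λ ρ →
      (∀ i j → InZp p (ι i j)) × (∀ i j → InZp p (ρ i j))
    × (∀ g → InA g → (ι Qℚ.· castM (act M g)) Qℚ.≈M (castM (act P g) Qℚ.· ι))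
    × (∀ g → InA g → (ρ Qℚ.· castM (act P g)) Qℚ.≈M (castM (act M g) Qℚ.· ρ))
    × (ρ Qℚ.· ι) Qℚ.≈M Qℚ.1M

-- the flasque class ρ_{A_n}(M) is p-invertible: for a flasque resolution
-- 0 → M → P → F → 0 (P permutation, F flasque), F is p-invertible
-- (this does not depend on the chosen resolution)
FlasqueClassPInvertible : ∀ {n} → ℕ → RawLattice n → Set
FlasqueClassPInvertible {n} p M =
  Σ (RawLattice n) λ P → Σ (RawLattice n) λ F →
    IsGLattice P × IsGLattice F
  × ShortExact M P F × IsPermutation P × IsFlasque F
  × IsPInvertible p F

-- ℤ-dual lattice M° = Hom(M, ℤ), with (g φ)(m) = φ(g⁻¹ m): in the dual
-- basis g acts by the transpose of the matrix of g⁻¹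
dual : ∀ {n} → RawLattice n → RawLattice n
dual M = record { rank = rank M ; act = λ g → transpose (act M (invP g)) }

module Coset (m : ℕ) where
  n = suc m

  -- the letter n (stabilised by A_{n-1})
  a : Fin n
  a = fromℕ m

  -- A_n/A_{n-1} is identified with the A_n-orbit of the letter n via
  -- gA_{n-1} ↦ g(n)
  inOrbit : Fin n → Bool
  inOrbit x = any (λ g → lookup g a == x) (altList n)

  others : List (Fin n)
  others = filter (λ x → T? (not (x == a) ∧ inOrbit x)) (allFin n)

  r = length others

  b : Fin r → Fin n
  b = List.lookup others

  δ : Fin n → Fin n → ℤ
  δ x y = if x == y then ℤ.+ 1 else ℤ.+ 0

  -- I = ker(ℤ[A_n/A_{n-1}] → ℤ), with ℤ-basis u_x = e_x - e_a (x ≠ a in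
  -- the orbit);  g u_x = e_{gx} - e_{ga}, i.e. the coordinate at u_y is
  -- [gx = y] - [ga = y]
  augKernel : RawLattice n
  augKernel = record
    { rank = r
    ; act  = λ g k l → δ (lookup g (b l)) (b k) ℤ.- δ (lookup g a) (b k) }

J : (n : ℕ) → RawLattice n
J zero    = record { rank = 0 ; act = λ _ () }
J (suc m) = dual (Coset.augKernel m)

{-# OPTIONS --safe #-}
module Submission where

-- Write X for the set of n letters.  For n ≥ 3 the lattice J is the lattice of functions on X
-- modulo constants.  A p-integral splitting F → P′ → F is replaced by integral maps whose
-- composite is an integer e prime to p.
--
-- (⇐)  J is embedded in a permutation lattice P by the differences a x - a y and by linear
-- forms coming from Bézout relations between the class sizes of all labellings of X.  The
-- latter make the cokernel F flasque: for a subgroup H, applied to the labelling by H-orbits,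
-- they force an H-invariant function whose image is a norm to be a norm modulo constants.  If p ∤ n,
-- summing over the second letter of a pair splits n·J off P, hence n·F.  If p = n, every
-- full cycle c gives maps P → ℤ[X] → P between 0 → J → P and 0 → J → ℤ[X] → ℤ → 0 which split F off
-- P ⊕ ℤ equivariantly for ⟨c⟩; averaging over the (n-1)! cycles, a number prime to p, gives
-- an equivariant splitting.
--
-- (⇒)  Let n be composite and p ∣ n.  The restriction of F to a subgroup ⟨s,t⟩ ≅ C_p × C_p of A_n
-- satisfies the cohomological vanishing properties of permutation lattices.  For p odd let s rotate
-- one block of p letters and t all the others: then there is a class in H²(⟨s,t⟩, F) that
-- vanishes on all cyclic subgroups, and its vanishing forces p ∣ e².  For p = 2 use
-- H¹(⟨s,t⟩, F), with ⟨s,t⟩ acting freely if 4 ∣ n, and with three additional orbits of length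
-- two having distinct stabilisers if n ≡ 2 mod 4.

open import Defs
open import Data.Bool using (Bool; true; false; T; _∧_; _∨_; not; if_then_else_)
open import Data.Nat as ℕ using (ℕ; zero; suc; _!; _≤_)
import Data.Nat.Properties as ℕP
open import Data.Integer as ℤ using (ℤ; -[1+_]; _⊔_; ∣_∣; +_; _+_; _*_; _-_; -_; 0ℤ; 1ℤ)
import Data.Integer.Properties as ℤP
open import Data.Integer.Tactic.RingSolver using (solve-∀)
open import Data.Fin as Fin using (Fin; toℕ; _≟_)
open import Data.Product using (Σ; ∃; _×_; _,_; proj₁; proj₂)
open import Data.Empty using (⊥; ⊥-elim)
open import Data.Sum as Sum using (_⊎_; inj₁; inj₂)
open import Relation.Nullary using (¬_; Dec; yes; no)
open import Relation.Nullary.Decidable using (⌊_⌋)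
open import Relation.Binary.PropositionalEquality using (_≡_; refl; sym; trans; cong; cong₂; subst; subst₂; module ≡-Reasoning)
open import Function using (_∘_; id; case_of_)
open import Data.Unit using (tt)
import Data.Fin.Properties as FinP
open import Data.Vec as Vec using (Vec; lookup; tabulate)
open import Data.Vec.Properties using (lookup∘tabulate; tabulate∘lookup; tabulate-cong)
open import Data.List as List using (List; []; _∷_; allFin)
open import Data.List.Membership.Propositional using (_∈_)
open import Data.List.Membership.Propositional.Properties using (∈-allFin; ∈-filter⁺; ∈-filter⁻; ∈-concatMap⁺; ∈-map⁺; ∈-lookup)
open import Data.List.Relation.Unary.Any as Any using (here; there)
import Data.List.Relation.Unary.Any.Properties as AnyP
open import Data.List.Relation.Unary.All as All using (All)
import Data.List.Relation.Unary.All.Properties as AllP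
open import Data.Nat.DivMod using (m≡m%n+[m/n]*n; m*n%n≡0; m%n<n; %-distribˡ-+; m%n%n≡m%n; [m+n]%n≡m%n; m<n⇒m%n≡m)
open import Data.Bool.ListAction using (all)
open import Data.Nat.ListAction using (sum)
open import Data.Bool.Properties using (T-∧; T-∨; T-irrelevant)
open import Function.Bundles using (Equivalence; _⇔_; mk⇔)
open import Data.List.Properties using (map-tabulate)
open import Relation.Binary using (tri<; tri≈; tri>)
open import Data.List.Relation.Unary.Unique.Propositional using (Unique)
open import Data.List.Relation.Unary.Unique.Propositional.Properties using (filter⁺; allFin⁺)
open import Data.List.Relation.Unary.AllPairs as AllPairs using (AllPairs)
import Data.Fin.Permutation.Components as PC
open import Data.Nat.Primality using (Prime; Composite; euclidsLemma; prime⇒nonZero; prime⇒irreducible; prime⇒nonTrivial; prime[2]; prime?; ¬prime⇒composite)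
open import Data.Nat.Divisibility using (_∣_; divides; ∣⇒≤; ∣-trans; ∣1⇒≡1; _∣?_)
open import Data.Nat.Coprimality using (Coprime; coprime-Bézout)
open import Data.Nat.GCD using (module Bézout; module GCD)
open import Data.Rational as ℚ using (ℚ; mkℚ)
import Data.Rational.Properties as ℚP
open import Data.Rational.Unnormalised as ℚᵘ using (mkℚᵘ; *≡*)
import Data.Rational.Unnormalised.Properties as ℚᵘP
open import Data.Integer.GCD using () renaming (gcd to gcdℤ)
open import Data.Fin.Patterns using (0F; 1F; 2F; 3F; 4F; 5F)
open import Data.Fin.Permutation as Perm′ using (Permutation; permutation; _⟨$⟩ʳ_; _⟨$⟩ˡ_; insert; remove; lift₀; insert-punchIn; insert-remove)

-- The computations take place in `P` rather than in `F`: a vector of `F` is lifted to `P`, an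
-- identity in `F` becomes one in `P` up to an error `I w`, and `w` is a function on the letters
-- known up to a constant. The obstructions end in arithmetic: two such functions differ by a
-- constant, and comparing values at chosen letters makes p divide e or e². When 4 divides n, the
-- class used comes from H³(C₂ × C₂, ℤ) = ℤ/2, which is invisible on cyclic subgroups. The prime 2
-- stands apart because rotating a single block of two letters is odd, and because 0 + 1 + ... + (p
-- - 1) is divisible by p only for odd p. Flasqueness: since Ĥ⁻¹(H, P) = 0, the group Ĥ⁻¹(H, F) is
-- the kernel of Ĥ⁰(H, J) → Ĥ⁰(H, P), so the forms defining the embedding must make this map
-- injective for all H at once. A labelling by H-orbits gives coordinates fixed by H, at which a
-- norm is divisible by the order of H. For p = n, an antiderivative along a cycle is determined
-- only up to a constant, and equivariance under conjugation requires a canonical one; this is why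
-- maxima appear.

T-not⌊⌋ : ∀ {A : Set} (d : Dec A) → T (not ⌊ d ⌋) → ¬ A
T-not⌊⌋ (no ¬a) _ = ¬a

not⌊⌋-T : ∀ {A : Set} (d : Dec A) → ¬ A → T (not ⌊ d ⌋)
not⌊⌋-T (no _)  _  = tt
not⌊⌋-T (yes a) ¬a = ¬a a

⌊⌋-T : ∀ {A : Set} (d : Dec A) → A → T ⌊ d ⌋
⌊⌋-T (yes _) _ = tt
⌊⌋-T (no ¬a) a = ¬a a

T-⌊⌋ : ∀ {A : Set} (d : Dec A) → T ⌊ d ⌋ → A
T-⌊⌋ (yes a) _ = a

⌊⌋-⇔ : ∀ {A B : Set} (d : Dec A) (d′ : Dec B) → (A → B) → (B → A) → ⌊ d ⌋ ≡ ⌊ d′ ⌋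
⌊⌋-⇔ (yes a) (yes _) f g = refl
⌊⌋-⇔ (yes a) (no ¬b) f g = ⊥-elim (¬b (f a))
⌊⌋-⇔ (no ¬a) (yes b) f g = ⊥-elim (¬a (g b))
⌊⌋-⇔ (no ¬a) (no _)  f g = refl

-- Indicator functions and finite sums of integers

ind : Bool → ℤ
ind b = if b then + 1 else + 0

ind-yes : ∀ {A : Set} (d : Dec A) → A → ind ⌊ d ⌋ ≡ 1ℤ
ind-yes (yes _) _ = refl
ind-yes (no ¬a) a = ⊥-elim (¬a a)

ind-no : ∀ {A : Set} (d : Dec A) → ¬ A → ind ⌊ d ⌋ ≡ 0ℤ
ind-no (yes a) ¬a = ⊥-elim (¬a a)
ind-no (no _) _ = refl

ind-⇔ : ∀ {A B : Set} (d : Dec A) (d′ : Dec B) → (A → B) → (B → A) → ind ⌊ d ⌋ ≡ ind ⌊ d′ ⌋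
ind-⇔ (yes a) d′ f g = sym (ind-yes d′ (f a))
ind-⇔ (no ¬a) d′ f g = sym (ind-no d′ (¬a ∘ g))

∑-cong : ∀ {m} {f g : Fin m → ℤ} → (∀ i → f i ≡ g i) → ∑ f ≡ ∑ g
∑-cong {zero}  e = refl
∑-cong {suc m} e = cong₂ _+_ (e Fin.zero) (∑-cong (e ∘ Fin.suc))

∑-zero : ∀ {m} {f : Fin m → ℤ} → (∀ i → f i ≡ 0ℤ) → ∑ f ≡ 0ℤ
∑-zero {zero}  e = refl
∑-zero {suc m} e = cong₂ _+_ (e Fin.zero) (∑-zero (e ∘ Fin.suc))

∑-+ : ∀ {m} (f g : Fin m → ℤ) → ∑ (λ i → f i + g i) ≡ ∑ f + ∑ g
∑-+ {zero}  f g = refl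
∑-+ {suc m} f g = trans (cong (_+_ (f Fin.zero + g Fin.zero)) (∑-+ (f ∘ Fin.suc) (g ∘ Fin.suc)))
  (interchange (f Fin.zero) (g Fin.zero) (∑ (f ∘ Fin.suc)) (∑ (g ∘ Fin.suc)))
  where
  interchange : ∀ a b c d → a + b + (c + d) ≡ a + c + (b + d)
  interchange = solve-∀

∑-*ˡ : ∀ {m} (c : ℤ) (f : Fin m → ℤ) → ∑ (λ i → c * f i) ≡ c * ∑ f
∑-*ˡ {zero}  c f = sym (ℤP.*-zeroʳ c)
∑-*ˡ {suc m} c f = trans (cong (_+_ (c * f Fin.zero)) (∑-*ˡ c (f ∘ Fin.suc))) (sym (ℤP.*-distribˡ-+ c (f Fin.zero) (∑ (f ∘ Fin.suc))))

∑-*ʳ : ∀ {m} (f : Fin m → ℤ) (c : ℤ) → ∑ (λ i → f i * c) ≡ ∑ f * c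
∑-*ʳ f c = trans (∑-cong (λ i → ℤP.*-comm (f i) c)) (trans (∑-*ˡ c f) (ℤP.*-comm c (∑ f)))

∑-neg : ∀ {m} (f : Fin m → ℤ) → ∑ (λ i → - f i) ≡ - ∑ f
∑-neg f = trans (∑-cong (λ i → sym (ℤP.-1*i≡-i (f i)))) (trans (∑-*ˡ (- 1ℤ) f) (ℤP.-1*i≡-i (∑ f)))

∑-− : ∀ {m} (f g : Fin m → ℤ) → ∑ (λ i → f i - g i) ≡ ∑ f - ∑ g
∑-− f g = trans (∑-+ f (λ i → - g i)) (cong (_+_ (∑ f)) (∑-neg g))

∑-const : ∀ m (c : ℤ) → ∑ {m} (λ _ → c) ≡ + m * c
∑-const zero    c = sym (ℤP.*-zeroˡ c)
∑-const (suc m) c = trans (cong (_+_ c) (∑-const m c)) (sym (ℤP.suc-* (+ m) c))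

∑-swap : ∀ {m k} (f : Fin m → Fin k → ℤ) → ∑ (λ i → ∑ (f i)) ≡ ∑ (λ j → ∑ (λ i → f i j))
∑-swap {zero}  {k} f = sym (∑-zero {k} (λ _ → refl))
∑-swap {suc m} {k} f = trans (cong (_+_ (∑ (f Fin.zero))) (∑-swap (f ∘ Fin.suc)))
  (sym (∑-+ (f Fin.zero) (λ j → ∑ (λ i → f (Fin.suc i) j))))

∑-unique : ∀ {m} (f : Fin m → ℤ) (i : Fin m) → (∀ j → ¬ i ≡ j → f j ≡ 0ℤ) → ∑ f ≡ f i
∑-unique {suc m} f Fin.zero e =
  trans (cong (_+_ (f Fin.zero)) (∑-zero (λ j → e (Fin.suc j) λ ()))) (ℤP.+-identityʳ (f Fin.zero))
∑-unique {suc m} f (Fin.suc i) e =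
  trans (cong₂ _+_ (e Fin.zero λ ()) (∑-unique (f ∘ Fin.suc) i (λ j ne → e (Fin.suc j) (λ { refl → ne refl }))))
    (ℤP.+-identityˡ (f (Fin.suc i)))

∑-δ : ∀ {m} (i : Fin m) (f : Fin m → ℤ) → ∑ (λ j → ind ⌊ i ≟ j ⌋ * f j) ≡ f i
∑-δ i f = trans (∑-unique _ i (λ j ne → cong (_* f j) (ind-no (i ≟ j) ne)))
  (trans (cong (_* f i) (ind-yes (i ≟ i) refl)) (ℤP.*-identityˡ (f i)))

∑-δʳ : ∀ {m} (i : Fin m) (f : Fin m → ℤ) → ∑ (λ j → f j * ind ⌊ j ≟ i ⌋) ≡ f i
∑-δʳ i f = trans (∑-cong (λ j → trans (ℤP.*-comm (f j) _)
    (cong (_* f j) (ind-⇔ (j ≟ i) (i ≟ j) sym sym)))) (∑-δ i f)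

∑-bij : ∀ {m k} (σ : Fin m → Fin k) (τ : Fin k → Fin m) → (∀ i → τ (σ i) ≡ i) → (∀ j → σ (τ j) ≡ j) →
  (f : Fin k → ℤ) → ∑ (f ∘ σ) ≡ ∑ f
∑-bij σ τ τσ στ f = begin
  ∑ (λ i → f (σ i))                                  ≡⟨ ∑-cong (λ i → ∑-δ (σ i) f) ⟨
  ∑ (λ i → ∑ (λ j → ind ⌊ σ i ≟ j ⌋ * f j))          ≡⟨ ∑-swap (λ i j → ind ⌊ σ i ≟ j ⌋ * f j) ⟩
  ∑ (λ j → ∑ (λ i → ind ⌊ σ i ≟ j ⌋ * f j))
    ≡⟨ ∑-cong (λ j → ∑-cong (λ i → cong (_* f j)
        (ind-⇔ (σ i ≟ j) (τ j ≟ i) (λ { refl → τσ i }) (λ { refl → στ j })))) ⟩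
  ∑ (λ j → ∑ (λ i → ind ⌊ τ j ≟ i ⌋ * f j))          ≡⟨ ∑-cong (λ j → ∑-δ (τ j) (λ _ → f j)) ⟩
  ∑ f ∎
  where open ≡-Reasoning

-- Iterates of a self-map and orbit representatives

iter : {A : Set} → (A → A) → ℕ → A → A
iter f zero    x = x
iter f (suc k) x = f (iter f k x)

module _ {A : Set} (f : A → A) where

  iter-+ : ∀ i j x → iter f (i ℕ.+ j) x ≡ iter f i (iter f j x)
  iter-+ zero    j x = refl
  iter-+ (suc i) j x = cong f (iter-+ i j x)

  iter-comm : ∀ i j x → iter f i (iter f j x) ≡ iter f j (iter f i x)
  iter-comm i j x = trans (sym (iter-+ i j x)) (trans (cong (λ k → iter f k x) (ℕP.+-comm i j)) (iter-+ j i x))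

  iter-suc : ∀ k x → iter f (suc k) x ≡ iter f k (f x)
  iter-suc k x = iter-comm 1 k x

  iter-fix : ∀ k {x} → f x ≡ x → iter f k x ≡ x
  iter-fix zero    e = refl
  iter-fix (suc k) e = trans (cong f (iter-fix k e)) e

  iter-* : ∀ i j {x} → iter f j x ≡ x → iter f (i ℕ.* j) x ≡ x
  iter-* zero    j e = refl
  iter-* (suc i) j {x} e = trans (iter-+ j (i ℕ.* j) x) (trans (cong (iter f j) (iter-* i j e)) e)

iter-map : {A B : Set} (h : A → B) {f : A → A} {g : B → B} → (∀ x → h (f x) ≡ g (h x)) →
  ∀ k x → h (iter f k x) ≡ iter g k (h x)
iter-map h e zero    x = refl
iter-map h {g = g} e (suc k) x = trans (e _) (cong g (iter-map h e k x))

-- The first index satisfying a Boolean predicate; it depends only on the extension of the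
-- predicate, which makes it a canonical choice of orbit representatives.

first : ∀ {m} → (Fin m → Bool) → Fin m → Fin m
first {suc m} P d = if P Fin.zero then Fin.zero else go d
  where
  go : Fin (suc m) → Fin (suc m)
  go Fin.zero    = Fin.zero
  go (Fin.suc d) = Fin.suc (first (P ∘ Fin.suc) d)

first-sat : ∀ {m} (P : Fin m → Bool) (d : Fin m) → T (P d) → T (P (first P d))
first-sat {suc m} P d pd with P Fin.zero in eq
first-sat {suc m} P Fin.zero    pd | true  = subst T (sym eq) _
first-sat {suc m} P (Fin.suc d) pd | true  = subst T (sym eq) _
first-sat {suc m} P Fin.zero    pd | false = ⊥-elim (subst T eq pd)
first-sat {suc m} P (Fin.suc d) pd | false = first-sat (P ∘ Fin.suc) d pd

first-cong : ∀ {m} (P Q : Fin m → Bool) (d d′ : Fin m) → (∀ i → P i ≡ Q i) → T (P d) → T (Q d′) →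
  first P d ≡ first Q d′
first-cong {suc m} P Q d d′ e pd qd′ with P Fin.zero in eqP | Q Fin.zero in eqQ
... | true  | true  = refl
... | true  | false = ⊥-elim (subst T (trans (sym eqP) (trans (e Fin.zero) eqQ)) _)
... | false | true  = ⊥-elim (subst T (trans (sym eqQ) (trans (sym (e Fin.zero)) eqP)) _)
first-cong {suc m} P Q Fin.zero    d′           e pd qd′ | false | false = ⊥-elim (subst T eqP pd)
first-cong {suc m} P Q (Fin.suc d) Fin.zero     e pd qd′ | false | false = ⊥-elim (subst T eqQ qd′)
first-cong {suc m} P Q (Fin.suc d) (Fin.suc d′) e pd qd′ | false | false =
  cong Fin.suc (first-cong (P ∘ Fin.suc) (Q ∘ Fin.suc) d d′ (e ∘ Fin.suc) pd qd′)

module Representative {m} {R : Fin m → Fin m → Set} (R? : ∀ i j → Dec (R i j)) (R-refl : ∀ i → R i i) where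

  abstract
    rep : Fin m → Fin m
    rep i = first (λ j → ⌊ R? i j ⌋) i

    rep-R : ∀ i → R i (rep i)
    rep-R i = T-⌊⌋ (R? i (rep i)) (first-sat (λ j → ⌊ R? i j ⌋) i (⌊⌋-T (R? i i) (R-refl i)))

    rep-cong : ∀ i i′ → (∀ j → R i j → R i′ j) → (∀ j → R i′ j → R i j) → rep i ≡ rep i′
    rep-cong i i′ f g = first-cong (λ j → ⌊ R? i j ⌋) (λ j → ⌊ R? i′ j ⌋) i i′
      (λ j → ⌊⌋-⇔ (R? i j) (R? i′ j) (f j) (g j)) (⌊⌋-T (R? i i) (R-refl i)) (⌊⌋-T (R? i′ i′) (R-refl i′))

-- Permutations as tables and their inverses

Inj : ∀ {n} → Perm n → Set
Inj g = ∀ x y → lookup g x ≡ lookup g y → x ≡ y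

module _ {n : ℕ} (g : Perm n) where

  private
    test : Fin n → Fin n → Bool
    test i j = (i == j) ∨ not (lookup g i == lookup g j)

  isBijective⇒Inj : T (isBijective g) → Inj g
  isBijective⇒Inj b x y e with Equivalence.to T-∨ (All.lookup (AllP.all⁺ (test x) (allFin n)
      (All.lookup (AllP.all⁺ (λ i → all (test i) (allFin n)) (allFin n) b) (∈-allFin x))) (∈-allFin y))
  ... | inj₁ t = T-⌊⌋ (x ≟ y) t
  ... | inj₂ t = ⊥-elim (T-not⌊⌋ (lookup g x ≟ lookup g y) t e)

  Inj⇒isBijective : Inj g → T (isBijective g)
  Inj⇒isBijective inj = AllP.all⁻ (λ i → all (test i) (allFin n)) (All.tabulate {xs = allFin n} λ {i} _ →
    AllP.all⁻ (test i) (All.tabulate {xs = allFin n} λ {j} _ → ok i j))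
    where
    ok : ∀ i j → T (test i j)
    ok i j with i ≟ j
    ... | yes _ = tt
    ... | no ne = not⌊⌋-T (lookup g i ≟ lookup g j) (ne ∘ inj i j)

-- If `y` were missed, punching it out would inject `suc n` elements into `n`.
injective⇒hits : ∀ {n} (f : Fin n → Fin n) → (∀ x y → f x ≡ f y → x ≡ y) → ∀ y → ∃ λ x → f x ≡ y
injective⇒hits {suc n} f inj y with FinP.any? (λ x → f x ≟ y)
... | yes p = p
... | no ¬p = ⊥-elim (ℕP.1+n≰n (FinP.injective⇒≤ {f = λ x → Fin.punchOut (ne x)}
    (λ {x} {x′} e → inj x x′ (FinP.punchOut-injective (ne x) (ne x′) e))))
  where
  ne : ∀ x → ¬ y ≡ f x
  ne x e = ¬p (x , sym e)

Inj⇒hits : ∀ {n} (g : Perm n) → Inj g → ∀ y → ∃ λ x → lookup g x ≡ y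
Inj⇒hits g = injective⇒hits (lookup g)

module _ {n : ℕ} (g : Perm n) (j : Fin n) where

  -- Stated for any `F` satisfying the recursion, since the search function itself has no name
  -- outside the definition of `invP`. Membership of `i` rules out the default value at the empty
  -- list.
  search-correct : (F : List (Fin n) → Fin n) →
    (∀ i is → F (i ∷ is) ≡ (if lookup g i == j then i else F is)) →
    ∀ xs i → lookup g i ≡ j → i ∈ xs → lookup g (F xs) ≡ j
  search-correct F eqn (x ∷ xs) i e mem rewrite eqn x xs with lookup g x ≟ j
  ... | yes p = p
  search-correct F eqn (x ∷ xs) .x e (here refl) | no ¬p = ⊥-elim (¬p e)
  search-correct F eqn (x ∷ xs) i  e (there mem) | no ¬p = search-correct F eqn xs i e mem

  -- The search function local to the definition of [invP] cannot be named; it is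
  -- recovered here by unification.
  mutual
    search : List (Fin n) → Fin n
    search = _

    lookup-invP : ∀ i → lookup g i ≡ j → lookup g (lookup (invP g) j) ≡ j
    lookup-invP i e with allFin n | ∈-allFin i
    ... | xs | i∈ = trans (cong (lookup g) (lookup∘tabulate _ j)) (search-correct search (λ _ _ → refl) xs i e i∈)

_∙_ : ∀ {n} → Perm n → Fin n → Fin n
g ∙ x = lookup g x

_⁻¹ : ∀ {n} → Perm n → Perm n
_⁻¹ = invP

infixr 8 _∙_
infix 9 _⁻¹

∘P-∙ : ∀ {n} (g h : Perm n) x → (g ∘P h) ∙ x ≡ g ∙ h ∙ x
∘P-∙ g h x = lookup∘tabulate (λ i → lookup g (lookup h i)) x

idP-∙ : ∀ {n} (x : Fin n) → idP ∙ x ≡ x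
idP-∙ x = lookup∘tabulate (λ i → i) x

perm-ext : ∀ {k} {n} (g h : Vec (Fin n) k) → (∀ x → lookup g x ≡ lookup h x) → g ≡ h
perm-ext g h e = trans (sym (tabulate∘lookup g)) (trans (tabulate-cong e) (tabulate∘lookup h))

module _ {n : ℕ} (g : Perm n) (inj : Inj g) where

  inverseʳ : ∀ x → g ∙ g ⁻¹ ∙ x ≡ x
  inverseʳ x = let (y , e) = Inj⇒hits g inj x in lookup-invP g x y e

  inverseˡ : ∀ x → g ⁻¹ ∙ g ∙ x ≡ x
  inverseˡ x = inj _ _ (inverseʳ (g ∙ x))

  ⁻¹-Inj : Inj (g ⁻¹)
  ⁻¹-Inj x y e = trans (sym (inverseʳ x)) (trans (cong (g ∙_) e) (inverseʳ y))

  ⁻¹-unique : (h : Fin n → Fin n) → (∀ x → h (g ∙ x) ≡ x) → ∀ x → g ⁻¹ ∙ x ≡ h x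
  ⁻¹-unique h e x = trans (sym (e _)) (cong h (inverseʳ x))

  ∑-perm : (f : Fin n → ℤ) → ∑ (λ x → f (g ∙ x)) ≡ ∑ f
  ∑-perm f = ∑-bij (g ∙_) (g ⁻¹ ∙_) inverseˡ inverseʳ f

∘P-Inj : ∀ {n} (g h : Perm n) → Inj g → Inj h → Inj (g ∘P h)
∘P-Inj g h ig ih x y e = ih x y (ig _ _ (trans (sym (∘P-∙ g h x)) (trans e (∘P-∙ g h y))))

idP-Inj : ∀ {n} → Inj (idP {n})
idP-Inj x y e = trans (sym (idP-∙ x)) (trans e (idP-∙ y))

idP⁻¹ : ∀ {n} (x : Fin n) → idP ⁻¹ ∙ x ≡ x
idP⁻¹ = ⁻¹-unique idP idP-Inj id idP-∙

∘P-⁻¹ : ∀ {n} (g h : Perm n) → Inj g → Inj h → ∀ x → (g ∘P h) ⁻¹ ∙ x ≡ h ⁻¹ ∙ g ⁻¹ ∙ x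
∘P-⁻¹ g h ig ih = ⁻¹-unique (g ∘P h) (∘P-Inj g h ig ih) (λ x → h ⁻¹ ∙ g ⁻¹ ∙ x)
  (λ x → trans (cong (λ z → h ⁻¹ ∙ g ⁻¹ ∙ z) (∘P-∙ g h x)) (trans (cong (h ⁻¹ ∙_) (inverseˡ g ig (h ∙ x))) (inverseˡ h ih x)))

-- Parity of the number of inversions

+sum-tabulate : ∀ {m} (f : Fin m → ℕ) → + sum (List.tabulate f) ≡ ∑ (λ i → + f i)
+sum-tabulate {zero}  f = refl
+sum-tabulate {suc m} f = trans (ℤP.pos-+ (f Fin.zero) _) (cong (_+_ (+ f Fin.zero)) (+sum-tabulate (f ∘ Fin.suc)))

+sum-allFin : ∀ {m} (f : Fin m → ℕ) → + sum (List.map f (allFin m)) ≡ ∑ (λ i → + f i)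
+sum-allFin {m} f = trans (cong (λ xs → + sum xs) (map-tabulate id f)) (+sum-tabulate f)

lt : ∀ {n} → Fin n → Fin n → ℤ
lt x y = ind (toℕ x ℕ.<ᵇ toℕ y)

lt-< : ∀ {n} {x y : Fin n} → x Fin.< y → lt x y ≡ 1ℤ
lt-< {x = x} {y} l with toℕ x ℕ.<ᵇ toℕ y | ℕP.<⇒<ᵇ l
... | true | _ = refl

lt-≮ : ∀ {n} {x y : Fin n} → ¬ x Fin.< y → lt x y ≡ 0ℤ
lt-≮ {x = x} {y} l with toℕ x ℕ.<ᵇ toℕ y in eq
... | false = refl
... | true  = ⊥-elim (l (ℕP.<ᵇ⇒< (toℕ x) (toℕ y) (subst T (sym eq) tt)))

lt-flip : ∀ {n} (x y : Fin n) → ¬ x ≡ y → lt y x ≡ 1ℤ - lt x y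
lt-flip x y ne with FinP.<-cmp x y
... | tri< a _ c = trans (lt-≮ {x = y} {x} c) (cong (_-_ 1ℤ) (sym (lt-< {x = x} {y} a)))
... | tri≈ _ b _ = ⊥-elim (ne b)
... | tri> a _ c = trans (lt-< {x = y} {x} c) (cong (_-_ 1ℤ) (sym (lt-≮ {x = x} {y} a)))

+inversions : ∀ {n} (g : Perm n) → + inversions g ≡ ∑ (λ i → ∑ (λ j → lt i j * lt (g ∙ j) (g ∙ i)))
+inversions {n} g = trans (+sum-allFin (λ i → sum (List.map (entry i) (allFin n)))) (∑-cong λ i → trans (+sum-allFin (entry i)) (∑-cong λ j →
  ∧-ind (toℕ i ℕ.<ᵇ toℕ j) (toℕ (lookup g j) ℕ.<ᵇ toℕ (lookup g i))))
  where
  entry : Fin n → Fin n → ℕ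
  entry i j = if (toℕ i ℕ.<ᵇ toℕ j) ∧ (toℕ (lookup g j) ℕ.<ᵇ toℕ (lookup g i)) then 1 else 0
  ∧-ind : ∀ b c → + (if b ∧ c then 1 else 0) ≡ ind b * ind c
  ∧-ind true  true  = refl
  ∧-ind true  false = refl
  ∧-ind false true  = refl
  ∧-ind false false = refl

-- A pair is inverted by the composite when exactly one of `h` and `g` inverts it, the latter on the
-- images. So `X` counts the pairs inverted by `h` and straightened again by `g`: they occur in both
-- numbers, and in that of the composite not at all.
inversions-∘ : ∀ {n} (g h : Perm n) → Inj g → Inj h → ∃ λ X →
  + inversions (g ∘P h) ≡ + inversions h + + inversions g - + 2 * X
inversions-∘ {n} g h ig ih = ∑∑ X , (begin
  + inversions (g ∘P h)  ≡⟨ +inversions (g ∘P h) ⟩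
  ∑∑ (λ i j → lt i j * lt ((g ∘P h) ∙ j) ((g ∘P h) ∙ i))
    ≡⟨ ∑-cong (λ i → ∑-cong (λ j → cong (lt i j *_) (cong₂ lt (∘P-∙ g h j) (∘P-∙ g h i)))) ⟩
  ∑∑ (λ i j → lt i j * c j i)  ≡⟨ ∑-cong (λ i → ∑-cong (pointwise i)) ⟩
  ∑∑ (λ i j → lt i j * b j i + (lt i j * (b i j * c j i) + lt i j * (b j i * c i j)) - + 2 * X i j)
    ≡⟨ ∑∑-− (λ i j → lt i j * b j i + (lt i j * (b i j * c j i) + lt i j * (b j i * c i j))) (λ i j → + 2 * X i j) ⟩
  ∑∑ (λ i j → lt i j * b j i + (lt i j * (b i j * c j i) + lt i j * (b j i * c i j))) - ∑∑ (λ i j → + 2 * X i j)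
    ≡⟨ cong₂ _-_ (trans (∑∑-+ (λ i j → lt i j * b j i) (λ i j → lt i j * (b i j * c j i) + lt i j * (b j i * c i j)))
         (cong₂ _+_ (sym (+inversions h)) regroup))
         (trans (∑-cong (λ i → ∑-*ˡ (+ 2) (X i))) (∑-*ˡ (+ 2) (λ i → ∑ (X i)))) ⟩
  + inversions h + + inversions g - + 2 * ∑∑ X ∎)
  where
  open ≡-Reasoning
  ∑∑ : (Fin n → Fin n → ℤ) → ℤ
  ∑∑ f = ∑ (λ i → ∑ (f i))
  ∑∑-+ : ∀ f f′ → ∑∑ (λ i j → f i j + f′ i j) ≡ ∑∑ f + ∑∑ f′
  ∑∑-+ f f′ = trans (∑-cong (λ i → ∑-+ (f i) (f′ i))) (∑-+ (∑ ∘ f) (∑ ∘ f′))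
  ∑∑-− : ∀ f f′ → ∑∑ (λ i j → f i j - f′ i j) ≡ ∑∑ f - ∑∑ f′
  ∑∑-− f f′ = trans (∑-cong (λ i → ∑-− (f i) (f′ i))) (∑-− (∑ ∘ f) (∑ ∘ f′))
  b c X : Fin n → Fin n → ℤ
  b i j = lt (h ∙ i) (h ∙ j)
  c i j = lt (g ∙ h ∙ i) (g ∙ h ∙ j)
  X i j = lt i j * (b j i * c i j)
  alg : ∀ a b c → a * (1ℤ - c) ≡
    a * (1ℤ - b) + (a * (b * (1ℤ - c)) + a * ((1ℤ - b) * c)) - + 2 * (a * ((1ℤ - b) * c))
  alg = solve-∀
  pointwise : ∀ i j → lt i j * c j i ≡
    lt i j * b j i + (lt i j * (b i j * c j i) + lt i j * (b j i * c i j)) - + 2 * X i j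
  pointwise i j with i ≟ j
  ... | yes refl rewrite lt-≮ {x = i} {i} (ℕP.<-irrefl refl) = refl
  ... | no ne rewrite lt-flip (h ∙ i) (h ∙ j) (ne ∘ ih i j)
                    | lt-flip (g ∙ h ∙ i) (g ∙ h ∙ j) (ne ∘ ih i j ∘ ig _ _) =
    alg (lt i j) (lt (h ∙ i) (h ∙ j)) (lt (g ∙ h ∙ i) (g ∙ h ∙ j))
  pair : ∀ i j → lt i j * (b i j * c j i) + lt j i * (b i j * c j i) ≡ b i j * c j i
  pair i j with i ≟ j
  ... | yes refl rewrite lt-≮ {x = h ∙ i} {h ∙ i} (ℕP.<-irrefl refl) =
    cong₂ _+_ (ℤP.*-zeroʳ (lt i i)) (ℤP.*-zeroʳ (lt i i))
  ... | no ne rewrite lt-flip i j ne = split (lt i j) (b i j * c j i)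
    where
    split : ∀ x y → x * y + (1ℤ - x) * y ≡ y
    split = solve-∀
  -- Swapping the two indices merges the pairs with i < j and those with j < i into a sum over all
  -- ordered pairs, which can then be reindexed along `h`.
  regroup : ∑∑ (λ i j → lt i j * (b i j * c j i) + lt i j * (b j i * c i j)) ≡ + inversions g
  regroup = begin
    ∑∑ (λ i j → lt i j * (b i j * c j i) + lt i j * (b j i * c i j))
      ≡⟨ ∑∑-+ (λ i j → lt i j * (b i j * c j i)) (λ i j → lt i j * (b j i * c i j)) ⟩
    ∑∑ (λ i j → lt i j * (b i j * c j i)) + ∑∑ (λ i j → lt i j * (b j i * c i j))
      ≡⟨ cong (_+_ (∑∑ (λ i j → lt i j * (b i j * c j i)))) (∑-swap (λ i j → lt i j * (b j i * c i j))) ⟩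
    ∑∑ (λ i j → lt i j * (b i j * c j i)) + ∑∑ (λ i j → lt j i * (b i j * c j i))
      ≡⟨ ∑∑-+ (λ i j → lt i j * (b i j * c j i)) (λ i j → lt j i * (b i j * c j i)) ⟨
    ∑∑ (λ i j → lt i j * (b i j * c j i) + lt j i * (b i j * c j i))
      ≡⟨ ∑-cong (λ i → ∑-cong (pair i)) ⟩
    ∑∑ (λ i j → b i j * c j i)
      ≡⟨ ∑-cong (λ i → ∑-perm h ih (λ v → lt (h ∙ i) v * lt (g ∙ v) (g ∙ h ∙ i))) ⟩
    ∑ (λ i → ∑ (λ v → lt (h ∙ i) v * lt (g ∙ v) (g ∙ h ∙ i)))
      ≡⟨ ∑-perm h ih (λ u → ∑ (λ v → lt u v * lt (g ∙ v) (g ∙ u))) ⟩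
    ∑∑ (λ u v → lt u v * lt (g ∙ v) (g ∙ u)) ≡⟨ +inversions g ⟨
    + inversions g ∎

isEven⇒ : ∀ {n} (g : Perm n) → T (isEven g) → ∃ λ z → + inversions g ≡ + 2 * z
isEven⇒ g e = + (inversions g ℕ./ 2) , trans (cong +_ (trans (m≡m%n+[m/n]*n (inversions g) 2)
    (cong (ℕ._+ (inversions g ℕ./ 2 ℕ.* 2)) (ℕP.≡ᵇ⇒≡ _ 0 e))))
  (trans (ℤP.pos-* (inversions g ℕ./ 2) 2) (ℤP.*-comm (+ (inversions g ℕ./ 2)) (+ 2)))

isEven⇐ : ∀ {n} (g : Perm n) z → + inversions g ≡ + 2 * z → T (isEven g)
isEven⇐ g z e = ℕP.≡⇒≡ᵇ (inversions g ℕ.% 2) 0 (trans (cong (ℕ._% 2) eq) (m*n%n≡0 ∣ z ∣ 2))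
  where
  eq : inversions g ≡ ∣ z ∣ ℕ.* 2
  eq = trans (cong ∣_∣ e) (trans (ℤP.abs-* (+ 2) z) (ℕP.*-comm 2 ∣ z ∣))

-- The alternating group and its transitivity

InA⇒Inj : ∀ {n} (g : Perm n) → InA g → Inj g
InA⇒Inj g a = isBijective⇒Inj g (proj₁ (Equivalence.to T-∧ a))

InA-∘ : ∀ {n} (g h : Perm n) → InA g → InA h → InA (g ∘P h)
InA-∘ g h ag ah = Equivalence.from T-∧ (Inj⇒isBijective (g ∘P h) (∘P-Inj g h (InA⇒Inj g ag) (InA⇒Inj h ah)) , even)
  where
  alg : ∀ y z X → + 2 * y + + 2 * z - + 2 * X ≡ + 2 * (y + z - X)
  alg = solve-∀
  even : T (isEven (g ∘P h))
  even =
    let (X , e) = inversions-∘ g h (InA⇒Inj g ag) (InA⇒Inj h ah)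
        (z , eg) = isEven⇒ g (proj₂ (Equivalence.to (T-∧ {isBijective g}) ag))
        (y , eh) = isEven⇒ h (proj₂ (Equivalence.to (T-∧ {isBijective h}) ah))
    in isEven⇐ (g ∘P h) (y + z - X) (trans e (trans (cong₂ (λ u v → u + v - + 2 * X) eh eg) (alg y z X)))

InA-square : ∀ {n} (g : Perm n) → Inj g → InA (g ∘P g)
InA-square g ig = Equivalence.from T-∧ (Inj⇒isBijective (g ∘P g) (∘P-Inj g g ig ig) ,
  (let (X , e) = inversions-∘ g g ig ig in isEven⇐ (g ∘P g) (+ inversions g - X) (trans e (alg (+ inversions g) X))))
  where
  alg : ∀ y X → y + y - + 2 * X ≡ + 2 * (y - X)
  alg = solve-∀

InA-irrelevant : ∀ {n} {g : Perm n} (a b : InA g) → a ≡ b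
InA-irrelevant {g = g} a b = T-irrelevant a b

-- Evenness of explicit permutations is certified below by a square root, so that no inversions have
-- to be counted.
InA-of-square : ∀ {n} (c s : Fin n → Fin n) → (∀ x y → c x ≡ c y → x ≡ y) → (∀ x → c (c x) ≡ s x) → InA (tabulate s)
InA-of-square c s inj e = subst InA eq (InA-square (tabulate c) inj′)
  where
  inj′ : Inj (tabulate c)
  inj′ x y q = inj x y (trans (sym (lookup∘tabulate c x)) (trans q (lookup∘tabulate c y)))
  eq : tabulate c ∘P tabulate c ≡ tabulate s
  eq = tabulate-cong (λ x → trans (lookup∘tabulate c _) (trans (cong c (lookup∘tabulate c x)) (e x)))

lookup-injective : ∀ {A : Set} {xs : List A} → Unique xs → ∀ i j → List.lookup xs i ≡ List.lookup xs j → i ≡ j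
lookup-injective {xs = x ∷ xs} (px AllPairs.∷ u) Fin.zero    Fin.zero    e = refl
lookup-injective {xs = x ∷ xs} (px AllPairs.∷ u) Fin.zero    (Fin.suc j) e = ⊥-elim (All.lookup px (∈-lookup j) e)
lookup-injective {xs = x ∷ xs} (px AllPairs.∷ u) (Fin.suc i) Fin.zero    e = ⊥-elim (All.lookup px (∈-lookup i) (sym e))
lookup-injective {xs = x ∷ xs} (px AllPairs.∷ u) (Fin.suc i) (Fin.suc j) e = cong Fin.suc (lookup-injective u i j e)

allTables-complete : ∀ n k (v : Vec (Fin n) k) → v ∈ allTables n k
allTables-complete n zero    Vec.[] = here refl
allTables-complete n (suc k) (i Vec.∷ v) = ∈-concatMap⁺ (λ i → List.map (i Vec.∷_) (allTables n k)) {xs = allFin n}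
  (Any.map (λ { refl → ∈-map⁺ (i Vec.∷_) (allTables-complete n k v) }) (∈-allFin i))

altList-complete : ∀ {n} (g : Perm n) → InA g → g ∈ altList n
altList-complete {n} g a = ∈-filter⁺ (λ g → T? (isAlt g)) (allTables-complete n n g) a

transpose-ˡ : ∀ {n} (i j : Fin n) → PC.transpose i j i ≡ j
transpose-ˡ i j with i ≟ i
... | yes _ = refl
... | no ne = ⊥-elim (ne refl)

transpose-≢ : ∀ {n} (i j k : Fin n) → ¬ k ≡ i → ¬ k ≡ j → PC.transpose i j k ≡ k
transpose-≢ i j k ki kj with k ≟ i
... | yes e = ⊥-elim (ki e)
... | no _ with k ≟ j
...   | yes e = ⊥-elim (kj e)
...   | no _  = refl

transpose-injective : ∀ {n} (i j x y : Fin n) → PC.transpose i j x ≡ PC.transpose i j y → x ≡ y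
transpose-injective i j x y e = trans (sym (PC.transpose-inverse j i)) (trans (cong (PC.transpose j i) e) (PC.transpose-inverse j i))

third : ∀ {k} (x y : Fin (suc (suc (suc k)))) → ∃ λ z → ¬ z ≡ x × ¬ z ≡ y
third Fin.zero Fin.zero = Fin.suc Fin.zero , (λ ()) , (λ ())
third Fin.zero (Fin.suc Fin.zero) = Fin.suc (Fin.suc Fin.zero) , (λ ()) , (λ ())
third Fin.zero (Fin.suc (Fin.suc y)) = Fin.suc Fin.zero , (λ ()) , (λ ())
third (Fin.suc Fin.zero) Fin.zero = Fin.suc (Fin.suc Fin.zero) , (λ ()) , (λ ())
third (Fin.suc x) (Fin.suc y) = Fin.zero , (λ ()) , (λ ())
third (Fin.suc (Fin.suc x)) Fin.zero = Fin.suc Fin.zero , (λ ()) , (λ ())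

-- A three-cycle is the square of its inverse.
alternating-transitive : ∀ {k} (x y : Fin (suc (suc (suc k)))) → ¬ y ≡ x → ∃ λ g → InA g × g ∙ x ≡ y
alternating-transitive {k} x y y≢x = tabulate (c ∘ c) ,
  InA-of-square c (c ∘ c) (λ u v → transpose-injective z y u v ∘ transpose-injective x z _ _) (λ _ → refl) ,
  trans (lookup∘tabulate (c ∘ c) x) (trans (cong c cx≡z) cz≡y)
  where
  z = proj₁ (third x y)
  z≢x = proj₁ (proj₂ (third x y))
  z≢y = proj₂ (proj₂ (third x y))
  c : Fin (suc (suc (suc k))) → Fin (suc (suc (suc k)))
  c u = PC.transpose x z (PC.transpose z y u)
  cx≡z : c x ≡ z
  cx≡z = trans (cong (PC.transpose x z) (transpose-≢ z y x (z≢x ∘ sym) (y≢x ∘ sym))) (transpose-ˡ x z)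
  cz≡y : c z ≡ y
  cz≡y = trans (cong (PC.transpose x z) (transpose-ˡ z y)) (transpose-≢ x z y y≢x (z≢y ∘ sym))

-- A lattice of functions on the letters modulo constants, given by the values of the
-- representative vanishing at a base letter.
record FunctionsModConstants (n : ℕ) : Set where
  field
    lattice     : RawLattice n
    a           : Fin n
    b           : Fin (rank lattice) → Fin n
    b≢a         : ∀ l → ¬ b l ≡ a
    b-injective : ∀ i j → b i ≡ b j → i ≡ j
    b-hits      : ∀ x → ¬ x ≡ a → ∃ λ l → b l ≡ x

  r : ℕ
  r = rank lattice

  ext : Vect r → Fin n → ℤ
  ext w x = ∑ (λ l → ind ⌊ x ≟ b l ⌋ * w l)

  res : (Fin n → ℤ) → Vect r
  res f l = f (b l) - f a

  field
    act-res : ∀ g w l → (act lattice g ⊛ w) l ≡ res (λ x → ext w (g ⁻¹ ∙ x)) l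

  ext-cong : ∀ {u v : Vect r} → (∀ l → u l ≡ v l) → ∀ x → ext u x ≡ ext v x
  ext-cong e x = ∑-cong (λ l → cong (ind ⌊ x ≟ b l ⌋ *_) (e l))

  ext-a : ∀ w → ext w a ≡ 0ℤ
  ext-a w = ∑-zero (λ l → cong (_* w l) (ind-no (a ≟ b l) (b≢a l ∘ sym)))

  ext-b : ∀ w l → ext w (b l) ≡ w l
  ext-b w l = trans (∑-cong (λ i → cong (_* w i) (ind-⇔ (b l ≟ b i) (l ≟ i) (b-injective l i) (cong b)))) (∑-δ l w)

  ext-res : ∀ f x → ext (res f) x ≡ f x - f a
  ext-res f x with x ≟ a
  ... | yes refl = trans (ext-a (res f)) (sym (ℤP.+-inverseʳ (f a)))
  ... | no x≢a with b-hits x x≢a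
  ...   | l , refl = ext-b (res f) l

  res-ext : ∀ w l → res (ext w) l ≡ w l
  res-ext w l = trans (cong₂ _-_ (ext-b w l) (ext-a w)) (ℤP.+-identityʳ (w l))

  ext-act : ∀ g w x → ext (act lattice g ⊛ w) x ≡ ext w (g ⁻¹ ∙ x) - ext w (g ⁻¹ ∙ a)
  ext-act g w x = trans (ext-cong (act-res g w) x) (ext-res (λ x → ext w (g ⁻¹ ∙ x)) x)

module _ (k : ℕ) where

  open Coset (suc (suc k)) using (a; b; others; inOrbit; δ; n)

  private
    isOther : Fin n → Bool
    isOther x = not (x == a) ∧ inOrbit x

    -- By transitivity, for which three letters are needed: A₂ is trivial.
    inOrbit-all : ∀ x → ¬ x ≡ a → T (inOrbit x)
    inOrbit-all x x≢a = let (g , ag , ga≡x) = alternating-transitive a x x≢a in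
      AnyP.any⁺ (λ g → lookup g a == x)
        (Any.map (λ {h} g≡h → subst (λ h → T (lookup h a == x)) g≡h (⌊⌋-T (lookup g a ≟ x) ga≡x)) (altList-complete g ag))

    others-complete : ∀ x → ¬ x ≡ a → x ∈ others
    others-complete x x≢a = ∈-filter⁺ (λ x → T? (isOther x)) (∈-allFin x)
      (Equivalence.from T-∧ (not⌊⌋-T (x ≟ a) x≢a , inOrbit-all x x≢a))

  -- The basis vector e_{b l} - e_a of the augmentation kernel pairs with a function f to f (b l) -
  -- f a, so the coordinates of a dual vector are the values of the function normalised to vanish at
  -- `a`. The transposed matrix of g⁻¹ substitutes g⁻¹ and then normalises again.
  J-functions : FunctionsModConstants n
  J-functions = record
    { lattice = J n
    ; a = a
    ; b = b
    ; b≢a = λ l → T-not⌊⌋ (b l ≟ a) (proj₁ (Equivalence.to (T-∧ {not (b l == a)} {inOrbit (b l)})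
        (proj₂ (∈-filter⁻ (λ x → T? (isOther x)) {xs = allFin n} (∈-lookup {xs = others} l)))))
    ; b-injective = lookup-injective (filter⁺ (λ x → T? (isOther x)) (allFin⁺ n))
    ; b-hits = λ x x≢a → Any.index (others-complete x x≢a) , sym (AnyP.lookup-index (others-complete x x≢a))
    ; act-res = λ g w l → trans (∑-cong (λ i → distrib (δ (g ⁻¹ ∙ b l) (b i)) (δ (g ⁻¹ ∙ a) (b i)) (w i)))
        (∑-− (λ i → δ (g ⁻¹ ∙ b l) (b i) * w i) (λ i → δ (g ⁻¹ ∙ a) (b i) * w i))
    }
    where
    distrib : ∀ x y z → (x - y) * z ≡ x * z - y * z
    distrib = solve-∀

-- The coordinates of the sum of the f j e_{g j}. In this form it is literally multiplication by the
-- matrix of a permutation lattice, and it makes sense before `g` is known to be bijective.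
push : ∀ {B} → (Fin B → Fin B) → (Fin B → ℤ) → Fin B → ℤ
push g f i = ∑ (λ j → ind ⌊ i ≟ g j ⌋ * f j)

push-inverse : ∀ {B} (g h : Fin B → Fin B) → (∀ i → g (h i) ≡ i) → (∀ j → h (g j) ≡ j) →
  ∀ f i → push g f i ≡ f (h i)
push-inverse g h gh hg f i = trans (∑-cong (λ j → cong (_* f j)
  (ind-⇔ (i ≟ g j) (h i ≟ j) (λ { refl → hg j }) (λ { refl → sym (gh i) })))) (∑-δ (h i) f)

*-cancelˡ-0 : ∀ k .{{_ : ℕ.NonZero k}} z → + k * z ≡ 0ℤ → z ≡ 0ℤ
*-cancelˡ-0 k@(suc _) z e with ℤP.i*j≡0⇒i≡0∨j≡0 (+ k) e
... | inj₂ z≡0 = z≡0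

-- Ĥ⁻¹ of a permutation lattice vanishes: moving all the mass of f to the orbit
-- representatives changes f by elements (g - 1) y, and nothing is left because the total
-- mass of every orbit is zero.
module _ {B K : ℕ} .{{_ : ℕ.NonZero K}} (g : Fin K → Fin B → Fin B) (ρ : Fin B → Fin B) (κ : Fin B → Fin K)
  (ρ-inv : ∀ k j → ρ (g k j) ≡ ρ j) (κ-rep : ∀ j → g (κ j) j ≡ ρ j) where

  private
    mass : Fin B → (Fin B → ℤ) → ℤ
    mass i f = ∑ (λ j → ind ⌊ i ≟ ρ j ⌋ * f j)

    mass-push : ∀ k i f → mass i (push (g k) f) ≡ mass i f
    mass-push k i f = begin
      ∑ (λ i′ → ind ⌊ i ≟ ρ i′ ⌋ * ∑ (λ j → ind ⌊ i′ ≟ g k j ⌋ * f j))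
        ≡⟨ ∑-cong (λ i′ → ∑-*ˡ (ind ⌊ i ≟ ρ i′ ⌋) (λ j → ind ⌊ i′ ≟ g k j ⌋ * f j)) ⟨
      ∑ (λ i′ → ∑ (λ j → ind ⌊ i ≟ ρ i′ ⌋ * (ind ⌊ i′ ≟ g k j ⌋ * f j)))
        ≡⟨ ∑-swap (λ i′ j → ind ⌊ i ≟ ρ i′ ⌋ * (ind ⌊ i′ ≟ g k j ⌋ * f j)) ⟩
      ∑ (λ j → ∑ (λ i′ → ind ⌊ i ≟ ρ i′ ⌋ * (ind ⌊ i′ ≟ g k j ⌋ * f j)))
        ≡⟨ ∑-cong (λ j → ∑-cong (λ i′ → reorder (ind ⌊ i ≟ ρ i′ ⌋) (ind ⌊ i′ ≟ g k j ⌋) (f j))) ⟩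
      ∑ (λ j → ∑ (λ i′ → ind ⌊ i ≟ ρ i′ ⌋ * f j * ind ⌊ i′ ≟ g k j ⌋))
        ≡⟨ ∑-cong (λ j → ∑-δʳ (g k j) (λ i′ → ind ⌊ i ≟ ρ i′ ⌋ * f j)) ⟩
      ∑ (λ j → ind ⌊ i ≟ ρ (g k j) ⌋ * f j)
        ≡⟨ ∑-cong (λ j → cong (λ z → ind ⌊ i ≟ z ⌋ * f j) (ρ-inv k j)) ⟩
      ∑ (λ j → ind ⌊ i ≟ ρ j ⌋ * f j) ∎
      where
      open ≡-Reasoning
      reorder : ∀ x y z → x * (y * z) ≡ x * z * y
      reorder = solve-∀

  coinvariants : (f : Fin B → ℤ) → (∀ i → ∑ (λ k → push (g k) f i) ≡ 0ℤ) →
    ∃ λ (y : Fin K → Fin B → ℤ) → ∀ i → f i ≡ ∑ (λ k → push (g k) (y k) i - y k i)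
  coinvariants f norm0 = y , λ i → sym (begin
    ∑ (λ k → push (g k) (y k) i - y k i)     ≡⟨ ∑-− (λ k → push (g k) (y k) i) (λ k → y k i) ⟩
    ∑ (λ k → push (g k) (y k) i) - ∑ (λ k → y k i)
      ≡⟨ cong₂ _-_ (pushed i) (kept i) ⟩
    - mass i f - - f i                        ≡⟨ cong (λ z → - z - - f i) (mass0 i) ⟩
    - 0ℤ - - f i                              ≡⟨ alg (f i) ⟩
    f i ∎)
    where
    open ≡-Reasoning
    alg : ∀ z → - 0ℤ - - z ≡ z
    alg = solve-∀
    y : Fin K → Fin B → ℤ
    y k j = ind ⌊ κ j ≟ k ⌋ * - f j
    kept : ∀ i → ∑ (λ k → y k i) ≡ - f i
    kept i = ∑-δ (κ i) (λ _ → - f i)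
    reorder : ∀ x y z → x * (y * - z) ≡ y * - (x * z)
    reorder = solve-∀
    pushed : ∀ i → ∑ (λ k → push (g k) (y k) i) ≡ - mass i f
    pushed i = begin
      ∑ (λ k → ∑ (λ j → ind ⌊ i ≟ g k j ⌋ * y k j))
        ≡⟨ ∑-swap (λ k j → ind ⌊ i ≟ g k j ⌋ * y k j) ⟩
      ∑ (λ j → ∑ (λ k → ind ⌊ i ≟ g k j ⌋ * (ind ⌊ κ j ≟ k ⌋ * - f j)))
        ≡⟨ ∑-cong (λ j → ∑-cong (λ k → reorder (ind ⌊ i ≟ g k j ⌋) (ind ⌊ κ j ≟ k ⌋) (f j))) ⟩
      ∑ (λ j → ∑ (λ k → ind ⌊ κ j ≟ k ⌋ * - (ind ⌊ i ≟ g k j ⌋ * f j)))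
        ≡⟨ ∑-cong (λ j → ∑-δ (κ j) (λ k → - (ind ⌊ i ≟ g k j ⌋ * f j))) ⟩
      ∑ (λ j → - (ind ⌊ i ≟ g (κ j) j ⌋ * f j))
        ≡⟨ ∑-cong (λ j → cong (λ z → - (ind ⌊ i ≟ z ⌋ * f j)) (κ-rep j)) ⟩
      ∑ (λ j → - (ind ⌊ i ≟ ρ j ⌋ * f j)) ≡⟨ ∑-neg (λ j → ind ⌊ i ≟ ρ j ⌋ * f j) ⟩
      - mass i f ∎
    -- A push does not change the mass of an orbit, so the mass of the vanishing norm is `K` times
    -- that of `f`.
    mass0 : ∀ i → mass i f ≡ 0ℤ
    mass0 i = *-cancelˡ-0 K (mass i f) (begin
      + K * mass i f                            ≡⟨ ∑-const K (mass i f) ⟨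
      ∑ {K} (λ k → mass i f)                    ≡⟨ ∑-cong {K} (λ k → mass-push k i f) ⟨
      ∑ {K} (λ k → mass i (push (g k) f))       ≡⟨ ∑-swap (λ k j → ind ⌊ i ≟ ρ j ⌋ * push (g k) f j) ⟩
      ∑ (λ j → ∑ (λ k → ind ⌊ i ≟ ρ j ⌋ * push (g k) f j))
        ≡⟨ ∑-zero (λ j → trans (∑-*ˡ (ind ⌊ i ≟ ρ j ⌋) (λ k → push (g k) f j))
             (trans (cong (ind ⌊ i ≟ ρ j ⌋ *_) (norm0 j)) (ℤP.*-zeroʳ (ind ⌊ i ≟ ρ j ⌋)))) ⟩
      0ℤ ∎)

-- Norms and coboundaries for commuting self-maps of order p

prime⇒coprime : ∀ {p} → Prime p → ∀ k → 0 ℕ.< k → k ℕ.< p → Coprime k p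
prime⇒coprime pr k 0<k k<p (d∣k , d∣p) with prime⇒irreducible pr d∣p
... | inj₁ d≡1 = d≡1
... | inj₂ refl = ⊥-elim (ℕP.<⇒≱ k<p (∣⇒≤ {{ℕ.>-nonZero 0<k}} d∣k))

-- Bézout. With `E k` saying that the k-th iterate fixes something, it expresses that a subgroup of
-- a cyclic group of prime order is trivial or everything.
coprime-one : (E : ℕ → Set) → E 0 → (∀ i j → E i → E j → E (i ℕ.+ j)) → (∀ i j → E (i ℕ.+ j) → E j → E i) →
  ∀ {k p} → Coprime k p → E k → E p → E 1
coprime-one E e0 e+ e∸ {k} {p} cop ek ep with coprime-Bézout cop
... | Bézout.+- x y eq = e∸ 1 (y ℕ.* p) (subst E (sym eq) (mult x ek)) (mult y ep)
  where
  mult : ∀ x {j} → E j → E (x ℕ.* j)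
  mult zero    e = e0
  mult (suc x) e = e+ _ _ e (mult x e)
... | Bézout.-+ x y eq = e∸ 1 (x ℕ.* k) (subst E (sym eq) (mult y ep)) (mult x ek)
  where
  mult : ∀ x {j} → E j → E (x ℕ.* j)
  mult zero    e = e0
  mult (suc x) e = e+ _ _ e (mult x e)

N : ∀ {B} (p : ℕ) → (Fin B → Fin B) → (Fin B → ℤ) → Fin B → ℤ
N p T f j = ∑ {p} (λ k → f (iter T (toℕ k) j))

-- The `S`-orbits, given by `∼`, are permuted by `T`; as `p` is prime, an `S`-orbit is either fixed
-- by `T` or runs through `p` different ones. The norm is treated separately in these two cases.
module CommutingMaps {B : ℕ} (p : ℕ) (pr : Prime p) (S T : Fin B → Fin B)
  (ST : ∀ j → S (T j) ≡ T (S j)) (Sᵖ : ∀ j → iter S p j ≡ j) (Tᵖ : ∀ j → iter T p j ≡ j) where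

  private instance
    p≢0 : ℕ.NonZero p
    p≢0 = prime⇒nonZero pr

  residue : ℕ → Fin p
  residue c = Fin.fromℕ< (m%n<n c p)

  iter-residue : (G : Fin B → Fin B) → (∀ j → iter G p j ≡ j) → ∀ c j → iter G (toℕ (residue c)) j ≡ iter G c j
  iter-residue G Gᵖ c j = begin
    iter G (toℕ (residue c)) j     ≡⟨ cong (λ d → iter G d j) (FinP.toℕ-fromℕ< (m%n<n c p)) ⟩
    iter G (c ℕ.% p) j             ≡⟨ cong (iter G (c ℕ.% p)) (iter-* G (c ℕ./ p) p (Gᵖ j)) ⟨
    iter G (c ℕ.% p) (iter G (c ℕ./ p ℕ.* p) j) ≡⟨ iter-+ G (c ℕ.% p) (c ℕ./ p ℕ.* p) j ⟨
    iter G (c ℕ.% p ℕ.+ c ℕ./ p ℕ.* p) j ≡⟨ cong (λ d → iter G d j) (m≡m%n+[m/n]*n c p) ⟨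
    iter G c j ∎
    where open ≡-Reasoning

  infix 4 _∼_ _≋_
  _∼_ : Fin B → Fin B → Set
  j ∼ j′ = ∃ λ c → iter S c j ≡ j′

  ∼-refl : ∀ {j} → j ∼ j
  ∼-refl = 0 , refl

  ∼-trans : ∀ {i j k} → i ∼ j → j ∼ k → i ∼ k
  ∼-trans {i} (c , refl) (d , refl) = d ℕ.+ c , iter-+ S d c i

  ∼-sym : ∀ {i j} → i ∼ j → j ∼ i
  ∼-sym {i} (c , refl) = c ℕ.* (p ℕ.∸ 1) , (begin
    iter S (c ℕ.* (p ℕ.∸ 1)) (iter S c i) ≡⟨ iter-+ S (c ℕ.* (p ℕ.∸ 1)) c i ⟨
    iter S (c ℕ.* (p ℕ.∸ 1) ℕ.+ c) i      ≡⟨ cong (λ d → iter S d i) (eq p) ⟩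
    iter S (c ℕ.* p) i                    ≡⟨ iter-* S c p (Sᵖ i) ⟩
    i ∎)
    where
    open ≡-Reasoning
    eq : ∀ p .{{_ : ℕ.NonZero p}} → c ℕ.* (p ℕ.∸ 1) ℕ.+ c ≡ c ℕ.* p
    eq (suc q) = trans (ℕP.+-comm (c ℕ.* q) c) (sym (ℕP.*-suc c q))

  T-∼ : ∀ {i j} → i ∼ j → T i ∼ T j
  T-∼ {i} (c , refl) = c , sym (iter-map T {S} {S} (λ x → sym (ST x)) c i)

  iterT-∼ : ∀ k {i j} → i ∼ j → iter T k i ∼ iter T k j
  iterT-∼ zero    e = e
  iterT-∼ (suc k) e = T-∼ (iterT-∼ k e)

  abstract
    _∼?_ : ∀ i j → Dec (i ∼ j)
    i ∼? j with FinP.any? (λ (c : Fin p) → iter S (toℕ c) i ≟ j)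
    ... | yes (c , e) = yes (toℕ c , e)
    ... | no ¬e = no (λ { (c , e) → ¬e (residue c , trans (iter-residue S Sᵖ c i) e) })

  _≋_ : Fin B → Fin B → Set
  j ≋ j′ = ∃ λ d → iter T d j ∼ j′

  abstract
    _≋?_ : ∀ i j → Dec (i ≋ j)
    i ≋? j with FinP.any? (λ (d : Fin p) → iter T (toℕ d) i ∼? j)
    ... | yes (d , e) = yes (toℕ d , e)
    ... | no ¬e = no (λ { (d , e) → ¬e (residue d , subst (_∼ j) (sym (iter-residue T Tᵖ d i)) e) })

  open Representative _≋?_ (λ i → 0 , ∼-refl)

  rep-∼ : ∀ {i j} → i ∼ j → rep i ≡ rep j
  rep-∼ {i} {j} e = rep-cong i j (λ { _ (d , q) → d , ∼-trans (iterT-∼ d (∼-sym e)) q })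
    (λ { _ (d , q) → d , ∼-trans (iterT-∼ d e) q })

  rep-T : ∀ j → rep (T j) ≡ rep j
  rep-T j = rep-cong (T j) j
    (λ { _ (d , q) → suc d , subst (_∼ _) (sym (iter-suc T d j)) q })
    (λ { _ (d , q) → d ℕ.+ (p ℕ.∸ 1) , subst (_∼ _) (sym (back d)) q })
    where
    eq : ∀ p .{{_ : ℕ.NonZero p}} d → d ℕ.+ (p ℕ.∸ 1) ℕ.+ 1 ≡ d ℕ.+ p
    eq (suc q) d = trans (ℕP.+-assoc d q 1) (cong (d ℕ.+_) (ℕP.+-comm q 1))
    back : ∀ d → iter T (d ℕ.+ (p ℕ.∸ 1)) (T j) ≡ iter T d j
    back d = trans (sym (iter-+ T (d ℕ.+ (p ℕ.∸ 1)) 1 j)) (trans (cong (λ c → iter T c j) (eq p d))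
      (trans (iter-+ T d p j) (cong (iter T d) (Tᵖ j))))

  rep-iterT : ∀ k j → rep (iter T k j) ≡ rep j
  rep-iterT zero    j = refl
  rep-iterT (suc k) j = trans (rep-T _) (rep-iterT k j)

  -- Singles out one `S`-orbit inside every orbit of the group generated by `S` and `T`.
  Base : Fin B → Set
  Base j = j ∼ rep j

  base? : ∀ j → Dec (Base j)
  base? j = j ∼? rep j

  Base-∼ : ∀ {i j} → i ∼ j → Base i → Base j
  Base-∼ e q = ∼-trans (∼-sym e) (∼-trans q (0 , rep-∼ e))

  T-fixes-∼ : ∀ k j → 0 ℕ.< k → k ℕ.< p → iter T k j ∼ j → T j ∼ j
  T-fixes-∼ k j 0<k k<p e = coprime-one (λ i → iter T i j ∼ j) ∼-refl
    (λ i i′ q q′ → ∼-trans (subst (_∼ _) (sym (iter-+ T i i′ j)) (iterT-∼ i q′)) q)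
    (λ i i′ q q′ → ∼-trans (∼-sym (subst (_∼ iter T i j) (sym (iter-+ T i i′ j)) (iterT-∼ i q′))) q)
    (prime⇒coprime pr k 0<k k<p) e (0 , Tᵖ j)

  abstract
    base-translate : ∀ j → ∃ λ (k : Fin p) → Base (iter T (toℕ k) j)
    base-translate j = let (d , e) = rep-R j in
      residue d , subst Base (sym (iter-residue T Tᵖ d j)) (∼-trans e (0 , sym (rep-iterT d j)))

  private
    return : ∀ k m j → k ℕ.+ m ≡ p → iter T k (iter T m j) ≡ j
    return k m j eq = trans (sym (iter-+ T k m j)) (trans (cong (λ c → iter T c j) eq) (Tᵖ j))

  T-fixes-iterT : ∀ k j → k ℕ.≤ p → T (iter T k j) ∼ iter T k j → T j ∼ j
  T-fixes-iterT k j k≤p e = subst₂ _∼_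
    (trans (iter-comm T m (suc k) j) (cong T (return k m j eq)))
    (trans (iter-comm T m k j) (return k m j eq)) (iterT-∼ m e)
    where
    m = p ℕ.∸ k
    eq = ℕP.m+[n∸m]≡n k≤p

  -- Two base members of one `T`-orbit lie in the same `S`-orbit, so a proper power of `T`, and
  -- hence `T`, would fix that orbit.
  base-unique-< : ∀ j → ¬ T j ∼ j → ∀ k l → k ℕ.< l → l ℕ.< p → Base (iter T k j) → ¬ Base (iter T l j)
  base-unique-< j ¬fix k l k<l l<p bk bl = ¬fix (T-fixes-iterT k j (ℕP.<⇒≤ (ℕP.<-trans k<l l<p))
    (T-fixes-∼ (l ℕ.∸ k) (iter T k j) (ℕP.m<n⇒0<n∸m k<l) (ℕP.≤-<-trans (ℕP.m∸n≤m l k) l<p)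
      (subst (_∼ iter T k j) (trans (cong (λ c → iter T c j) (sym (ℕP.m∸n+n≡m (ℕP.<⇒≤ k<l)))) (iter-+ T (l ℕ.∸ k) k j))
        (∼-trans bl (∼-trans (0 , trans (rep-iterT l j) (sym (rep-iterT k j))) (∼-sym bk))))))

  base-unique : ∀ j → ¬ T j ∼ j → ∀ (k l : Fin p) → Base (iter T (toℕ k) j) → Base (iter T (toℕ l) j) → k ≡ l
  base-unique j ¬fix k l bk bl with FinP.<-cmp k l
  ... | tri≈ _ e _   = e
  ... | tri< k<l _ _ = ⊥-elim (base-unique-< j ¬fix (toℕ k) (toℕ l) k<l (FinP.toℕ<n l) bk bl)
  ... | tri> _ _ l<k = ⊥-elim (base-unique-< j ¬fix (toℕ l) (toℕ k) l<k (FinP.toℕ<n k) bl bk)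

  +p*-injective : ∀ x y → + p * x ≡ + p * y → x ≡ y
  +p*-injective x y e = ℤP.*-cancelˡ-≡ (+ p) x y e

  iter-invariant : ∀ {f : Fin B → ℤ} {G : Fin B → Fin B} → (∀ j → f (G j) ≡ f j) → ∀ k j → f (iter G k j) ≡ f j
  iter-invariant inv zero    j = refl
  iter-invariant inv (suc k) j = trans (inv _) (iter-invariant inv k j)

  ∼-invariant : ∀ {f : Fin B → ℤ} → (∀ j → f (S j) ≡ f j) → ∀ {i j} → i ∼ j → f i ≡ f j
  ∼-invariant {f} inv {i} (c , refl) = sym (iter-invariant {f} inv c i)

  module _ (m : Fin B → ℤ) (mS : ∀ j → m (S j) ≡ m j) (mT : ∀ j → m (T j) ≡ m j)
    (p∣m : ∀ j → T j ∼ j → ∃ λ q → m j ≡ + p * q) where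

    private
      ind-∼ : ∀ {i j} → i ∼ j → ind ⌊ base? i ⌋ ≡ ind ⌊ base? j ⌋
      ind-∼ {i} {j} e = ind-⇔ (base? i) (base? j) (Base-∼ e) (Base-∼ (∼-sym e))

      r′ : ∀ j → Dec (T j ∼ j) → ℤ
      r′ j (yes e) = proj₁ (p∣m j e)
      r′ j (no _)  = ind ⌊ base? j ⌋ * m j

      r : Fin B → ℤ
      r j = r′ j (T j ∼? j)

      r-fixed : ∀ j → T j ∼ j → + p * r j ≡ m j
      r-fixed j e with T j ∼? j
      ... | yes e′ = sym (proj₂ (p∣m j e′))
      ... | no ¬e  = ⊥-elim (¬e e)

      r-moved : ∀ j → ¬ T j ∼ j → r j ≡ ind ⌊ base? j ⌋ * m j
      r-moved j ¬e with T j ∼? j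
      ... | yes e = ⊥-elim (¬e e)
      ... | no _  = refl

    -- On an `S`-orbit fixed by `T` the norm of an `S`-invariant function is multiplication by `p`,
    -- so there `m` is divided by `p`; among `p` orbits permuted by `T`, all of `m` is put on the
    -- base one.
    invariant-norm : ∃ λ (r : Fin B → ℤ) → (∀ j → r (S j) ≡ r j) × (∀ j → m j ≡ N p T r j)
    invariant-norm = r , rS , norm
      where
      S∼ : ∀ j → j ∼ S j
      S∼ j = 1 , refl
      TS : ∀ {i j} → i ∼ j → T i ∼ i → T j ∼ j
      TS e q = ∼-trans (T-∼ (∼-sym e)) (∼-trans q e)
      rS : ∀ j → r (S j) ≡ r j
      rS j with T j ∼? j
      ... | yes e = +p*-injective _ _ (trans (r-fixed (S j) (TS (S∼ j) e)) (trans (mS j) (proj₂ (p∣m j e))))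
      ... | no ¬e = trans (r-moved (S j) (¬e ∘ TS (∼-sym (S∼ j)))) (cong₂ _*_ (sym (ind-∼ (S∼ j))) (mS j))
      iter-T-∼ : ∀ k j → T j ∼ j → T (iter T k j) ∼ iter T k j
      iter-T-∼ k j e = subst (_∼ iter T k j) (iter-comm T k 1 j) (iterT-∼ k e)
      norm : ∀ j → m j ≡ N p T r j
      norm j with T j ∼? j
      ... | yes e = trans (sym (r-fixed j e)) (sym (trans
          (∑-cong {p} (λ k → +p*-injective _ _ (trans (r-fixed _ (iter-T-∼ (toℕ k) j e))
            (trans (iter-invariant {m} mT (toℕ k) j) (sym (r-fixed j e))))))
          (∑-const p (r j))))
      ... | no ¬e = sym (trans
          (∑-cong {p} (λ k → trans (r-moved _ (¬e ∘ T-fixes-iterT (toℕ k) j (ℕP.<⇒≤ (FinP.toℕ<n k))))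
            (cong (ind ⌊ base? (iter T (toℕ k) j) ⌋ *_) (iter-invariant {m} mT (toℕ k) j))))
          (trans (∑-unique {p} _ k₀ (λ k ne → cong (_* m j) (ind-no (base? _) (λ bk → ne (base-unique j ¬e k₀ k b₀ bk)))))
            (trans (cong (_* m j) (ind-yes (base? _) b₀)) (ℤP.*-identityˡ (m j)))))
        where
        k₀ = proj₁ (base-translate j)
        b₀ = proj₂ (base-translate j)

-- The order is `suc p`. Vanishing of Ĥ⁻¹ writes `f` as a sum of terms (T^k - 1) y_k, and each of
-- them is T - 1 applied to a partial sum of the iterates of y_k.
norm-zero-cyclic : ∀ {B} p (T : Fin B → Fin B) → (∀ j → iter T (suc p) j ≡ j) → (f : Fin B → ℤ) →
  (∀ j → N (suc p) T f j ≡ 0ℤ) → ∃ λ (u : Fin B → ℤ) → ∀ j → f j ≡ u (T j) - u j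
norm-zero-cyclic {B} p T Tᵖ f norm0 = U , λ j → trans (proj₂ coinv j)
    (trans (∑-cong (λ k → trans (cong (_- y k j) (pull k (y k) j)) (telescope (y k) (toℕ k) j)))
      (∑-− (λ k → partial (y k) (toℕ k) (T j)) (λ k → partial (y k) (toℕ k) j)))
  where
  g : Fin (suc p) → Fin B → Fin B
  g k = iter T (toℕ k ℕ.* p)
  T⁻ : ∀ k j → iter T k (iter T (k ℕ.* p) j) ≡ j
  T⁻ k j = trans (sym (iter-+ T k (k ℕ.* p) j)) (trans (cong (λ c → iter T c j) (sym (ℕP.*-suc k p))) (iter-* T k (suc p) (Tᵖ j)))
  pull : ∀ k f j → push (g k) f j ≡ f (iter T (toℕ k) j)
  pull k = push-inverse (g k) (iter T (toℕ k)) (λ i → trans (iter-comm T (toℕ k ℕ.* p) (toℕ k) i) (T⁻ (toℕ k) i)) (T⁻ (toℕ k))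
  R : Fin B → Fin B → Set
  R i j = ∃ λ k → g k i ≡ j
  R? : ∀ i j → Dec (R i j)
  R? i j = FinP.any? (λ k → g k i ≟ j)
  _~_ : Fin B → Fin B → Set
  i ~ j = ∃ λ c → iter T c i ≡ j
  -- `g k` is the inverse of the k-th power. Modulo the order `suc p` the number `p` is -1, so the
  -- power c is reached as (c p) p, the index being `c * p` reduced.
  ~⇒R : ∀ {i j} → i ~ j → R i j
  ~⇒R {i} (c , refl) = Fin.fromℕ< (m%n<n c′ (suc p)) , trans (cong (λ d → iter T (d ℕ.* p) i) (FinP.toℕ-fromℕ< (m%n<n c′ (suc p)))) (begin
      iter T (c′ ℕ.% suc p ℕ.* p) i  ≡⟨ periodic (c′ ℕ.% suc p ℕ.* p) (c′ ℕ./ suc p ℕ.* p) ⟨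
      iter T (c′ ℕ.% suc p ℕ.* p ℕ.+ c′ ℕ./ suc p ℕ.* p ℕ.* suc p) i
        ≡⟨ cong (λ d → iter T d i) (trans (cong (c′ ℕ.% suc p ℕ.* p ℕ.+_) (rearrange (c′ ℕ./ suc p)))
             (sym (ℕP.*-distribʳ-+ p (c′ ℕ.% suc p) (c′ ℕ./ suc p ℕ.* suc p)))) ⟩
      iter T ((c′ ℕ.% suc p ℕ.+ c′ ℕ./ suc p ℕ.* suc p) ℕ.* p) i
        ≡⟨ cong (λ d → iter T (d ℕ.* p) i) (m≡m%n+[m/n]*n c′ (suc p)) ⟨
      iter T (c ℕ.* p ℕ.* p) i       ≡⟨ periodic (c ℕ.* p ℕ.* p) c ⟨
      iter T (c ℕ.* p ℕ.* p ℕ.+ c ℕ.* suc p) i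
        ≡⟨ cong (λ d → iter T d i) (square c) ⟩
      iter T (c ℕ.+ c ℕ.* p ℕ.* suc p) i  ≡⟨ periodic c (c ℕ.* p) ⟩
      iter T c i ∎)
    where
    open ≡-Reasoning
    c′ = c ℕ.* p
    periodic : ∀ x y → iter T (x ℕ.+ y ℕ.* suc p) i ≡ iter T x i
    periodic x y = trans (iter-+ T x (y ℕ.* suc p) i) (cong (iter T x) (iter-* T y (suc p) (Tᵖ i)))
    rearrange : ∀ y → y ℕ.* p ℕ.* suc p ≡ y ℕ.* suc p ℕ.* p
    rearrange y = trans (ℕP.*-assoc y p (suc p)) (trans (cong (y ℕ.*_) (ℕP.*-comm p (suc p))) (sym (ℕP.*-assoc y (suc p) p)))
    square : ∀ c → c ℕ.* p ℕ.* p ℕ.+ c ℕ.* suc p ≡ c ℕ.+ c ℕ.* p ℕ.* suc p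
    square c = trans (cong (c ℕ.* p ℕ.* p ℕ.+_) (ℕP.*-suc c p)) (trans (ℕP.+-comm (c ℕ.* p ℕ.* p) (c ℕ.+ c ℕ.* p))
      (trans (ℕP.+-assoc c (c ℕ.* p) (c ℕ.* p ℕ.* p)) (cong (c ℕ.+_) (sym (ℕP.*-suc (c ℕ.* p) p)))))
  open Representative R? (λ i → ~⇒R (0 , refl))
  ~-R : ∀ {i j k} → i ~ j → R j k → R i k
  ~-R {i} (c , refl) (k , refl) = ~⇒R (toℕ k ℕ.* p ℕ.+ c , iter-+ T (toℕ k ℕ.* p) c i)
  coinv = coinvariants g rep (λ j → proj₁ (rep-R j))
    (λ k j → rep-cong (g k j) j (λ _ → ~-R (toℕ k ℕ.* p , refl)) (λ _ → ~-R (toℕ k , T⁻ (toℕ k) j)))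
    (λ j → proj₂ (rep-R j)) f (λ i → trans (∑-cong (λ k → pull k f i)) (norm0 i))
  y = proj₁ coinv
  partial : (Fin B → ℤ) → ℕ → Fin B → ℤ
  partial f zero    j = 0ℤ
  partial f (suc k) j = f (iter T k j) + partial f k j
  telescope : ∀ f k j → f (iter T k j) - f j ≡ partial f k (T j) - partial f k j
  telescope f zero    j = ℤP.+-inverseʳ (f j)
  telescope f (suc k) j = begin
    f (T (iter T k j)) - f j  ≡⟨ alg (f (T (iter T k j))) (f (iter T k j)) (f j) ⟩
    f (T (iter T k j)) - f (iter T k j) + (f (iter T k j) - f j) ≡⟨ cong₂ _+_ (cong (λ z → f z - f (iter T k j)) (iter-suc T k j)) (telescope f k j) ⟩
    f (iter T k (T j)) - f (iter T k j) + (partial f k (T j) - partial f k j)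
      ≡⟨ alg′ (f (iter T k (T j))) (f (iter T k j)) (partial f k (T j)) (partial f k j) ⟩
    partial f (suc k) (T j) - partial f (suc k) j ∎
    where
    open ≡-Reasoning
    alg : ∀ x y z → x - z ≡ x - y + (y - z)
    alg = solve-∀
    alg′ : ∀ x y z w → x - y + (z - w) ≡ x + z - (y + w)
    alg′ = solve-∀
  U : Fin B → ℤ
  U j = ∑ (λ k → partial (y k) (toℕ k) j)


module CommutingInvolutions {B : ℕ} (S T : Fin B → Fin B)
  (ST : ∀ j → S (T j) ≡ T (S j)) (S² : ∀ j → S (S j) ≡ j) (T² : ∀ j → T (T j) ≡ j) where

  open CommutingMaps 2 prime[2] S T ST S² T² public

  -- On an `S`-orbit fixed by `T`, `v` is its own negative, hence zero. Of two orbits swapped by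
  -- `T`, `u` is 0 on the base one and `- v` on the other.
  invariant-norm-zero : (v : Fin B → ℤ) → (∀ j → v (S j) ≡ v j) → (∀ j → v j + v (T j) ≡ 0ℤ) →
    ∃ λ (u : Fin B → ℤ) → (∀ j → u (S j) ≡ u j) × (∀ j → v j ≡ u (T j) - u j)
  invariant-norm-zero v vS vT = u , uS , coboundary
    where
    β : Fin B → ℤ
    β j = ind ⌊ base? j ⌋
    u : Fin B → ℤ
    u j = (β j - 1ℤ) * v j
    uS : ∀ j → u (S j) ≡ u j
    uS j = cong₂ (λ x y → (x - 1ℤ) * y)
      (ind-⇔ (base? (S j)) (base? j) (Base-∼ (∼-sym (1 , refl))) (Base-∼ (1 , refl))) (vS j)
    alg : ∀ v v′ x y → v + v′ ≡ 0ℤ → x + y ≡ 1ℤ → v ≡ (x - 1ℤ) * v′ - (y - 1ℤ) * v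
    alg v v′ x y e e′ = begin
      v                                         ≡⟨ l₁ v v′ x ⟩
      v + (x - 1ℤ) * v′ + (1ℤ - x) * (v + v′) - (1ℤ - x) * v ≡⟨ cong (λ z → v + (x - 1ℤ) * v′ + (1ℤ - x) * z - (1ℤ - x) * v) e ⟩
      v + (x - 1ℤ) * v′ + (1ℤ - x) * 0ℤ - (1ℤ - x) * v  ≡⟨ l₂ v v′ x y ⟩
      (x - 1ℤ) * v′ - (y - 1ℤ) * v + (x + y - 1ℤ) * v ≡⟨ cong (λ z → (x - 1ℤ) * v′ - (y - 1ℤ) * v + (z - 1ℤ) * v) e′ ⟩
      (x - 1ℤ) * v′ - (y - 1ℤ) * v + (1ℤ - 1ℤ) * v    ≡⟨ l₃ ((x - 1ℤ) * v′ - (y - 1ℤ) * v) v ⟩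
      (x - 1ℤ) * v′ - (y - 1ℤ) * v ∎
      where
      open ≡-Reasoning
      l₁ : ∀ v v′ x → v ≡ v + (x - 1ℤ) * v′ + (1ℤ - x) * (v + v′) - (1ℤ - x) * v
      l₁ = solve-∀
      l₂ : ∀ v v′ x y → v + (x - 1ℤ) * v′ + (1ℤ - x) * 0ℤ - (1ℤ - x) * v ≡ (x - 1ℤ) * v′ - (y - 1ℤ) * v + (x + y - 1ℤ) * v
      l₂ = solve-∀
      l₃ : ∀ z v → z + (1ℤ - 1ℤ) * v ≡ z
      l₃ = solve-∀
    coboundary : ∀ j → v j ≡ u (T j) - u j
    coboundary j with T j ∼? j
    ... | yes e = trans v0 (sym (cong₂ _-_ (zero-* (β (T j) - 1ℤ) (trans vTj v0)) (zero-* (β j - 1ℤ) v0)))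
      where
      vTj : v (T j) ≡ v j
      vTj = ∼-invariant {v} vS e
      double : ∀ z → + 2 * z ≡ z + z
      double = solve-∀
      v0 : v j ≡ 0ℤ
      v0 = *-cancelˡ-0 2 (v j) (trans (double (v j)) (trans (cong (_+_ (v j)) (sym vTj)) (vT j)))
      zero-* : ∀ x {y} → y ≡ 0ℤ → x * y ≡ 0ℤ
      zero-* x refl = ℤP.*-zeroʳ x
    ... | no ¬e = alg (v j) (v (T j)) (β (T j)) (β j) (vT j) β-sum
      where
      β-sum : β (T j) + β j ≡ 1ℤ
      β-sum with base-translate j
      ... | Fin.zero , b₀ = cong₂ _+_
        (ind-no (base? (T j)) (λ b₁ → case (base-unique j ¬e Fin.zero (Fin.suc Fin.zero) b₀ b₁) of λ ()))
        (ind-yes (base? j) b₀)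
      ... | Fin.suc Fin.zero , b₁ = cong₂ _+_ (ind-yes (base? (T j)) b₁)
        (ind-no (base? j) (λ b₀ → case (base-unique j ¬e Fin.zero (Fin.suc Fin.zero) b₀ b₁) of λ ()))

-- Clearing denominators prime to p

private
  toℚᵘ-cast : ∀ z → ℚ.toℚᵘ (ℤ→ℚ z) ℚᵘ.≃ mkℚᵘ z 0
  toℚᵘ-cast z = ℚP.toℚᵘ-fromℚᵘ (mkℚᵘ z 0)

cast-+ : ∀ x y → ℤ→ℚ (x + y) ≡ ℤ→ℚ x ℚ.+ ℤ→ℚ y
cast-+ x y = ℚP.toℚᵘ-injective (ℚᵘP.≃-trans (toℚᵘ-cast (x + y)) (ℚᵘP.≃-trans (*≡* (alg x y))
    (ℚᵘP.≃-sym (ℚᵘP.≃-trans (ℚP.toℚᵘ-homo-+ (ℤ→ℚ x) (ℤ→ℚ y)) (ℚᵘP.+-cong (toℚᵘ-cast x) (toℚᵘ-cast y))))))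
  where
  alg : ∀ x y → (x + y) * 1ℤ ≡ (x * 1ℤ + y * 1ℤ) * 1ℤ
  alg = solve-∀

cast-* : ∀ x y → ℤ→ℚ (x * y) ≡ ℤ→ℚ x ℚ.* ℤ→ℚ y
cast-* x y = ℚP.toℚᵘ-injective (ℚᵘP.≃-trans (toℚᵘ-cast (x * y)) (ℚᵘP.≃-trans (*≡* refl)
    (ℚᵘP.≃-sym (ℚᵘP.≃-trans (ℚP.toℚᵘ-homo-* (ℤ→ℚ x) (ℤ→ℚ y)) (ℚᵘP.*-cong (toℚᵘ-cast x) (toℚᵘ-cast y))))))

cast-injective : ∀ x y → ℤ→ℚ x ≡ ℤ→ℚ y → x ≡ y
cast-injective x y e with ℚᵘP.≃-trans (ℚᵘP.≃-sym (toℚᵘ-cast x)) (ℚᵘP.≃-trans (ℚP.toℚᵘ-cong e) (toℚᵘ-cast y))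
... | *≡* q = trans (sym (ℤP.*-identityʳ x)) (trans q (ℤP.*-identityʳ y))

denominator-* : ∀ q → ℤ→ℚ (+ ℚ.denominatorℕ q) ℚ.* q ≡ ℤ→ℚ (ℚ.numerator q)
denominator-* q@(mkℚ z d-1 _) = ℚP.toℚᵘ-injective (ℚᵘP.≃-trans (ℚP.toℚᵘ-homo-* (ℤ→ℚ (+ suc d-1)) q)
    (ℚᵘP.≃-trans (ℚᵘP.*-congʳ {ℚ.toℚᵘ q} (toℚᵘ-cast (+ suc d-1)))
      (ℚᵘP.≃-trans (*≡* (alg (+ suc d-1) z)) (ℚᵘP.≃-sym (toℚᵘ-cast z)))))
  where
  alg : ∀ d z → d * z * 1ℤ ≡ z * (1ℤ * d)
  alg = solve-∀

/-* : ∀ z e .{{_ : ℕ.NonZero e}} → z ℚ./ e ≡ ℤ→ℚ z ℚ.* (1ℤ ℚ./ e)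
/-* z e@(suc e-1) = ℚP.toℚᵘ-injective (ℚᵘP.≃-trans (ℚP.toℚᵘ-fromℚᵘ (mkℚᵘ z e-1))
    (ℚᵘP.≃-trans (*≡* (alg z (+ e))) (ℚᵘP.≃-sym (ℚᵘP.≃-trans (ℚP.toℚᵘ-homo-* (ℤ→ℚ z) (1ℤ ℚ./ e))
      (ℚᵘP.*-cong (toℚᵘ-cast z) (ℚP.toℚᵘ-fromℚᵘ (mkℚᵘ 1ℤ e-1)))))))
  where
  alg : ∀ z e → z * (1ℤ * e) ≡ z * 1ℤ * e
  alg = solve-∀

n/n : ∀ e .{{_ : ℕ.NonZero e}} → ℤ→ℚ (+ e) ℚ.* (1ℤ ℚ./ e) ≡ ℚ.1ℚ
n/n e@(suc e-1) = trans (sym (/-* (+ e) e)) (ℚP.toℚᵘ-injective (ℚᵘP.≃-trans (ℚP.toℚᵘ-fromℚᵘ (mkℚᵘ (+ e) e-1)) (*≡* (ℤP.*-comm (+ e) 1ℤ))))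

denominator-/ : ∀ z e .{{_ : ℕ.NonZero e}} → ℚ.denominatorℕ (z ℚ./ e) ∣ e
denominator-/ z e = divides ∣ gcdℤ z (+ e) ∣ (trans (cong ∣_∣ (sym (ℚP.↧-/ z e)))
  (trans (ℤP.abs-* (ℚ.denominator (z ℚ./ e)) (gcdℤ z (+ e))) (ℕP.*-comm (ℚ.denominatorℕ (z ℚ./ e)) ∣ gcdℤ z (+ e) ∣)))

∑ℚ-cong : ∀ {m} {f g : Fin m → ℚ} → (∀ i → f i ≡ g i) → Qℚ.∑ f ≡ Qℚ.∑ g
∑ℚ-cong {zero}  e = refl
∑ℚ-cong {suc m} e = cong₂ ℚ._+_ (e Fin.zero) (∑ℚ-cong (e ∘ Fin.suc))

∑ℚ-*ˡ : ∀ {m} c (f : Fin m → ℚ) → Qℚ.∑ (λ i → c ℚ.* f i) ≡ c ℚ.* Qℚ.∑ f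
∑ℚ-*ˡ {zero}  c f = sym (ℚP.*-zeroʳ c)
∑ℚ-*ˡ {suc m} c f = trans (cong (c ℚ.* f Fin.zero ℚ.+_) (∑ℚ-*ˡ c (f ∘ Fin.suc)))
  (sym (ℚP.*-distribˡ-+ c (f Fin.zero) (Qℚ.∑ (f ∘ Fin.suc))))

∤-* : ∀ {p} → Prime p → ∀ {m n} → ¬ p ∣ m → ¬ p ∣ n → ¬ p ∣ m ℕ.* n
∤-* pr {m} {n} pm pn d with euclidsLemma m n pr d
... | inj₁ q = pm q
... | inj₂ q = pn q

∤-1 : ∀ {p} → Prime p → ¬ p ∣ 1
∤-1 pr d = case (∣1⇒≡1 d) of λ { refl → prime⇒¬1 pr }
  where
  prime⇒¬1 : ¬ Prime 1
  prime⇒¬1 pr with prime⇒nonTrivial pr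
  ... | ()

common-multiple : ∀ {p} → Prime p → ∀ {m} (d : Fin m → ℕ) → (∀ i → ¬ p ∣ d i) →
  ∃ λ D → ¬ p ∣ D × ∃ λ (c : Fin m → ℕ) → ∀ i → D ≡ c i ℕ.* d i
common-multiple pr {zero}  d ∤d = 1 , ∤-1 pr , (λ ()) , λ ()
common-multiple pr {suc m} d ∤d with common-multiple pr (d ∘ Fin.suc) (∤d ∘ Fin.suc)
... | D , ∤D , c , e = d Fin.zero ℕ.* D , ∤-* pr (∤d Fin.zero) ∤D , c′ , e′
  where
  c′ : Fin (suc m) → ℕ
  c′ Fin.zero    = D
  c′ (Fin.suc i) = d Fin.zero ℕ.* c i
  e′ : ∀ i → d Fin.zero ℕ.* D ≡ c′ i ℕ.* d i
  e′ Fin.zero    = ℕP.*-comm (d Fin.zero) D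
  e′ (Fin.suc i) = trans (cong (d Fin.zero ℕ.*_) (e i)) (sym (ℕP.*-assoc (d Fin.zero) (c i) (d (Fin.suc i))))

clear-denominators : ∀ {p} → Prime p → ∀ {r c} (Q : Qℚ.Mat r c) → (∀ i j → InZp p (Q i j)) →
  ∃ λ D → ¬ p ∣ D × ∃ λ (M : Mat r c) → ∀ i j → ℤ→ℚ (M i j) ≡ ℤ→ℚ (+ D) ℚ.* Q i j
clear-denominators pr {r} {c} Q Qint = D , ∤D , M , eq
  where
  row = λ i → common-multiple pr (λ j → ℚ.denominatorℕ (Q i j)) (Qint i)
  total = common-multiple pr (λ i → proj₁ (row i)) (λ i → proj₁ (proj₂ (row i)))
  D = proj₁ total
  ∤D = proj₁ (proj₂ total)
  u : Fin r → ℕ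
  u = proj₁ (proj₂ (proj₂ total))
  v : Fin r → Fin c → ℕ
  v i = proj₁ (proj₂ (proj₂ (row i)))
  M : Mat r c
  M i j = + (u i ℕ.* v i j) * ℚ.numerator (Q i j)
  eq : ∀ i j → ℤ→ℚ (M i j) ≡ ℤ→ℚ (+ D) ℚ.* Q i j
  eq i j = begin
    ℤ→ℚ (M i j) ≡⟨ cast-* (+ (u i ℕ.* v i j)) (ℚ.numerator (Q i j)) ⟩
    ℤ→ℚ (+ (u i ℕ.* v i j)) ℚ.* ℤ→ℚ (ℚ.numerator (Q i j)) ≡⟨ cong (ℤ→ℚ (+ (u i ℕ.* v i j)) ℚ.*_) (denominator-* (Q i j)) ⟨
    ℤ→ℚ (+ (u i ℕ.* v i j)) ℚ.* (ℤ→ℚ (+ d) ℚ.* Q i j) ≡⟨ ℚP.*-assoc (ℤ→ℚ (+ (u i ℕ.* v i j))) (ℤ→ℚ (+ d)) (Q i j) ⟨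
    ℤ→ℚ (+ (u i ℕ.* v i j)) ℚ.* ℤ→ℚ (+ d) ℚ.* Q i j ≡⟨ cong (ℚ._* Q i j) (cast-* (+ (u i ℕ.* v i j)) (+ d)) ⟨
    ℤ→ℚ (+ (u i ℕ.* v i j) * + d) ℚ.* Q i j ≡⟨ cong (λ z → ℤ→ℚ z ℚ.* Q i j) (trans (sym (ℤP.pos-* (u i ℕ.* v i j) d)) (cong +_ D-eq)) ⟩
    ℤ→ℚ (+ D) ℚ.* Q i j ∎
    where
    open ≡-Reasoning
    d = ℚ.denominatorℕ (Q i j)
    D-eq : u i ℕ.* v i j ℕ.* d ≡ D
    D-eq = sym (trans (proj₂ (proj₂ (proj₂ total)) i) (trans (cong (u i ℕ.*_) (proj₂ (proj₂ (proj₂ (row i))) j))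
      (sym (ℕP.*-assoc (u i) (v i j) d))))

IntInvertible : ∀ {n} → ℕ → RawLattice n → Set
IntInvertible {n} p M =
  Σ (RawLattice n) λ P → IsGLattice P × IsPermutation P
  × Σ (Mat (rank P) (rank M)) λ ι → Σ (Mat (rank M) (rank P)) λ ρ → Σ ℕ λ e →
    ¬ p ∣ e × IsHom M P ι × IsHom P M ρ × (∀ i j → (ρ · ι) i j ≡ + e * 1M i j)

-- The embedding is kept abstract so that its definition is not unfolded.
module Embedding (c : ℤ → ℚ) (c-+ : ∀ x y → c (x + y) ≡ c x ℚ.+ c y) (c-* : ∀ x y → c (x * y) ≡ c x ℚ.* c y)
  (c-0 : c 0ℤ ≡ ℚ.0ℚ) (c-1 : c 1ℤ ≡ ℚ.1ℚ) where

  open ≡-Reasoning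

  c-∑ : ∀ {m} (f : Fin m → ℤ) → c (∑ f) ≡ Qℚ.∑ (c ∘ f)
  c-∑ {zero}  f = c-0
  c-∑ {suc m} f = trans (c-+ (f Fin.zero) (∑ (f ∘ Fin.suc))) (cong (c (f Fin.zero) ℚ.+_) (c-∑ (f ∘ Fin.suc)))

  cM : ∀ {r k} → Mat r k → Qℚ.Mat r k
  cM M i j = c (M i j)

  c-· : ∀ {r k d} (M : Mat r k) (N : Mat k d) i j → c ((M · N) i j) ≡ (cM M Qℚ.· cM N) i j
  c-· M N i j = trans (c-∑ (λ k → M i k * N k j)) (∑ℚ-cong (λ k → c-* (M i k) (N k j)))

  c-1M : ∀ {r} (i j : Fin r) → c (1M i j) ≡ Qℚ.1M i j
  c-1M i j with ⌊ i ≟ j ⌋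
  ... | true  = c-1
  ... | false = c-0

  swap : ∀ a b c → a ℚ.* (b ℚ.* c) ≡ b ℚ.* (a ℚ.* c)
  swap a b c = trans (sym (ℚP.*-assoc a b c)) (trans (cong (ℚ._* c) (ℚP.*-comm a b)) (ℚP.*-assoc b a c))

  scaleˡ : ∀ {r k l} (δ : ℚ) (A Q : Qℚ.Mat r k) (U : Qℚ.Mat k l) → (∀ i j → A i j ≡ δ ℚ.* Q i j) →
    ∀ i j → (A Qℚ.· U) i j ≡ δ ℚ.* (Q Qℚ.· U) i j
  scaleˡ δ A Q U e i j = trans
    (∑ℚ-cong (λ k → trans (cong (ℚ._* U k j) (e i k)) (ℚP.*-assoc δ (Q i k) (U k j))))
    (∑ℚ-*ˡ δ (λ k → Q i k ℚ.* U k j))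

  scaleʳ : ∀ {r k l} (δ : ℚ) (A Q : Qℚ.Mat k l) (V : Qℚ.Mat r k) → (∀ i j → A i j ≡ δ ℚ.* Q i j) →
    ∀ i j → (V Qℚ.· A) i j ≡ δ ℚ.* (V Qℚ.· Q) i j
  scaleʳ δ A Q V e i j = trans
    (∑ℚ-cong (λ k → trans (cong (V i k ℚ.*_) (e k j)) (swap (V i k) δ (Q k j))))
    (∑ℚ-*ˡ δ (λ k → V i k ℚ.* Q k j))

  scaled-commute : ∀ {r k} (δ : ℚ) (A Q : Qℚ.Mat r k) → (∀ i j → A i j ≡ δ ℚ.* Q i j) →
    (U : Qℚ.Mat k k) (V : Qℚ.Mat r r) → (Q Qℚ.· U) Qℚ.≈M (V Qℚ.· Q) → (A Qℚ.· U) Qℚ.≈M (V Qℚ.· A)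
  scaled-commute δ A Q e U V h i j = trans (scaleˡ δ A Q U e i j) (trans (cong (δ ℚ.*_) (h i j)) (sym (scaleʳ δ A Q V e i j)))

  commute-down : (∀ x y → c x ≡ c y → x ≡ y) → ∀ {r k} (A : Mat r k) (U : Mat k k) (V : Mat r r) →
    (cM A Qℚ.· cM U) Qℚ.≈M (cM V Qℚ.· cM A) → (A · U) ≈M (V · A)
  commute-down inj A U V h i j = inj _ _ (trans (c-· A U i j) (trans (h i j) (sym (c-· V A i j))))

  commute-up : ∀ {r k} (A : Mat r k) (U : Mat k k) (V : Mat r r) →
    (A · U) ≈M (V · A) → (cM A Qℚ.· cM U) Qℚ.≈M (cM V Qℚ.· cM A)
  commute-up A U V h i j = trans (sym (c-· A U i j)) (trans (cong c (h i j)) (c-· V A i j))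

  product-down : (∀ x y → c x ≡ c y → x ≡ y) → ∀ {r k} (R : Mat r k) (I : Mat k r) ρ ι (x y : ℤ) →
    (∀ i j → c (R i j) ≡ c x ℚ.* ρ i j) → (∀ i j → c (I i j) ≡ c y ℚ.* ι i j) →
    (ρ Qℚ.· ι) Qℚ.≈M Qℚ.1M → ∀ i j → (R · I) i j ≡ x * y * 1M i j
  product-down inj R I ρ ι x y eR eI h i j = inj _ _ (begin
    c ((R · I) i j)                         ≡⟨ c-· R I i j ⟩
    (cM R Qℚ.· cM I) i j                    ≡⟨ scaleˡ (c x) (cM R) ρ (cM I) eR i j ⟩
    c x ℚ.* (ρ Qℚ.· cM I) i j               ≡⟨ cong (c x ℚ.*_) (scaleʳ (c y) (cM I) ι ρ eI i j) ⟩
    c x ℚ.* (c y ℚ.* (ρ Qℚ.· ι) i j)        ≡⟨ ℚP.*-assoc (c x) (c y) _ ⟨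
    c x ℚ.* c y ℚ.* (ρ Qℚ.· ι) i j          ≡⟨ cong₂ ℚ._*_ (sym (c-* x y)) (trans (h i j) (sym (c-1M i j))) ⟩
    c (x * y) ℚ.* c (1M i j)                ≡⟨ c-* (x * y) (1M i j) ⟨
    c (x * y * 1M i j) ∎)

  product-up : ∀ {r k} (R : Mat r k) (I : Mat k r) (ρ : Qℚ.Mat r k) (x : ℤ) (δ : ℚ) → c x ℚ.* δ ≡ ℚ.1ℚ →
    (∀ i j → ρ i j ≡ δ ℚ.* c (R i j)) → (∀ i j → (R · I) i j ≡ x * 1M i j) → (ρ Qℚ.· cM I) Qℚ.≈M Qℚ.1M
  product-up R I ρ x δ xδ e h i j = begin
    (ρ Qℚ.· cM I) i j                       ≡⟨ scaleˡ δ ρ (cM R) (cM I) e i j ⟩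
    δ ℚ.* (cM R Qℚ.· cM I) i j              ≡⟨ cong (δ ℚ.*_) (trans (sym (c-· R I i j)) (trans (cong c (h i j)) (c-* x (1M i j)))) ⟩
    δ ℚ.* (c x ℚ.* c (1M i j))              ≡⟨ ℚP.*-assoc δ (c x) _ ⟨
    δ ℚ.* c x ℚ.* c (1M i j)                ≡⟨ cong₂ ℚ._*_ (trans (ℚP.*-comm δ (c x)) xδ) (c-1M i j) ⟩
    ℚ.1ℚ ℚ.* Qℚ.1M i j                      ≡⟨ ℚP.*-identityˡ _ ⟩
    Qℚ.1M i j ∎

module _ {n p : ℕ} (pr : Prime p) (M : RawLattice n) where

  private module E = Embedding ℤ→ℚ cast-+ cast-* refl refl

  pInvertible⇒int : IsPInvertible p M → IntInvertible p M
  pInvertible⇒int (P , glP , permP , ι , ρ , ιint , ρint , ιhom , ρhom , ρι) =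
    let (D , ∤D , I , I-eq) = clear-denominators pr ι ιint
        (E , ∤E , R , R-eq) = clear-denominators pr ρ ρint
    in P , glP , permP , I , R , E ℕ.* D , ∤-* pr ∤E ∤D
    , (λ g ag → E.commute-down cast-injective I (act M g) (act P g)
        (E.scaled-commute (ℤ→ℚ (+ D)) (castM I) ι I-eq (castM (act M g)) (castM (act P g)) (ιhom g ag)))
    , (λ g ag → E.commute-down cast-injective R (act P g) (act M g)
        (E.scaled-commute (ℤ→ℚ (+ E)) (castM R) ρ R-eq (castM (act P g)) (castM (act M g)) (ρhom g ag)))
    , (λ i j → trans (E.product-down cast-injective R I ρ ι (+ E) (+ D) R-eq I-eq ρι i j) (cong (_* 1M i j) (sym (ℤP.pos-* E D))))

  int⇒pInvertible : IntInvertible p M → IsPInvertible p M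
  int⇒pInvertible (P , glP , permP , ι , ρ , zero , ∤e , _) = ⊥-elim (∤e (divides 0 refl))
  int⇒pInvertible (P , glP , permP , ι , ρ , e@(suc _) , ∤e , ιhom , ρhom , ρι) =
    P , glP , permP , castM ι , (λ i j → ρ i j ℚ./ e)
    , (λ i j d → ∤-1 pr (∣-trans d (denominator-/ (ι i j) 1)))
    , (λ i j d → ∤e (∣-trans d (denominator-/ (ρ i j) e)))
    , (λ g ag → E.commute-up ι (act M g) (act P g) (ιhom g ag))
    , (λ g ag → E.scaled-commute (1ℤ ℚ./ e) (λ i j → ρ i j ℚ./ e) (castM ρ) /e (castM (act P g)) (castM (act M g))
        (E.commute-up ρ (act P g) (act M g) (ρhom g ag)))
    , E.product-up ρ ι (λ i j → ρ i j ℚ./ e) (+ e) (1ℤ ℚ./ e) (n/n e) /e ρι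
    where
    /e : ∀ i j → ρ i j ℚ./ e ≡ (1ℤ ℚ./ e) ℚ.* ℤ→ℚ (ρ i j)
    /e i j = trans (/-* (ρ i j) e) (ℚP.*-comm (ℤ→ℚ (ρ i j)) (1ℤ ℚ./ e))

-- Linear maps of integer vectors and matrices

record Linear {m k : ℕ} (f : Vect m → Vect k) : Set where
  field
    lin-cong : ∀ {u v} → (∀ j → u j ≡ v j) → ∀ i → f u i ≡ f v i
    lin-+    : ∀ u v i → f (λ j → u j + v j) i ≡ f u i + f v i
    lin-*    : ∀ c v i → f (λ j → c * v j) i ≡ c * f v i

  lin-0 : ∀ i → f (λ _ → 0ℤ) i ≡ 0ℤ
  lin-0 i = trans (lin-cong (λ _ → refl) i) (trans (lin-* 0ℤ (λ _ → 0ℤ) i) (ℤP.*-zeroˡ (f (λ _ → 0ℤ) i)))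

  lin-neg : ∀ v i → f (λ j → - v j) i ≡ - f v i
  lin-neg v i = trans (lin-cong (λ j → sym (ℤP.-1*i≡-i (v j))) i) (trans (lin-* (- 1ℤ) v i) (ℤP.-1*i≡-i (f v i)))

  lin-− : ∀ u v i → f (λ j → u j - v j) i ≡ f u i - f v i
  lin-− u v i = trans (lin-+ u (λ j → - v j) i) (cong (_+_ (f u i)) (lin-neg v i))

  lin-∑ : ∀ {l} (u : Fin l → Vect m) i → f (λ j → ∑ (λ k → u k j)) i ≡ ∑ (λ k → f (u k) i)
  lin-∑ {zero}  u i = lin-0 i
  lin-∑ {suc l} u i = trans (lin-+ (u Fin.zero) (λ j → ∑ (λ k → u (Fin.suc k) j)) i)
    (cong (_+_ (f (u Fin.zero) i)) (lin-∑ (u ∘ Fin.suc) i))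

module _ {r c : ℕ} (M : Mat r c) where

  ⊛-cong : ∀ {u v : Vect c} → (∀ j → u j ≡ v j) → ∀ i → (M ⊛ u) i ≡ (M ⊛ v) i
  ⊛-cong e i = ∑-cong (λ j → cong (M i j *_) (e j))

  ⊛-linear : Linear (M ⊛_)
  ⊛-linear = record
    { lin-cong = ⊛-cong
    ; lin-+ = λ u v i → trans (∑-cong (λ j → ℤP.*-distribˡ-+ (M i j) (u j) (v j))) (∑-+ (λ j → M i j * u j) (λ j → M i j * v j))
    ; lin-* = λ c v i → trans (∑-cong (λ j → comm (M i j) c (v j))) (∑-*ˡ c (λ j → M i j * v j))
    }
    where
    comm : ∀ x y z → x * (y * z) ≡ y * (x * z)
    comm = solve-∀

∘-linear : ∀ {m k l} {f : Vect k → Vect l} {g : Vect m → Vect k} → Linear f → Linear g → Linear (f ∘ g)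
∘-linear {f = f} {g} lf lg = record
  { lin-cong = λ e → F.lin-cong (G.lin-cong e)
  ; lin-+ = λ u v i → trans (F.lin-cong (G.lin-+ u v) i) (F.lin-+ (g u) (g v) i)
  ; lin-* = λ c v i → trans (F.lin-cong (G.lin-* c v) i) (F.lin-* c (g v) i)
  }
  where
  module F = Linear lf
  module G = Linear lg

·-⊛ : ∀ {r c d} (M : Mat r c) (N : Mat c d) v i → ((M · N) ⊛ v) i ≡ (M ⊛ (N ⊛ v)) i
·-⊛ M N v i = begin
  ∑ (λ k → ∑ (λ j → M i j * N j k) * v k) ≡⟨ ∑-cong (λ k → ∑-*ʳ (λ j → M i j * N j k) (v k)) ⟨
  ∑ (λ k → ∑ (λ j → M i j * N j k * v k)) ≡⟨ ∑-swap (λ k j → M i j * N j k * v k) ⟩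
  ∑ (λ j → ∑ (λ k → M i j * N j k * v k)) ≡⟨ ∑-cong (λ j → trans (∑-cong (λ k → ℤP.*-assoc (M i j) (N j k) (v k))) (∑-*ˡ (M i j) (λ k → N j k * v k))) ⟩
  ∑ (λ j → M i j * ∑ (λ k → N j k * v k)) ∎
  where open ≡-Reasoning

1M-⊛ : ∀ {r} (v : Vect r) i → (1M ⊛ v) i ≡ v i
1M-⊛ v i = ∑-δ i v

≈M⇒⊛ : ∀ {r c} {M N : Mat r c} → M ≈M N → ∀ v i → (M ⊛ v) i ≡ (N ⊛ v) i
≈M⇒⊛ e v i = ∑-cong (λ j → cong (_* v j) (e i j))

⊛⇒≈M : ∀ {r c} {M N : Mat r c} → (∀ v i → (M ⊛ v) i ≡ (N ⊛ v) i) → M ≈M N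
⊛⇒≈M {M = M} {N} e i j = trans (sym (∑-δʳ j (M i))) (trans (e (λ k → ind ⌊ k ≟ j ⌋) i) (∑-δʳ j (N i)))

module HomVec {n} {M N : RawLattice n} {f : Mat (rank N) (rank M)} (hom : IsHom M N f) where
  hom-⊛ : ∀ g → InA g → ∀ v i → (f ⊛ (act M g ⊛ v)) i ≡ (act N g ⊛ (f ⊛ v)) i
  hom-⊛ g ag v i = trans (sym (·-⊛ f (act M g) v i)) (trans (≈M⇒⊛ (hom g ag) v i) (·-⊛ (act N g) f v i))

InA-id : ∀ n → InA (idP {n})
InA-id n = InA-of-square {n} (λ x → x) (λ x → x) (λ _ _ e → e) (λ _ → refl)

-- Lattices with a permuted basis, restricted to two commuting elements

module PermutationBasis {n : ℕ} (P : RawLattice n) (glP : IsGLattice P) (permP : IsPermutation P) where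

  size : ℕ
  size = rank P

  private
    𝔅 ℭ : Mat size size
    𝔅 = proj₁ permP
    ℭ = proj₁ (proj₂ permP)
    ℭ𝔅 : (ℭ · 𝔅) ≈M 1M
    ℭ𝔅 = proj₁ (proj₂ (proj₂ permP))
    𝔅ℭ : (𝔅 · ℭ) ≈M 1M
    𝔅ℭ = proj₁ (proj₂ (proj₂ (proj₂ permP)))

  σ : ∀ g → InA g → Fin size → Fin size
  σ g ag = proj₁ (proj₂ (proj₂ (proj₂ (proj₂ permP))) g ag)

  coords vec : Vect size → Vect size
  coords v = ℭ ⊛ v
  vec f = 𝔅 ⊛ f

  coords-linear : Linear coords
  coords-linear = ⊛-linear ℭ

  vec-linear : Linear vec
  vec-linear = ⊛-linear 𝔅

  coords-vec : ∀ f i → coords (vec f) i ≡ f i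
  coords-vec f i = trans (sym (·-⊛ ℭ 𝔅 f i)) (trans (≈M⇒⊛ ℭ𝔅 f i) (1M-⊛ f i))

  vec-coords : ∀ v i → vec (coords v) i ≡ v i
  vec-coords v i = trans (sym (·-⊛ 𝔅 ℭ v i)) (trans (≈M⇒⊛ 𝔅ℭ v i) (1M-⊛ v i))

  private
    act-𝔅 : ∀ g ag j i → (act P g ⊛ (λ k → 𝔅 k j)) i ≡ 𝔅 i (σ g ag j)
    act-𝔅 g ag j = proj₂ (proj₂ (proj₂ (proj₂ (proj₂ permP))) g ag) j

    -- `IsPermutation` provides each `σ g` on its own; that a basis vector determines its index is
    -- what makes these permutations compose.
    𝔅-injective : ∀ i j → (∀ k → 𝔅 k i ≡ 𝔅 k j) → i ≡ j
    𝔅-injective i j e with i ≟ j in eq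
    ... | yes i≡j = i≡j
    ... | no i≢j = ⊥-elim (1≢0 (trans (sym (ind-yes (i ≟ i) refl)) (trans (sym (ℭ𝔅 i i))
        (trans (∑-cong (λ k → cong (ℭ i k *_) (e k))) (trans (ℭ𝔅 i j) (ind-no (i ≟ j) i≢j))))))
      where
      1≢0 : ¬ 1ℤ ≡ 0ℤ
      1≢0 ()

  coords-act : ∀ g ag v i → coords (act P g ⊛ v) i ≡ push (σ g ag) (coords v) i
  coords-act g ag v i = begin
    (ℭ ⊛ (act P g ⊛ v)) i               ≡⟨ ⊛-cong ℭ (⊛-cong (act P g) (λ k → sym (vec-coords v k))) i ⟩
    (ℭ ⊛ (act P g ⊛ (𝔅 ⊛ f))) i         ≡⟨ ⊛-cong ℭ (λ k → sym (·-⊛ (act P g) 𝔅 f k)) i ⟩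
    (ℭ ⊛ ((act P g · 𝔅) ⊛ f)) i         ≡⟨ ⊛-cong ℭ (≈M⇒⊛ {M = act P g · 𝔅} {N = λ k j → 𝔅 k (σ g ag j)} (λ k j → act-𝔅 g ag j k) f) i ⟩
    (ℭ ⊛ ((λ k j → 𝔅 k (σ g ag j)) ⊛ f)) i ≡⟨ ·-⊛ ℭ (λ k j → 𝔅 k (σ g ag j)) f i ⟨
    ((ℭ · (λ k j → 𝔅 k (σ g ag j))) ⊛ f) i ≡⟨ ≈M⇒⊛ {M = ℭ · (λ k j → 𝔅 k (σ g ag j))} {N = λ i j → 1M i (σ g ag j)} (λ i j → ℭ𝔅 i (σ g ag j)) f i ⟩
    push (σ g ag) f i ∎
    where
    open ≡-Reasoning
    f = coords v

  σ-id : ∀ a j → σ idP a j ≡ j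
  σ-id a j = 𝔅-injective _ _ (λ k → trans (sym (act-𝔅 idP a j k)) (trans (≈M⇒⊛ (proj₁ glP) (λ k → 𝔅 k j) k) (1M-⊛ (λ k → 𝔅 k j) k)))

  σ-∘ : ∀ g h ag ah agh j → σ (g ∘P h) agh j ≡ σ g ag (σ h ah j)
  σ-∘ g h ag ah agh j = 𝔅-injective _ _ (λ k → begin
    𝔅 k (σ (g ∘P h) agh j)               ≡⟨ act-𝔅 (g ∘P h) agh j k ⟨
    (act P (g ∘P h) ⊛ (λ k → 𝔅 k j)) k   ≡⟨ ≈M⇒⊛ (proj₂ glP g h ag ah) (λ k → 𝔅 k j) k ⟩
    ((act P g · act P h) ⊛ (λ k → 𝔅 k j)) k ≡⟨ ·-⊛ (act P g) (act P h) (λ k → 𝔅 k j) k ⟩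
    (act P g ⊛ (act P h ⊛ (λ k → 𝔅 k j))) k ≡⟨ ⊛-cong (act P g) (act-𝔅 h ah j) k ⟩
    (act P g ⊛ (λ k → 𝔅 k (σ h ah j))) k ≡⟨ act-𝔅 g ag (σ h ah j) k ⟩
    𝔅 k (σ g ag (σ h ah j)) ∎)
    where open ≡-Reasoning

  σ-cong : ∀ {g h} (ag : InA g) (ah : InA h) → g ≡ h → ∀ j → σ g ag j ≡ σ h ah j
  σ-cong {g} ag ah refl j = cong (λ a → σ g a j) (InA-irrelevant {g = g} ag ah)

-- An even self-map s of the letters of order dividing p.  The group element [inverse] acts
-- on functions by pulling back along s.
module PeriodicElement {n : ℕ} (p : ℕ) .{{_ : ℕ.NonZero p}} (s : Fin n → Fin n) (As : InA (tabulate s))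
  (sᵖ : ∀ x → iter s p x ≡ x) where

  pow : ℕ → Perm n
  pow k = tabulate (iter s k)

  pow-∘ : ∀ i j → pow i ∘P pow j ≡ pow (i ℕ.+ j)
  pow-∘ i j = tabulate-cong (λ x → trans (lookup∘tabulate (iter s i) _)
    (trans (cong (iter s i) (lookup∘tabulate (iter s j) x)) (sym (iter-+ s i j x))))

  pow-InA : ∀ k → InA (pow k)
  pow-InA zero    = InA-id n
  pow-InA (suc k) = subst InA (pow-∘ 1 k) (InA-∘ (pow 1) (pow k) As (pow-InA k))

  inverse : Perm n
  inverse = pow (p ℕ.∸ 1)

  inverse-InA : InA inverse
  inverse-InA = pow-InA (p ℕ.∸ 1)

  private
    p∸1+1 : ∀ p .{{_ : ℕ.NonZero p}} → p ℕ.∸ 1 ℕ.+ 1 ≡ p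
    p∸1+1 (suc q) = ℕP.+-comm q 1

    pow-p : pow p ≡ idP
    pow-p = tabulate-cong sᵖ

  s-inverse : ∀ x → s (inverse ∙ x) ≡ x
  s-inverse x = trans (cong s (lookup∘tabulate (iter s (p ℕ.∸ 1)) x))
    (trans (cong (λ c → iter s c x) (trans (ℕP.+-comm 1 (p ℕ.∸ 1)) (p∸1+1 p))) (sᵖ x))

  inverse⁻¹ : ∀ x → inverse ⁻¹ ∙ x ≡ s x
  inverse⁻¹ = ⁻¹-unique inverse (InA⇒Inj inverse inverse-InA) s s-inverse

  module OnBasis (P : RawLattice n) (glP : IsGLattice P) (permP : IsPermutation P) where

    open PermutationBasis P glP permP

    S : Fin size → Fin size
    S = σ (tabulate s) As

    iterS : ∀ k j → iter S k j ≡ σ (pow k) (pow-InA k) j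
    iterS zero    j = sym (σ-id (InA-id n) j)
    iterS (suc k) j = trans (cong S (iterS k j)) (sym (trans
      (σ-cong (pow-InA (suc k)) (InA-∘ (pow 1) (pow k) As (pow-InA k)) (sym (pow-∘ 1 k)) j)
      (σ-∘ (pow 1) (pow k) As (pow-InA k) _ j)))

    Sᵖ : ∀ j → iter S p j ≡ j
    Sᵖ j = trans (iterS p j) (trans (σ-cong (pow-InA p) (InA-id n) pow-p j) (σ-id (InA-id n) j))

    coords-pull : ∀ v i → coords (act P inverse ⊛ v) i ≡ coords v (S i)
    coords-pull v i = trans (coords-act inverse inverse-InA v i)
      (push-inverse (σ inverse inverse-InA) S
        (λ i → trans (sym (iterS (p ℕ.∸ 1) (S i))) (trans (sym (iter-+ S (p ℕ.∸ 1) 1 i)) (trans (cong (λ c → iter S c i) (p∸1+1 p)) (Sᵖ i))))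
        (λ j → trans (cong S (sym (iterS (p ℕ.∸ 1) j))) (trans (cong (λ c → iter S c j) (trans (ℕP.+-comm 1 (p ℕ.∸ 1)) (p∸1+1 p))) (Sᵖ j)))
        (coords v) i)

    vec-pull : ∀ f i → vec (f ∘ S) i ≡ (act P inverse ⊛ vec f) i
    vec-pull f i = trans (Linear.lin-cong vec-linear (λ j → trans (sym (coords-vec f (S j))) (sym (coords-pull (vec f) j))) i)
      (vec-coords (act P inverse ⊛ vec f) i)

    coords-S : ∀ (t : Fin n → Fin n) (At : InA (tabulate t)) → (∀ x → s (t x) ≡ t (s x)) →
      ∀ j → S (σ (tabulate t) At j) ≡ σ (tabulate t) At (S j)
    coords-S t At st j = trans (sym (σ-∘ (tabulate s) (tabulate t) As At a₁ j)) (trans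
      (σ-cong a₁ (InA-∘ (tabulate t) (tabulate s) At As) (tabulate-cong (λ x → trans (two s t x) (trans (st x) (sym (two t s x))))) j)
      (σ-∘ (tabulate t) (tabulate s) At As _ j))
      where
      a₁ = InA-∘ (tabulate s) (tabulate t) As At
      two : ∀ (u v : Fin n → Fin n) x → lookup (tabulate u) (lookup (tabulate v) x) ≡ u (v x)
      two u v x = trans (lookup∘tabulate u _) (cong u (lookup∘tabulate v x))

-- A resolution 0 → J → P → F → 0 together with a splitting of e·F off the permutation
-- lattice P′, in coordinates and restricted to two commuting self-maps s and t of the
-- letters.  J is presented by functions on the letters, I is the inclusion J → P, Π the
-- projection P → F, A the composite P → F → P′ and Q the map P′ → F.
record Situation (n p : ℕ) (s t : Fin n → Fin n) : Set where
  field
    B B′ φ  : ℕ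
    𝑆 𝑇     : Fin B → Fin B
    𝑆′ 𝑇′   : Fin B′ → Fin B′
    ST      : ∀ j → 𝑆 (𝑇 j) ≡ 𝑇 (𝑆 j)
    Sᵖ      : ∀ j → iter 𝑆 p j ≡ j
    Tᵖ      : ∀ j → iter 𝑇 p j ≡ j
    ST′     : ∀ j → 𝑆′ (𝑇′ j) ≡ 𝑇′ (𝑆′ j)
    Sᵖ′     : ∀ j → iter 𝑆′ p j ≡ j
    Tᵖ′     : ∀ j → iter 𝑇′ p j ≡ j
    I       : (Fin n → ℤ) → Fin B → ℤ
    I-lin   : Linear I
    I-const : ∀ c j → I (λ _ → c) j ≡ 0ℤ
    I-inj   : ∀ (w : Vect n) → (∀ j → I w j ≡ 0ℤ) → ∀ x y → w x ≡ w y
    I-S     : ∀ (w : Vect n) j → I (w ∘ s) j ≡ I w (𝑆 j)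
    I-T     : ∀ (w : Vect n) j → I (w ∘ t) j ≡ I w (𝑇 j)
    Π       : Vect B → Vect φ
    Π-lin   : Linear Π
    Π-I     : ∀ (w : Vect n) i → Π (I w) i ≡ 0ℤ
    Π-ker   : ∀ (v : Vect B) → (∀ i → Π v i ≡ 0ℤ) → ∃ λ (w : Vect n) → ∀ j → v j ≡ I w j
    Π-surj  : ∀ (y : Vect φ) → ∃ λ (u : Vect B) → ∀ i → Π u i ≡ y i
    sF tF   : Vect φ → Vect φ
    sF-lin  : Linear sF
    tF-lin  : Linear tF
    Π-S     : ∀ (u : Vect B) i → Π (u ∘ 𝑆) i ≡ sF (Π u) i
    Π-T     : ∀ (u : Vect B) i → Π (u ∘ 𝑇) i ≡ tF (Π u) i
    A       : Vect φ → Vect B′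
    A-lin   : Linear A
    A-S     : ∀ (y : Vect φ) j → A (sF y) j ≡ A y (𝑆′ j)
    A-T     : ∀ (y : Vect φ) j → A (tF y) j ≡ A y (𝑇′ j)
    Q       : Vect B′ → Vect φ
    Q-lin   : Linear Q
    Q-S     : ∀ (q : Vect B′) i → Q (q ∘ 𝑆′) i ≡ sF (Q q) i
    Q-T     : ∀ (q : Vect B′) i → Q (q ∘ 𝑇′) i ≡ tF (Q q) i
    e       : ℕ
    p∤e     : ¬ p ∣ e
    Q-A     : ∀ (y : Vect φ) i → Q (A y) i ≡ + e * y i

module _ {n : ℕ} (fm : FunctionsModConstants n) (p : ℕ) .{{_ : ℕ.NonZero p}} (s t : Fin n → Fin n)
  (As : InA (tabulate s)) (At : InA (tabulate t)) (st : ∀ x → s (t x) ≡ t (s x))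
  (sᵖ : ∀ x → iter s p x ≡ x) (tᵖ : ∀ x → iter t p x ≡ x) where

  open FunctionsModConstants fm

  -- `sF` and `tF` are the actions of the inverse elements, so that functions on the letters and on
  -- both bases are all pulled back along self-maps.
  situation : (P F : RawLattice n) → IsGLattice P → ShortExact lattice P F → IsPermutation P →
    IntInvertible p F → Situation n p s t
  situation P F glP (i , π , ihom , πhom , inj , surj , πi , exact) permP
    (P′ , glP′ , permP′ , ι , ρ , e , p∤e , ιhom , ρhom , ρι) = record
    { B = B.size ; B′ = B′.size ; φ = rank F
    ; 𝑆 = SB.S ; 𝑇 = TB.S ; 𝑆′ = SB′.S ; 𝑇′ = TB′.S
    ; ST = SB.coords-S t At st ; Sᵖ = SB.Sᵖ ; Tᵖ = TB.Sᵖ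
    ; ST′ = SB′.coords-S t At st ; Sᵖ′ = SB′.Sᵖ ; Tᵖ′ = TB′.Sᵖ
    ; I = I ; I-lin = I-lin
    ; I-const = λ c j → trans (Linear.lin-cong CI-lin (λ l → ℤP.+-inverseʳ c) j) (Linear.lin-0 CI-lin j)
    ; I-inj = λ w I0 x y → let
        res0 : ∀ l → res w l ≡ 0ℤ
        res0 = inj (res w) (λ k → trans (sym (B.vec-coords (i ⊛ res w) k))
          (trans (Linear.lin-cong B.vec-linear I0 k) (Linear.lin-0 B.vec-linear k)))
        w≡wa : ∀ x → w x - w a ≡ 0ℤ
        w≡wa x = trans (sym (ext-res w x)) (∑-zero (λ l → trans (cong (ind ⌊ x ≟ b l ⌋ *_) (res0 l)) (ℤP.*-zeroʳ (ind ⌊ x ≟ b l ⌋))))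
      in trans (ℤP.i-j≡0⇒i≡j (w x) (w a) (w≡wa x)) (sym (ℤP.i-j≡0⇒i≡j (w y) (w a) (w≡wa y)))
    ; I-S = I-pull s As sᵖ
    ; I-T = I-pull t At tᵖ
    ; Π = Π ; Π-lin = Π-lin
    ; Π-I = λ w k → trans (⊛-cong π (B.vec-coords (i ⊛ res w)) k) (πi (res w) k)
    ; Π-ker = λ v e → let (x , q) = exact (B.vec v) e in
        ext x , λ j → trans (sym (B.coords-vec v j)) (Linear.lin-cong B.coords-linear
          (λ k → trans (sym (q k)) (⊛-cong i (λ l → sym (res-ext x l)) k)) j)
    ; Π-surj = λ y → let (x , q) = surj y in B.coords x , λ k → trans (⊛-cong π (B.vec-coords x) k) (q k)
    ; sF = act F SE.inverse ⊛_ ; tF = act F TE.inverse ⊛_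
    ; sF-lin = ⊛-linear (act F SE.inverse) ; tF-lin = ⊛-linear (act F TE.inverse)
    ; Π-S = λ u k → trans (⊛-cong π (SB.vec-pull u) k) (HomVec.hom-⊛ {M = P} {F} {π} πhom SE.inverse SE.inverse-InA (B.vec u) k)
    ; Π-T = λ u k → trans (⊛-cong π (TB.vec-pull u) k) (HomVec.hom-⊛ {M = P} {F} {π} πhom TE.inverse TE.inverse-InA (B.vec u) k)
    ; A = λ y → B′.coords (ι ⊛ y)
    ; A-lin = ∘-linear B′.coords-linear (⊛-linear ι)
    ; A-S = λ y j → trans (Linear.lin-cong B′.coords-linear (HomVec.hom-⊛ {M = F} {P′} {ι} ιhom SE.inverse SE.inverse-InA y) j) (SB′.coords-pull (ι ⊛ y) j)
    ; A-T = λ y j → trans (Linear.lin-cong B′.coords-linear (HomVec.hom-⊛ {M = F} {P′} {ι} ιhom TE.inverse TE.inverse-InA y) j) (TB′.coords-pull (ι ⊛ y) j)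
    ; Q = λ q → ρ ⊛ B′.vec q
    ; Q-lin = ∘-linear (⊛-linear ρ) B′.vec-linear
    ; Q-S = λ q k → trans (⊛-cong ρ (SB′.vec-pull q) k) (HomVec.hom-⊛ {M = P′} {F} {ρ} ρhom SE.inverse SE.inverse-InA (B′.vec q) k)
    ; Q-T = λ q k → trans (⊛-cong ρ (TB′.vec-pull q) k) (HomVec.hom-⊛ {M = P′} {F} {ρ} ρhom TE.inverse TE.inverse-InA (B′.vec q) k)
    ; e = e ; p∤e = p∤e
    ; Q-A = λ y k → trans (⊛-cong ρ (B′.vec-coords (ι ⊛ y)) k) (trans (sym (·-⊛ ρ ι y k))
        (trans (∑-cong (λ l → trans (cong (_* y l) (ρι k l)) (ℤP.*-assoc (+ e) (1M k l) (y l))))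
          (trans (∑-*ˡ (+ e) (λ l → 1M k l * y l)) (cong (+ e *_) (1M-⊛ y k)))))
    }
    where
    module B = PermutationBasis P glP permP
    module B′ = PermutationBasis P′ glP′ permP′
    module SE = PeriodicElement p s As sᵖ
    module TE = PeriodicElement p t At tᵖ
    module SB = SE.OnBasis P glP permP
    module TB = TE.OnBasis P glP permP
    module SB′ = SE.OnBasis P′ glP′ permP′
    module TB′ = TE.OnBasis P′ glP′ permP′
    CI-lin : Linear (λ w → B.coords (i ⊛ w))
    CI-lin = ∘-linear B.coords-linear (⊛-linear i)
    res-lin : Linear res
    res-lin = record
      { lin-cong = λ e l → cong₂ _-_ (e (b l)) (e a)
      ; lin-+ = λ u v l → alg (u (b l)) (v (b l)) (u a) (v a)
      ; lin-* = λ c v l → alg′ c (v (b l)) (v a)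
      }
      where
      alg : ∀ x y z w → x + y - (z + w) ≡ x - z + (y - w)
      alg = solve-∀
      alg′ : ∀ c x y → c * x - c * y ≡ c * (x - y)
      alg′ = solve-∀
    I : (Fin n → ℤ) → Fin B.size → ℤ
    I w = B.coords (i ⊛ res w)
    I-lin : Linear I
    I-lin = ∘-linear CI-lin res-lin
    Π : Vect B.size → Vect (rank F)
    Π v = π ⊛ B.vec v
    Π-lin : Linear Π
    Π-lin = ∘-linear (⊛-linear π) B.vec-linear
    I-pull : ∀ s (As : InA (tabulate s)) (sᵖ : ∀ x → iter s p x ≡ x) w j →
      I (w ∘ s) j ≡ I w (B.σ (tabulate s) As j)
    I-pull s As sᵖ w j = begin
      B.coords (i ⊛ res (w ∘ s)) j                         ≡⟨ Linear.lin-cong CI-lin (λ l → sym (act-pull l)) j ⟩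
      B.coords (i ⊛ (act lattice E.inverse ⊛ res w)) j
        ≡⟨ Linear.lin-cong B.coords-linear (HomVec.hom-⊛ {M = lattice} {P} {i} ihom E.inverse E.inverse-InA (res w)) j ⟩
      B.coords (act P E.inverse ⊛ (i ⊛ res w)) j           ≡⟨ EB.coords-pull (i ⊛ res w) j ⟩
      B.coords (i ⊛ res w) (B.σ (tabulate s) As j) ∎
      where
      open ≡-Reasoning
      module E = PeriodicElement p s As sᵖ
      module EB = E.OnBasis P glP permP
      alg : ∀ x y z → x - y - (z - y) ≡ x - z
      alg = solve-∀
      act-pull : ∀ l → (act lattice E.inverse ⊛ res w) l ≡ res (w ∘ s) l
      act-pull l = trans (act-res E.inverse (res w) l) (trans
        (cong₂ _-_ (trans (ext-res w _) (cong (λ x → w x - w a) (E.inverse⁻¹ (b l))))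
                   (trans (ext-res w _) (cong (λ x → w x - w a) (E.inverse⁻¹ a))))
        (alg (w (s (b l))) (w a) (w (s a))))

-- Cohomological vanishing transferred from P′ to F

module Transfer {n p : ℕ} {s t : Fin n → Fin n} (sit : Situation n p s t) where

  open Situation sit
  open Linear I-lin using () renaming (lin-cong to I-cong; lin-+ to I-+; lin-* to I-*; lin-− to I-−; lin-∑ to I-∑) public
  private
    module Πᴸ = Linear Π-lin
    module Aᴸ = Linear A-lin
    module Qᴸ = Linear Q-lin
    module sᴸ = Linear sF-lin
    module tᴸ = Linear tF-lin

  mod-I : ∀ (u v : Vect B) → (∀ i → Π u i ≡ Π v i) → ∃ λ (w : Vect n) → ∀ j → u j ≡ v j + I w j
  mod-I u v e =
    let (w , q) = Π-ker (λ j → u j - v j) (λ i → trans (Πᴸ.lin-− u v i) (trans (cong (λ z → z - Π v i) (e i)) (ℤP.+-inverseʳ (Π v i))))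
    in w , λ j → trans (alg (u j) (v j)) (cong (_+_ (v j)) (q j))
    where
    alg : ∀ x y → x ≡ y + (x - y)
    alg = solve-∀

  Π-mod : ∀ {u v : Vect B} (w : Vect n) → (∀ j → u j ≡ v j + I w j) → ∀ i → Π u i ≡ Π v i
  Π-mod {u} {v} w e i = trans (Πᴸ.lin-cong e i) (trans (Πᴸ.lin-+ v (I w) i) (trans (cong (_+_ (Π v i)) (Π-I w i)) (ℤP.+-identityʳ (Π v i))))

  private
    α : Vect B → Vect B′
    α u = A (Π u)

    α-S : ∀ u j → α (u ∘ 𝑆) j ≡ α u (𝑆′ j)
    α-S u j = trans (Aᴸ.lin-cong (Π-S u) j) (A-S (Π u) j)

    α-T : ∀ u j → α (u ∘ 𝑇) j ≡ α u (𝑇′ j)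
    α-T u j = trans (Aᴸ.lin-cong (Π-T u) j) (A-T (Π u) j)

    α-iter : (G : Fin B → Fin B) (G′ : Fin B′ → Fin B′) → (∀ u j → α (u ∘ G) j ≡ α u (G′ j)) →
      ∀ k u j → α (u ∘ iter G k) j ≡ α u (iter G′ k j)
    α-iter G G′ h zero    u j = refl
    α-iter G G′ h (suc k) u j = trans (α-iter G G′ h k (u ∘ G) j) (h u (iter G′ k j))

    α-N : (G : Fin B → Fin B) (G′ : Fin B′ → Fin B′) → (∀ u j → α (u ∘ G) j ≡ α u (G′ j)) →
      ∀ u j → α (N p G u) j ≡ N p G′ (α u) j
    α-N G G′ h u j = trans (Aᴸ.lin-cong (Πᴸ.lin-∑ {p} (λ k → u ∘ iter G (toℕ k))) j)
      (trans (Aᴸ.lin-∑ {p} (λ k → Π (u ∘ iter G (toℕ k))) j) (∑-cong {p} (λ k → α-iter G G′ h (toℕ k) u j)))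

    Q-invariant : ∀ q u → (∀ i → Π u i ≡ Q q i) → (∀ j → q (𝑆′ j) ≡ q j) → ∃ λ (y : Vect n) → ∀ j → u (𝑆 j) ≡ u j + I y j
    Q-invariant q u Πu qS = mod-I (u ∘ 𝑆) u (λ i → trans (Π-S u i) (trans (sᴸ.lin-cong Πu i)
      (trans (sym (Q-S q i)) (trans (Qᴸ.lin-cong qS i) (sym (Πu i))))))

    Q-pull : ∀ q u → (∀ i → Π u i ≡ Q q i) → ∀ i → Π (u ∘ 𝑇) i ≡ Q (q ∘ 𝑇′) i
    Q-pull q u Πu i = trans (Π-T u i) (trans (tᴸ.lin-cong Πu i) (sym (Q-T q i)))

    Q-pulls : ∀ k q u → (∀ i → Π u i ≡ Q q i) → ∀ i → Π (u ∘ iter 𝑇 k) i ≡ Q (q ∘ iter 𝑇′ k) i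
    Q-pulls zero    q u Πu = Πu
    Q-pulls (suc k) q u Πu = Q-pulls k (q ∘ 𝑇′) (u ∘ 𝑇) (Q-pull q u Πu)

    Π-e : ∀ v i → Π (λ j → + e * v j) i ≡ Q (α v) i
    Π-e v i = trans (Πᴸ.lin-* (+ e) v i) (sym (Q-A (Π v) i))

    coboundary : ∀ v q → (∀ j → α v j ≡ q (𝑇′ j) - q j) → ∀ u → (∀ i → Π u i ≡ Q q i) →
      ∃ λ (z : Vect n) → ∀ j → + e * v j ≡ u (𝑇 j) - u j + I z j
    coboundary v q eq u Πu = mod-I (λ j → + e * v j) (λ j → u (𝑇 j) - u j) (λ i → trans (Π-e v i)
      (trans (Qᴸ.lin-cong eq i) (trans (Qᴸ.lin-− (q ∘ 𝑇′) q i)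
        (trans (cong₂ _-_ (sym (Q-pull q u Πu i)) (sym (Πu i))) (sym (Πᴸ.lin-− (u ∘ 𝑇) u i))))))

  module _ (pr : Prime p) where

    -- Ĥ⁰(⟨s,t⟩/⟨s⟩, F^s) has no classes vanishing on all cyclic subgroups.
    transfer-norm : ∀ v → (∀ i → Π (v ∘ 𝑆) i ≡ Π v i) → (∀ i → Π (v ∘ 𝑇) i ≡ Π v i) →
      (∀ c → ∃ λ x → ∀ i → Π v i ≡ Π (N p (λ j → iter 𝑆 c (𝑇 j)) x) i) →
      ∃ λ (u : Vect B) → ∃ λ (y : Vect n) → ∃ λ (z : Vect n) →
        (∀ j → + e * v j ≡ N p 𝑇 u j + I z j) × (∀ j → u (𝑆 j) ≡ u j + I y j)
    transfer-norm v vS vT vN = u , proj₁ inv , proj₁ norm , proj₂ norm , proj₂ inv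
      where
      open CommutingMaps p pr 𝑆′ 𝑇′ ST′ Sᵖ′ Tᵖ′ using (invariant-norm)
      -- A point of an `S`-orbit of the basis of `P′` fixed by `T` is fixed by some s^c t. Since `v`
      -- is a norm of that element in `F`, its image takes there `p` times a value.
      divisible : ∀ j → (∃ λ c → iter 𝑆′ c (𝑇′ j) ≡ j) → ∃ λ q → α v j ≡ + p * q
      divisible j (c , fix) = α x j , (begin
        α v j                                   ≡⟨ Aᴸ.lin-cong (proj₂ (vN c)) j ⟩
        α (N p G x) j                           ≡⟨ α-N G G′ (λ u j → trans (α-T (u ∘ iter 𝑆 c) j) (α-iter 𝑆 𝑆′ α-S c u (𝑇′ j))) x j ⟩
        ∑ {p} (λ k → α x (iter G′ (toℕ k) j))   ≡⟨ ∑-cong {p} (λ k → cong (α x) (iter-fix G′ (toℕ k) fix)) ⟩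
        ∑ {p} (λ k → α x j)                     ≡⟨ ∑-const p (α x j) ⟩
        + p * α x j ∎)
        where
        open ≡-Reasoning
        x = proj₁ (vN c)
        G : Fin B → Fin B
        G j = iter 𝑆 c (𝑇 j)
        G′ : Fin B′ → Fin B′
        G′ j = iter 𝑆′ c (𝑇′ j)
      r,_ = invariant-norm (α v) (λ j → trans (sym (α-S v j)) (Aᴸ.lin-cong vS j))
        (λ j → trans (sym (α-T v j)) (Aᴸ.lin-cong vT j)) divisible
      r = proj₁ r,_
      -- `r` lives on the basis of `P′`. Its image in `F` is lifted to `P`, where invariance under s
      -- survives only up to an error `I y`.
      u = proj₁ (Π-surj (Q r))
      Πu = proj₂ (Π-surj (Q r))
      inv = Q-invariant r u Πu (proj₁ (proj₂ r,_))
      norm = mod-I (λ j → + e * v j) (N p 𝑇 u) (λ i → trans (Π-e v i) (trans (Qᴸ.lin-cong (proj₂ (proj₂ r,_)) i)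
        (trans (Qᴸ.lin-∑ {p} (λ k → r ∘ iter 𝑇′ (toℕ k)) i)
          (trans (∑-cong {p} (λ k → sym (Q-pulls (toℕ k) r u Πu i))) (sym (Πᴸ.lin-∑ {p} (λ k → u ∘ iter 𝑇 (toℕ k)) i))))))

    -- Ĥ⁻¹(⟨t⟩, F) = 0.
    transfer-cyclic : ∀ v → (∀ i → Π (N p 𝑇 v) i ≡ 0ℤ) →
      ∃ λ (u : Vect B) → ∃ λ (z : Vect n) → ∀ j → + e * v j ≡ u (𝑇 j) - u j + I z j
    transfer-cyclic v v0 = u , coboundary v (proj₁ q,_) (proj₂ q,_) u (proj₂ (Π-surj (Q (proj₁ q,_))))
      where
      cyclic : ∀ p′ → p ≡ suc p′ → ∃ λ (q : Vect B′) → ∀ j → α v j ≡ q (𝑇′ j) - q j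
      cyclic p′ eq = norm-zero-cyclic p′ 𝑇′ (λ j → subst (λ p → iter 𝑇′ p j ≡ j) eq (Tᵖ′ j)) (α v)
        (λ j → trans (cong (λ p → N p 𝑇′ (α v) j) (sym eq)) (trans (sym (α-N 𝑇 𝑇′ α-T v j)) (trans (Aᴸ.lin-cong v0 j) (Aᴸ.lin-0 j))))
      q,_ = cyclic (p ℕ.∸ 1) (sym (ℕP.suc-pred p {{prime⇒nonZero pr}}))
      u = proj₁ (Π-surj (Q (proj₁ q,_)))

  -- H¹(⟨s,t⟩, F) = 0.
  transfer-H¹ : p ≡ 2 → ∀ v → (∀ i → Π (v ∘ 𝑆) i ≡ Π v i) → (∀ i → Π v i + Π (v ∘ 𝑇) i ≡ 0ℤ) →
    ∃ λ (u : Vect B) → ∃ λ (y : Vect n) → ∃ λ (z : Vect n) →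
      (∀ j → + e * v j ≡ u (𝑇 j) - u j + I z j) × (∀ j → u (𝑆 j) ≡ u j + I y j)
  transfer-H¹ p≡2 v vS vT = u , proj₁ inv , proj₁ cob , proj₂ cob , proj₂ inv
    where
    open CommutingInvolutions 𝑆′ 𝑇′ ST′ (λ j → subst (λ p → iter 𝑆′ p j ≡ j) p≡2 (Sᵖ′ j))
      (λ j → subst (λ p → iter 𝑇′ p j ≡ j) p≡2 (Tᵖ′ j)) using (invariant-norm-zero)
    q,_ = invariant-norm-zero (α v) (λ j → trans (sym (α-S v j)) (Aᴸ.lin-cong vS j))
      (λ j → trans (cong (_+_ (α v j)) (sym (α-T v j))) (trans (sym (Aᴸ.lin-+ (Π v) (Π (v ∘ 𝑇)) j)) (trans (Aᴸ.lin-cong vT j) (Aᴸ.lin-0 j))))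
    q = proj₁ q,_
    u = proj₁ (Π-surj (Q q))
    Πu = proj₂ (Π-surj (Q q))
    inv = Q-invariant q u Πu (proj₁ (proj₂ q,_))
    cob = coboundary v q (proj₂ (proj₂ q,_)) u Πu

-- Three configurations obstructing p-invertibility

+-∣ : ∀ {p m} Z → + m ≡ + p * Z → p ∣ m
+-∣ {p} {m} Z e = divides ∣ Z ∣ (trans (cong ∣_∣ e) (trans (ℤP.abs-* (+ p) Z) (ℕP.*-comm p ∣ Z ∣)))

-- Nested applications derive an equation from a linear combination of known equations, the
-- identity left to check being a ring identity.
combine₁ : ∀ {x y l r} → l ≡ r → x ≡ y + (l - r) → x ≡ y
combine₁ {y = y} {l} refl e = trans e (trans (cong (_+_ y) (ℤP.+-inverseʳ l)) (ℤP.+-identityʳ y))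

module _ {n p : ℕ} {s t : Fin n → Fin n} (sit : Situation n p s t) where

  open Situation sit
  open Transfer sit

  -- `I` forgets constants, so an identity in `P` is exploited by comparing two letters.
  I-equal : ∀ f g → (∀ j → I f j ≡ I g j) → ∀ x y → f x - g x ≡ f y - g y
  I-equal f g e = I-inj (λ x → f x - g x) (λ j → trans (I-− f g j) (trans (cong (_- I g j) (e j)) (ℤP.+-inverseʳ (I g j))))

-- p = 2, the Klein four-group ⟨s,t⟩ having a regular orbit and acting so that the
-- constant function 1 is a norm.
module FreeKlein {n : ℕ} {s t : Fin n → Fin n} (sit : Situation n 2 s t)
  (st : ∀ x → s (t x) ≡ t (s x)) (s² : ∀ x → s (s x) ≡ x)
  (E : Fin n → ℤ) (NE : ∀ x → E x + E (s x) + E (t x) + E (s (t x)) ≡ 1ℤ)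
  (x₀ : Fin n) (Ex₀ : E x₀ + E (t x₀) ≡ 1ℤ) (Esx₀ : E (s x₀) + E (t (s x₀)) ≡ 0ℤ) where

  open Situation sit
  open Transfer sit

  private
    g : Fin 4 → Fin B → Fin B
    g Fin.zero j = j
    g (Fin.suc Fin.zero) j = 𝑆 j
    g (Fin.suc (Fin.suc Fin.zero)) j = 𝑇 j
    g (Fin.suc (Fin.suc (Fin.suc Fin.zero))) j = 𝑆 (𝑇 j)

    g-involutive : ∀ k j → g k (g k j) ≡ j
    g-involutive 0F j = refl
    g-involutive 1F j = Sᵖ j
    g-involutive 2F j = Tᵖ j
    g-involutive 3F j = trans (cong 𝑆 (trans (sym (ST (𝑇 j))) (cong 𝑆 (Tᵖ j)))) (Sᵖ j)

    mul : Fin 4 → Fin 4 → Fin 4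
    mul 0F l  = l
    mul 1F 0F = 1F
    mul 1F 1F = 0F
    mul 1F 2F = 3F
    mul 1F 3F = 2F
    mul 2F 0F = 2F
    mul 2F 1F = 3F
    mul 2F 2F = 0F
    mul 2F 3F = 1F
    mul 3F 0F = 3F
    mul 3F 1F = 2F
    mul 3F 2F = 1F
    mul 3F 3F = 0F

    g-mul : ∀ k l j → g (mul k l) j ≡ g k (g l j)
    g-mul 0F l  j = refl
    g-mul 1F 0F j = refl
    g-mul 1F 1F j = sym (Sᵖ j)
    g-mul 1F 2F j = refl
    g-mul 1F 3F j = sym (Sᵖ (𝑇 j))
    g-mul 2F 0F j = refl
    g-mul 2F 1F j = ST j
    g-mul 2F 2F j = sym (Tᵖ j)
    g-mul 2F 3F j = trans (cong 𝑆 (sym (Tᵖ j))) (ST (𝑇 j))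
    g-mul 3F 0F j = refl
    g-mul 3F 1F j = trans (cong 𝑇 (sym (Sᵖ j))) (sym (ST (𝑆 j)))
    g-mul 3F 2F j = cong 𝑆 (sym (Tᵖ j))
    g-mul 3F 3F j = sym (g-involutive 3F j)

    R : Fin B → Fin B → Set
    R i j = ∃ λ k → g k i ≡ j

    open Representative {R = R} (λ i j → FinP.any? (λ k → g k i ≟ j)) (λ i → 0F , refl)

    rep-g : ∀ k j → rep (g k j) ≡ rep j
    rep-g k j = rep-cong (g k j) j
      (λ { _ (l , refl) → mul l k , g-mul l k j })
      (λ { _ (l , refl) → mul l k , trans (g-mul l k (g k j)) (cong (g l) (g-involutive k j)) })

    pull : ∀ k f j → push (g k) f j ≡ f (g k j)
    pull k = push-inverse (g k) (g k) (g-involutive k) (g-involutive k)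

    ε : Fin B → ℤ
    ε = I E

    I-STε : ∀ j → I (λ x → E (s (t x))) j ≡ ε (𝑆 (𝑇 j))
    I-STε j = trans (I-T (E ∘ s) j) (I-S E (𝑇 j))

    norm0 : ∀ j → ε j + (ε (𝑆 j) + (ε (𝑇 j) + (ε (𝑆 (𝑇 j)) + 0ℤ))) ≡ 0ℤ
    norm0 j = begin
      ε j + (ε (𝑆 j) + (ε (𝑇 j) + (ε (𝑆 (𝑇 j)) + 0ℤ))) ≡⟨ assoc (ε j) (ε (𝑆 j)) (ε (𝑇 j)) (ε (𝑆 (𝑇 j))) ⟩
      ε j + ε (𝑆 j) + ε (𝑇 j) + ε (𝑆 (𝑇 j)) ≡⟨ cong₂ _+_ (cong₂ _+_ (cong (_+_ (ε j)) (I-S E j)) (I-T E j)) (I-STε j) ⟨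
      I E j + I (E ∘ s) j + I (E ∘ t) j + I (λ x → E (s (t x))) j
        ≡⟨ trans (I-+ (λ x → E x + E (s x) + E (t x)) (λ x → E (s (t x))) j)
             (cong (λ z → z + I (λ x → E (s (t x))) j) (trans (I-+ (λ x → E x + E (s x)) (E ∘ t) j)
               (cong (λ z → z + I (E ∘ t) j) (I-+ E (E ∘ s) j)))) ⟨
      I (λ x → E x + E (s x) + E (t x) + E (s (t x))) j ≡⟨ I-cong NE j ⟩
      I (λ _ → 1ℤ) j ≡⟨ I-const 1ℤ j ⟩
      0ℤ ∎
      where
      open ≡-Reasoning
      assoc : ∀ a b c d → a + (b + (c + (d + 0ℤ))) ≡ a + b + c + d
      assoc = solve-∀

    coinv = coinvariants g rep (λ j → proj₁ (rep-R j)) rep-g (λ j → proj₂ (rep-R j)) ε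
      (λ i → trans (∑-cong (λ k → pull k ε i)) (norm0 i))
    y : Fin 4 → Fin B → ℤ
    y = proj₁ coinv

    α β : Fin B → ℤ
    α j = y 1F j + y 3F (𝑇 j)
    β j = y 2F j + y 3F j

    -- The norm of `E` is a constant, which `I` kills, so the norm of `ε` vanishes and Ĥ⁻¹ of a
    -- permutation lattice applies. Writing ST - 1 as (S - 1) T + (T - 1) distributes the third
    -- generator over the other two, and `ε` becomes (S - 1) α + (T - 1) β.
    ε-split : ∀ j → ε j ≡ α (𝑆 j) - α j + (β (𝑇 j) - β j)
    ε-split j = trans (proj₂ coinv j) (trans
      (cong₂ _+_ (cong (_- y 0F j) (pull 0F (y 0F) j)) (cong₂ _+_ (cong (_- y 1F j) (pull 1F (y 1F) j))
        (cong₂ _+_ (cong (_- y 2F j) (pull 2F (y 2F) j)) (cong (_+ 0ℤ) (cong (_- y 3F j) (trans (pull 3F (y 3F) j) (cong (y 3F) (ST j))))))))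
      (alg (y 0F j) (y 1F (𝑆 j)) (y 1F j) (y 2F (𝑇 j)) (y 2F j) (y 3F (𝑇 (𝑆 j))) (y 3F (𝑇 j)) (y 3F j)))
      where
      alg : ∀ a b b′ c c′ d d′ d″ → a - a + (b - b′ + (c - c′ + (d - d″ + 0ℤ))) ≡
        b + d - (b′ + d′) + (c + d′ - (c′ + d″))
      alg = solve-∀

    w₁ : Fin n → ℤ
    w₁ x = E x + E (t x)

    -- Applying 1 + T to the splitting of `ε` gives I w₁ = (1 + T)(S - 1) α, and both (S - 1) v and
    -- - (1 + T) v are equal to it. In `F`, `v` is therefore fixed by s and annihilated by 1 + t: a
    -- 1-cocycle.
    v : Fin B → ℤ
    v j = α (𝑇 j) - α (𝑆 j)

    I-w₁ : ∀ j → I w₁ j ≡ α (𝑆 j) - α j + (α (𝑆 (𝑇 j)) - α (𝑇 j))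
    I-w₁ j = trans (I-+ E (E ∘ t) j) (trans (cong₂ _+_ (ε-split j)
        (trans (I-T E j) (trans (ε-split (𝑇 j)) (cong (λ z → α (𝑆 (𝑇 j)) - α (𝑇 j) + (β z - β (𝑇 j))) (Tᵖ j)))))
      (alg (α (𝑆 j)) (α j) (β (𝑇 j)) (β j) (α (𝑆 (𝑇 j))) (α (𝑇 j))))
      where
      alg : ∀ a a′ b b′ c c′ → a - a′ + (b - b′) + (c - c′ + (b′ - b)) ≡ a - a′ + (c - c′)
      alg = solve-∀

    v-S : ∀ j → v (𝑆 j) ≡ v j + I w₁ j
    v-S j = trans (cong₂ _-_ (cong α (sym (ST j))) (cong α (Sᵖ j))) (trans
      (alg (α (𝑆 (𝑇 j))) (α j) (α (𝑇 j)) (α (𝑆 j))) (cong (_+_ (v j)) (sym (I-w₁ j))))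
      where
      alg : ∀ a b c d → a - b ≡ c - d + (d - b + (a - c))
      alg = solve-∀

    v-T : ∀ j → v j + v (𝑇 j) ≡ - I w₁ j
    v-T j = trans (cong (λ z → v j + (α z - α (𝑆 (𝑇 j)))) (Tᵖ j)) (trans
      (alg (α (𝑇 j)) (α (𝑆 j)) (α j) (α (𝑆 (𝑇 j)))) (cong -_ (sym (I-w₁ j))))
      where
      alg : ∀ a b c d → a - b + (c - d) ≡ - (b - c + (d - a))
      alg = solve-∀

    Π-v-T : ∀ i → Π v i + Π (v ∘ 𝑇) i ≡ 0ℤ
    Π-v-T i = trans (sym (Linear.lin-+ Π-lin v (v ∘ 𝑇) i)) (trans (Linear.lin-cong Π-lin v-T i)
      (trans (Linear.lin-neg Π-lin (I w₁) i) (cong -_ (Π-I w₁ i))))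

  -- If e v = (T - 1) u + I z with (S - 1) u = I y, applying S - 1 shows that e w₁ - (t - 1) y - (s
  -- - 1) z is a constant `c₁`, and (1 + s) y is constant because S² = 1. Adding the values at `x₀`
  -- and `s x₀` cancels `y` and `z` and leaves e = 2 c₁.
  impossible : ⊥
  impossible = final (transfer-H¹ refl v (Π-mod w₁ v-S) Π-v-T)
    where
    final : (∃ λ (u : Vect B) → ∃ λ (y : Vect n) → ∃ λ (z : Vect n) →
      (∀ j → + e * v j ≡ u (𝑇 j) - u j + I z j) × (∀ j → u (𝑆 j) ≡ u j + I y j)) → ⊥
    final (u , y , z , ev , uS) = p∤e (+-∣ c₁ (begin
      + e                                   ≡⟨ ℤP.*-identityʳ (+ e) ⟨
      + e * 1ℤ                              ≡⟨ cong (+ e *_) Ex₀ ⟨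
      + e * w₁ x₀                           ≡⟨ alg₁ (+ e * w₁ x₀) (y (t x₀)) (y x₀) (z (s x₀)) (z x₀) ⟩
      c₁ + (y (t x₀) - y x₀ + (z (s x₀) - z x₀))  ≡⟨ trans (sym (ℤP.+-identityʳ (c₁ + f₁ x₀))) (cong (λ q → c₁ + f₁ x₀ + q) zero′) ⟩
      c₁ + (y (t x₀) - y x₀ + (z (s x₀) - z x₀)) + (c₁ - (0ℤ - (y (t (s x₀)) - y (s x₀) + (z x₀ - z (s x₀)))))
        ≡⟨ alg₂ c₁ (y (t x₀)) (y x₀) (z (s x₀)) (z x₀) (y (t (s x₀))) (y (s x₀)) ⟩
      + 2 * c₁ + (y (t x₀) + y (t (s x₀)) - (y x₀ + y (s x₀)))
        ≡⟨ cong (λ q → + 2 * c₁ + (y (t x₀) + y q - (y x₀ + y (s x₀)))) (st x₀) ⟨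
      + 2 * c₁ + (y (t x₀) + y (s (t x₀)) - (y x₀ + y (s x₀)))
        ≡⟨ cong (λ q → + 2 * c₁ + q) (trans (cong₂ _-_ (strip (y (t x₀) + y (s (t x₀)))) (strip (y x₀ + y (s x₀))))
             (trans (cong (_- (y x₀ + y (s x₀) - 0ℤ)) (ysum (t x₀) x₀)) (ℤP.+-inverseʳ (y x₀ + y (s x₀) - 0ℤ)))) ⟩
      + 2 * c₁ + 0ℤ                         ≡⟨ ℤP.+-identityʳ (+ 2 * c₁) ⟩
      + 2 * c₁ ∎))
      where
      open ≡-Reasoning
      strip : ∀ q → q ≡ q - 0ℤ
      strip = solve-∀
      f₁ : Fin n → ℤ
      f₁ x = y (t x) - y x + (z (s x) - z x)
      c₁ : ℤ
      c₁ = + e * w₁ x₀ - f₁ x₀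
      alg₁ : ∀ a b c d f → a ≡ a - (b - c + (d - f)) + (b - c + (d - f))
      alg₁ = solve-∀
      alg₂ : ∀ k a b c d a′ b′ → k + (a - b + (c - d)) + (k - (0ℤ - (a′ - b′ + (d - c)))) ≡ + 2 * k + (a + a′ - (b + b′))
      alg₂ = solve-∀
      I-f₁ : ∀ j → I (λ x → + e * w₁ x) j ≡ I f₁ j
      I-f₁ j = begin
        I (λ x → + e * w₁ x) j                ≡⟨ I-* (+ e) w₁ j ⟩
        + e * I w₁ j                          ≡⟨ step₁ (+ e) (v (𝑆 j)) (v j) (I w₁ j) (v-S j) ⟩
        + e * v (𝑆 j) - + e * v j             ≡⟨ cong₂ _-_ (ev (𝑆 j)) (ev j) ⟩
        u (𝑇 (𝑆 j)) - u (𝑆 j) + I z (𝑆 j) - (u (𝑇 j) - u j + I z j)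
          ≡⟨ cong₂ (λ a b → a - b + I z (𝑆 j) - (u (𝑇 j) - u j + I z j)) (trans (cong u (sym (ST j))) (uS (𝑇 j))) (uS j) ⟩
        u (𝑇 j) + I y (𝑇 j) - (u j + I y j) + I z (𝑆 j) - (u (𝑇 j) - u j + I z j)
          ≡⟨ step₂ (u (𝑇 j)) (I y (𝑇 j)) (u j) (I y j) (I z (𝑆 j)) (I z j) ⟩
        I y (𝑇 j) - I y j + (I z (𝑆 j) - I z j)
          ≡⟨ cong₂ _+_ (trans (I-− (y ∘ t) y j) (cong (_- I y j) (I-T y j))) (trans (I-− (z ∘ s) z j) (cong (_- I z j) (I-S z j))) ⟨
        I (λ x → y (t x) - y x) j + I (λ x → z (s x) - z x) j ≡⟨ I-+ (λ x → y (t x) - y x) (λ x → z (s x) - z x) j ⟨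
        I f₁ j ∎
        where
        step₁ : ∀ e a b c → a ≡ b + c → e * c ≡ e * a - e * b
        step₁ e a b c refl = lemma e b c
          where
          lemma : ∀ e b c → e * c ≡ e * (b + c) - e * b
          lemma = solve-∀
        step₂ : ∀ a b c d f g → a + b - (c + d) + f - (a - c + g) ≡ b - d + (f - g)
        step₂ = solve-∀
      zero′ : 0ℤ ≡ c₁ - (0ℤ - (y (t (s x₀)) - y (s x₀) + (z x₀ - z (s x₀))))
      zero′ = sym (trans (cong (λ q → c₁ - q) (trans
          (cong₂ _-_ (sym (trans (cong (+ e *_) Esx₀) (ℤP.*-zeroʳ (+ e)))) (cong (λ q → y (t (s x₀)) - y (s x₀) + (z q - z (s x₀))) (sym (s² x₀))))
          (I-equal sit (λ x → + e * w₁ x) f₁ I-f₁ (s x₀) x₀))) (ℤP.+-inverseʳ c₁))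
      ysum : ∀ x x′ → y x + y (s x) - 0ℤ ≡ y x′ + y (s x′) - 0ℤ
      ysum = I-equal sit (λ x → y x + y (s x)) (λ _ → 0ℤ) (λ j → trans (I-+ y (y ∘ s) j)
        (trans (cong (_+_ (I y j)) (I-S y j)) (trans (zeroed (u (𝑆 (𝑆 j))) (u (𝑆 j)) (u j) (I y j) (I y (𝑆 j)) (cong u (Sᵖ j)) (uS (𝑆 j)) (uS j))
          (sym (I-const 0ℤ j)))))
        where
        zeroed : ∀ a b c d f → a ≡ c → a ≡ b + f → b ≡ c + d → d + f ≡ 0ℤ
        zeroed a b c d f refl eq refl = trans (lemma a d f) (trans (cong (_- a) (sym eq)) (ℤP.+-inverseʳ a))
          where
          lemma : ∀ a d f → d + f ≡ a + d + f - a
          lemma = solve-∀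

-- p = 2, the Klein four-group ⟨s,t⟩ having orbits of length two with the three possible
-- stabilisers: xₐ is fixed by s, x_b by t and x_c by st.
module BiquadraticOrbits {n : ℕ} {s t : Fin n → Fin n} (sit : Situation n 2 s t)
  (st : ∀ x → s (t x) ≡ t (s x)) (xₐ x_b x_c : Fin n) (s-xₐ : s xₐ ≡ xₐ) (t-x_b : t x_b ≡ x_b) (st-x_c : s x_c ≡ t x_c)
  (c D : Fin n → ℤ) (c-s : ∀ x → c (s x) + c (t (s x)) ≡ c x + c (t x))
  (c-D : ∀ x → c x + c (t x) + (D x + D (s (t x))) ≡ 1ℤ)
  (c-x_b : c x_b + c (t x_b) ≡ 0ℤ) (c-x_c : c x_c + c (t x_c) ≡ 1ℤ) where

  open Situation sit
  open Transfer sit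

  private
    open CommutingMaps 2 prime[2] 𝑆 𝑇 ST Sᵖ Tᵖ using (invariant-norm; residue; iter-residue; _∼_)

    w : Fin n → ℤ
    w x = c x + c (t x)

    m : Fin B → ℤ
    m j = I w j

    m-T : ∀ j → m j ≡ I c j + I c (𝑇 j)
    m-T j = trans (I-+ c (c ∘ t) j) (cong (_+_ (I c j)) (I-T c j))

    m-ST : ∀ j → m j ≡ - (I D j + I D (𝑆 (𝑇 j)))
    m-ST j = begin
      I w j ≡⟨ I-cong (λ x → solve-w (w x) (D x + D (s (t x))) (c-D x)) j ⟩
      I (λ x → 1ℤ - (D x + D (s (t x)))) j ≡⟨ I-− (λ _ → 1ℤ) (λ x → D x + D (s (t x))) j ⟩
      I (λ _ → 1ℤ) j - I (λ x → D x + D (s (t x))) j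
        ≡⟨ cong₂ _-_ (I-const 1ℤ j) (trans (I-+ D (D ∘ s ∘ t) j) (cong (_+_ (I D j)) (trans (I-T (D ∘ s) j) (I-S D (𝑇 j))))) ⟩
      0ℤ - (I D j + I D (𝑆 (𝑇 j))) ≡⟨ ℤP.+-identityˡ _ ⟩
      - (I D j + I D (𝑆 (𝑇 j))) ∎
      where
      open ≡-Reasoning
      alg : ∀ x y → x ≡ x + y - y
      alg = solve-∀
      solve-w : ∀ x y → x + y ≡ 1ℤ → x ≡ 1ℤ - y
      solve-w x y e = trans (alg x y) (cong (_- y) e)

    double : ∀ x → x + x ≡ + 2 * x
    double = solve-∀

    -- If `𝑇` fixes an `𝑆`-orbit, then `𝑇` or the product `𝑆𝑇` fixes its points. As `m` is the norm
    -- of `I c` for the first and of `- I D` for the second, it is twice a value there.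
    even : ∀ j → 𝑇 j ∼ j → ∃ λ q → m j ≡ + 2 * q
    even j (k , fix) = go (residue k) (trans (iter-residue 𝑆 Sᵖ k (𝑇 j)) fix)
      where
      go : (k : Fin 2) → iter 𝑆 (toℕ k) (𝑇 j) ≡ j → ∃ λ q → m j ≡ + 2 * q
      go Fin.zero e = I c j , trans (m-T j) (trans (cong (λ z → I c j + I c z) e) (double (I c j)))
      go (Fin.suc Fin.zero) e = - I D j , trans (m-ST j) (trans (cong (λ z → - (I D j + I D z)) e) (neg (I D j)))
        where
        neg : ∀ x → - (x + x) ≡ + 2 * - x
        neg = solve-∀

    norm = invariant-norm m (λ j → trans (sym (I-S w j)) (I-cong c-s j))
      (λ j → trans (m-T (𝑇 j)) (trans (cong (λ z → I c (𝑇 j) + I c z) (Tᵖ j)) (trans (ℤP.+-comm (I c (𝑇 j)) (I c j)) (sym (m-T j))))) even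

    r : Fin B → ℤ
    r = proj₁ norm

    m-r : ∀ j → m j ≡ r j + r (𝑇 j)
    m-r j = trans (proj₂ (proj₂ norm) j) (cong (_+_ (r j)) (ℤP.+-identityʳ (r (𝑇 j))))

    -- The cocycle: `r` is fixed by `𝑆`, and (1 + T) r = I w is zero in `F`.
    Π-r-T : ∀ i → Π r i + Π (r ∘ 𝑇) i ≡ 0ℤ
    Π-r-T i = trans (sym (Linear.lin-+ Π-lin r (r ∘ 𝑇) i)) (trans (Linear.lin-cong Π-lin (λ j → sym (m-r j)) i) (Π-I w i))

  -- From e r = (T - 1) u + I z and (S - 1) u = I y it follows that three functions are constant on
  -- the letters: e w - (1 + t) z, (t - 1) y + (s - 1) z and (1 + s) y. Comparing them at `xₐ`,
  -- `x_b` and `x_c` expresses e as an even number.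
  impossible : ⊥
  impossible = final (transfer-H¹ refl r (Linear.lin-cong Π-lin (proj₁ (proj₂ norm))) Π-r-T)
    where
    final : (∃ λ (u : Vect B) → ∃ λ (y : Vect n) → ∃ λ (z : Vect n) →
      (∀ j → + e * r j ≡ u (𝑇 j) - u j + I z j) × (∀ j → u (𝑆 j) ≡ u j + I y j)) → ⊥
    final (u , y , z , er , uS) = p∤e (+-∣ (z x_c - y xₐ + y x_c - z x_b)
      (combine₁ h₃ (combine₁ h₁ (combine₁ h₂ (combine₁ y-xₐ
        (alg (+ e) (z x_c) (z (t x_c)) (z x_b) (y (t xₐ)) (y xₐ) (y (t x_c)) (y x_c)))))))
      where
      alg : ∀ e Z₁ Z₂ W Ya′ Ya Yc′ Yc → e ≡ + 2 * (Z₁ - Ya + Yc - W)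
        + (e - (Z₁ + Z₂) - (0ℤ - (W + W))) + (Yc′ - Yc + (Z₂ - Z₁) - (Ya′ - Ya)) + (Ya + Ya - (Yc + Yc′)) + (Ya′ - Ya)
      alg = solve-∀

      h₃ : + e - (z x_c + z (t x_c)) ≡ 0ℤ - (z x_b + z x_b)
      h₃ = trans (cong (_- (z x_c + z (t x_c))) (sym (trans (cong (+ e *_) c-x_c) (ℤP.*-identityʳ (+ e)))))
        (trans (I-equal sit (λ x → + e * w x) (λ x → z x + z (t x)) I-eq x_c x_b)
          (cong₂ _-_ (trans (cong (+ e *_) c-x_b) (ℤP.*-zeroʳ (+ e))) (cong (λ q → z x_b + z q) t-x_b)))
        where
        cancel : ∀ a b c d → a - b + c + (b - a + d) ≡ c + d
        cancel = solve-∀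
        I-eq : ∀ j → I (λ x → + e * w x) j ≡ I (λ x → z x + z (t x)) j
        I-eq j = begin
          I (λ x → + e * w x) j           ≡⟨ I-* (+ e) w j ⟩
          + e * m j                       ≡⟨ cong (+ e *_) (m-r j) ⟩
          + e * (r j + r (𝑇 j))           ≡⟨ ℤP.*-distribˡ-+ (+ e) (r j) (r (𝑇 j)) ⟩
          + e * r j + + e * r (𝑇 j)       ≡⟨ cong₂ _+_ (er j) (trans (er (𝑇 j)) (cong (λ k → u k - u (𝑇 j) + I z (𝑇 j)) (Tᵖ j))) ⟩
          u (𝑇 j) - u j + I z j + (u j - u (𝑇 j) + I z (𝑇 j)) ≡⟨ cancel (u (𝑇 j)) (u j) (I z j) (I z (𝑇 j)) ⟩
          I z j + I z (𝑇 j)               ≡⟨ trans (I-+ z (z ∘ t) j) (cong (_+_ (I z j)) (I-T z j)) ⟨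
          I (λ x → z x + z (t x)) j ∎
          where open ≡-Reasoning

      f₁ : Fin n → ℤ
      f₁ x = y (t x) - y x + (z (s x) - z x)

      I-f₁ : ∀ j → I f₁ j ≡ I (λ _ → 0ℤ) j
      I-f₁ j = begin
        I f₁ j ≡⟨ I-+ (λ x → y (t x) - y x) (λ x → z (s x) - z x) j ⟩
        I (λ x → y (t x) - y x) j + I (λ x → z (s x) - z x) j
          ≡⟨ cong₂ _+_ (trans (I-− (y ∘ t) y j) (cong (_- I y j) (I-T y j))) (trans (I-− (z ∘ s) z j) (cong (_- I z j) (I-S z j))) ⟩
        I y (𝑇 j) - I y j + (I z (𝑆 j) - I z j)
          ≡⟨ combine₁ (sym (er (𝑆 j))) (combine₁ (er j) (combine₁ (cong (+ e *_) (proj₁ (proj₂ norm) j))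
               (combine₁ (uS j) (combine₁ (sym (trans (cong u (sym (ST j))) (uS (𝑇 j))))
                 (alg′ (+ e) (r (𝑆 j)) (r j) (u (𝑇 (𝑆 j))) (u (𝑆 j)) (u (𝑇 j)) (u j) (I y (𝑇 j)) (I y j) (I z (𝑆 j)) (I z j)))))) ⟩
        0ℤ ≡⟨ I-const 0ℤ j ⟨
        I (λ _ → 0ℤ) j ∎
        where
        open ≡-Reasoning
        alg′ : ∀ e r′ r uTS uS uT u yT y zS z → yT - y + (zS - z) ≡ 0ℤ
          + (uTS - uS + zS - e * r′) + (e * r - (uT - u + z)) + (e * r′ - e * r) + (uS - (u + y)) + (uT + yT - uTS)
        alg′ = solve-∀

      h₁ : y (t x_c) - y x_c + (z (t x_c) - z x_c) ≡ y (t xₐ) - y xₐ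
      h₁ = combine₁ (I-equal sit f₁ (λ _ → 0ℤ) I-f₁ x_c xₐ) (combine₁ (cong z (sym st-x_c)) (combine₁ (cong z s-xₐ)
        (alg′ (y (t x_c) - y x_c) (z (t x_c)) (z x_c) (z (s x_c)) (y (t xₐ) - y xₐ) (z (s xₐ)) (z xₐ))))
        where
        alg′ : ∀ p Z Zc Zs q Za′ Za → p + (Z - Zc) ≡ q + (p + (Zs - Zc) - 0ℤ - (q + (Za′ - Za) - 0ℤ)) + (Z - Zs) + (Za′ - Za)
        alg′ = solve-∀

      ysum : ∀ x x′ → y x + y (s x) - 0ℤ ≡ y x′ + y (s x′) - 0ℤ
      ysum = I-equal sit (λ x → y x + y (s x)) (λ _ → 0ℤ) (λ j → trans (I-+ y (y ∘ s) j)
        (trans (cong (_+_ (I y j)) (I-S y j)) (trans (combine₁ (cong u (Sᵖ j)) (combine₁ (sym (uS (𝑆 j))) (combine₁ (sym (uS j))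
          (alg′ (u (𝑆 (𝑆 j))) (u (𝑆 j)) (u j) (I y (𝑆 j)) (I y j))))) (sym (I-const 0ℤ j)))))
        where
        alg′ : ∀ uSS uS u yS y → y + yS ≡ 0ℤ + (uSS - u) + (uS + yS - uSS) + (u + y - uS)
        alg′ = solve-∀

      h₂ : y xₐ + y xₐ ≡ y x_c + y (t x_c)
      h₂ = combine₁ (ysum xₐ x_c) (combine₁ (cong y (sym s-xₐ)) (combine₁ (cong y st-x_c)
        (alg′ (y xₐ) (y (s xₐ)) (y x_c) (y (s x_c)) (y (t x_c)))))
        where
        alg′ : ∀ a a′ c c′ c″ → a + a ≡ c + c″ + (a + a′ - 0ℤ - (c + c′ - 0ℤ)) + (a - a′) + (c′ - c″)
        alg′ = solve-∀

      y-xₐ : y (t xₐ) ≡ y xₐ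
      y-xₐ = ℤP.*-cancelˡ-≡ (+ 2) (y (t xₐ)) (y xₐ) (combine₁ (ysum (t xₐ) xₐ)
        (combine₁ (cong y (trans (cong t (sym s-xₐ)) (sym (st xₐ)))) (combine₁ (cong y s-xₐ)
          (alg′ (y (t xₐ)) (y (s (t xₐ))) (y xₐ) (y (s xₐ))))))
        where
        alg′ : ∀ b b′ a a′ → + 2 * b ≡ + 2 * a + (b + b′ - 0ℤ - (a + a′ - 0ℤ)) + (b - b′) + (a′ - a)
        alg′ = solve-∀

∑-last : ∀ m (f : ℕ → ℤ) → ∑ {suc m} (f ∘ toℕ) ≡ ∑ {m} (f ∘ toℕ) + f m
∑-last zero    f = ℤP.+-comm (f 0) 0ℤ
∑-last (suc m) f = trans (cong (_+_ (f 0)) (∑-last m (f ∘ suc))) (sym (ℤP.+-assoc (f 0) (∑ {m} (f ∘ suc ∘ toℕ)) (f (suc m))))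

∑-shift : ∀ m (f : ℕ → ℤ) → f m ≡ f 0 → ∑ {m} (f ∘ suc ∘ toℕ) ≡ ∑ {m} (f ∘ toℕ)
∑-shift m f e = combine₁ (∑-last m f) (combine₁ e (alg (f 0) (∑ {m} (f ∘ suc ∘ toℕ)) (∑ {m} (f ∘ toℕ)) (f m)))
  where
  alg : ∀ a X Y b → X ≡ Y + (a + X - (Y + b)) + (b - a)
  alg = solve-∀

-- Summation by parts.
∑-weighted-shift : ∀ m (f : ℕ → ℤ) → ∑ {m} (λ k → + toℕ k * f (suc (toℕ k))) ≡
  ∑ {m} (λ k → + toℕ k * f (toℕ k)) + + m * f m - ∑ {m} (f ∘ suc ∘ toℕ)
∑-weighted-shift zero    f = refl
∑-weighted-shift (suc m) f = combine₁ (∑-last m (λ k → + k * f (suc k))) (combine₁ (∑-weighted-shift m f)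
  (combine₁ (sym (∑-last m (λ k → + k * f k))) (combine₁ (∑-last m (f ∘ suc)) (alg (+ m) (f m) (f (suc m))
    (∑ {suc m} (λ k → + toℕ k * f (suc (toℕ k)))) (∑ {m} (λ k → + toℕ k * f (suc (toℕ k))))
    (∑ {suc m} (λ k → + toℕ k * f (toℕ k))) (∑ {m} (λ k → + toℕ k * f (toℕ k)))
    (∑ {suc m} (f ∘ suc ∘ toℕ)) (∑ {m} (f ∘ suc ∘ toℕ))))))
  where
  alg : ∀ m a b X′ X Y′ Y Z′ Z → X′ ≡ Y′ + (1ℤ + m) * b - Z′ + (X′ - (X + m * b)) + (X - (Y + m * a - Z)) + (Y + m * a - Y′) + (Z′ - (Z + b))
  alg = solve-∀

∑-toℕ : ∀ m → + 2 * ∑ {m} (λ k → + toℕ k) ≡ + m * (+ m - 1ℤ)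
∑-toℕ zero    = refl
∑-toℕ (suc m) = trans (cong (+ 2 *_) (∑-last m (λ k → + k))) (combine₁ (∑-toℕ m) (alg (∑ {m} (λ k → + toℕ k)) (+ m)))
  where
  alg : ∀ X m → + 2 * (X + m) ≡ (1ℤ + m) * (1ℤ + m - 1ℤ) + (+ 2 * X - m * (m - 1ℤ))
  alg = solve-∀

N-pull : ∀ {B} p (T : Fin B → Fin B) → (∀ j → iter T p j ≡ j) → ∀ (u : Fin B → ℤ) j → N p T (u ∘ T) j ≡ N p T u j
N-pull p T Tᵖ u j = ∑-shift p (λ k → u (iter T k j)) (cong u (Tᵖ j))

periodic-injective : ∀ {A : Set} (G : A → A) p .{{_ : ℕ.NonZero p}} → (∀ j → iter G p j ≡ j) → ∀ {i j} → G i ≡ G j → i ≡ j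
periodic-injective G (suc p) Gᵖ {i} {j} e = trans (sym (Gᵖ i)) (trans (iter-suc G p i) (trans (cong (iter G p) e) (trans (sym (iter-suc G p j)) (Gᵖ j))))

-- p odd: w counts the steps along s from a letter x to the support of d.
module OddPrime {n p : ℕ} {s t : Fin n → Fin n} (sit : Situation n p s t) (pr : Prime p) (h : ℕ) (p-odd : p ≡ suc (2 ℕ.* h))
  (st : ∀ x → s (t x) ≡ t (s x)) (sᵖ : ∀ x → iter s p x ≡ x)
  (d τ : Fin n → ℤ) (d-t : ∀ x → d (t x) ≡ d x)
  (χ-τ : ∀ x → ∑ {p} (λ k → d (iter s (toℕ k) x)) + N p t τ x ≡ 1ℤ)
  (x₀ : Fin n) (t-x₀ : t x₀ ≡ x₀) (χ-x₀ : ∑ {p} (λ k → d (iter s (toℕ k) x₀)) ≡ 1ℤ)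
  (x₁ : Fin n) (s-x₁ : s x₁ ≡ x₁) where

  open Situation sit
  open Transfer sit

  private
    instance
      p≢0 : ℕ.NonZero p
      p≢0 = prime⇒nonZero pr

    χ w : Fin n → ℤ
    χ x = ∑ {p} (λ k → d (iter s (toℕ k) x))
    w x = ∑ {p} (λ k → + toℕ k * d (iter s (toℕ k) x))

    -- A discrete derivative. If `d` marks one letter of an s-orbit of length p, `w` falls by one at
    -- each step along it and jumps up by `p` when leaving that letter.
    w-s : ∀ x → w (s x) ≡ w x + + p * d x - χ x
    w-s x = trans (∑-cong {p} (λ k → cong (λ z → + toℕ k * d z) (sym (iter-suc s (toℕ k) x))))
      (trans (∑-weighted-shift p (λ k → d (iter s k x)))
        (cong₂ (λ a b → w x + + p * a - b) (cong d (sᵖ x)) (∑-shift p (λ k → d (iter s k x)) (cong d (sᵖ x)))))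

    w-t : ∀ x → w (t x) ≡ w x
    w-t x = ∑-cong {p} (λ k → cong (+ toℕ k *_) (trans (cong d (sym (iter-map t {s} {s} (λ y → sym (st y)) (toℕ k) x))) (d-t (iter s (toℕ k) x))))

    I-pulls : ∀ (g : Fin n → Fin n) (G : Fin B → Fin B) → (∀ f j → I (f ∘ g) j ≡ I f (G j)) → ∀ k f j → I (f ∘ iter g k) j ≡ I f (iter G k j)
    I-pulls g G h zero    f j = refl
    I-pulls g G h (suc k) f j = trans (I-pulls g G h k (f ∘ g) j) (h f (iter G k j))

    I-N : ∀ (g : Fin n → Fin n) (G : Fin B → Fin B) → (∀ f j → I (f ∘ g) j ≡ I f (G j)) → ∀ f j → I (N p g f) j ≡ N p G (I f) j
    I-N g G h f j = trans (I-∑ {p} (λ k → f ∘ iter g (toℕ k)) j) (∑-cong {p} (λ k → I-pulls g G h (toℕ k) f j))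

    N-fixed : ∀ {B} (G : Fin B → Fin B) (f : Fin B → ℤ) {j} → G j ≡ j → N p G f j ≡ + p * f j
    N-fixed G f {j} e = trans (∑-cong {p} (λ k → cong f (iter-fix G (toℕ k) e))) (∑-const p (f j))

    -- `χ` is 1 minus a norm of t, and at a fixed point of `𝑇` a norm is a multiple of `p`; so there
    -- `I w` is constant modulo `p` along `𝑆`.
    I-w-S : ∀ j → 𝑇 j ≡ j → I w (𝑆 j) ≡ I w j + + p * (I d j + I τ j)
    I-w-S j fix = begin
      I w (𝑆 j)                                   ≡⟨ I-S w j ⟨
      I (w ∘ s) j                                 ≡⟨ I-cong (λ x → trans (w-s x) (regroup (w x) (d x) (χ x) (N p t τ x) (χ-τ x))) j ⟩
      I (λ x → w x + + p * d x + (N p t τ x - 1ℤ)) j ≡⟨ I-+ (λ x → w x + + p * d x) (λ x → N p t τ x - 1ℤ) j ⟩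
      I (λ x → w x + + p * d x) j + I (λ x → N p t τ x - 1ℤ) j
        ≡⟨ cong₂ _+_ (trans (I-+ w (λ x → + p * d x) j) (cong (_+_ (I w j)) (I-* (+ p) d j)))
             (trans (I-− (N p t τ) (λ _ → 1ℤ) j) (cong₂ _-_ (trans (I-N t 𝑇 I-T τ j) (N-fixed 𝑇 (I τ) fix)) (I-const 1ℤ j))) ⟩
      I w j + + p * I d j + (+ p * I τ j - 0ℤ)    ≡⟨ alg (I w j) (+ p) (I d j) (I τ j) ⟩
      I w j + + p * (I d j + I τ j) ∎
      where
      open ≡-Reasoning
      regroup : ∀ a b c e → c + e ≡ 1ℤ → a + + p * b - c ≡ a + + p * b + (e - 1ℤ)
      regroup a b c e q = combine₁ (sym q) (alg′ (a + + p * b) c e)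
        where
        alg′ : ∀ x c e → x - c ≡ x + (e - 1ℤ) + (1ℤ - (c + e))
        alg′ = solve-∀
      alg : ∀ a p b c → a + p * b + (p * c - 0ℤ) ≡ a + p * (b + c)
      alg = solve-∀

    open CommutingMaps p pr 𝑆 𝑇 ST Sᵖ Tᵖ using (_∼_; _∼?_; ∼-refl; ∼-sym; ∼-trans; residue; iter-residue)
    open Representative _∼?_ (λ j → ∼-refl {j}) renaming (rep to ρ; rep-R to ρ-∼; rep-cong to ρ-cong)

    ρ-S : ∀ j → ρ (𝑆 j) ≡ ρ j
    ρ-S j = ρ-cong (𝑆 j) j (λ _ → ∼-trans (1 , refl)) (λ _ → ∼-trans (∼-sym (1 , refl)))

    I-w-∼ : ∀ k j → 𝑇 j ≡ j → ∃ λ Z → I w (iter 𝑆 k j) ≡ I w j + + p * Z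
    I-w-∼ zero    j fix = 0ℤ , sym (trans (cong (_+_ (I w j)) (ℤP.*-zeroʳ (+ p))) (ℤP.+-identityʳ (I w j)))
    I-w-∼ (suc k) j fix = let (Z , e) = I-w-∼ k j fix
                              i = iter 𝑆 k j
                              fix′ = trans (iter-map 𝑇 {𝑆} {𝑆} (λ y → sym (ST y)) k j) (cong (iter 𝑆 k) fix) in
      Z + (I d i + I τ i) , trans (I-w-S i fix′) (trans (cong (λ q → q + + p * (I d i + I τ i)) e) (alg (I w j) (+ p) Z (I d i + I τ i)))
      where
      alg : ∀ a p b c → a + p * b + p * c ≡ a + p * (b + c)
      alg = solve-∀

    -- The weights add up to p (p - 1) / 2, a multiple of `p` because `p` is odd.
    I-w-fixed : ∀ j → 𝑆 j ≡ j → ∃ λ Z → I w j ≡ + p * Z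
    I-w-fixed j fix = + h * I d j , (begin
      I w j ≡⟨ I-∑ {p} (λ k x → + toℕ k * d (iter s (toℕ k) x)) j ⟩
      ∑ {p} (λ k → I (λ x → + toℕ k * d (iter s (toℕ k) x)) j)
        ≡⟨ ∑-cong {p} (λ k → trans (I-* (+ toℕ k) (d ∘ iter s (toℕ k)) j) (cong (+ toℕ k *_) (trans (I-pulls s 𝑆 I-S (toℕ k) d j) (cong (I d) (iter-fix 𝑆 (toℕ k) fix))))) ⟩
      ∑ {p} (λ k → + toℕ k * I d j) ≡⟨ ∑-*ʳ {p} (λ k → + toℕ k) (I d j) ⟩
      ∑ {p} (λ k → + toℕ k) * I d j ≡⟨ cong (_* I d j) sum-toℕ ⟩
      + p * + h * I d j ≡⟨ ℤP.*-assoc (+ p) (+ h) (I d j) ⟩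
      + p * (+ h * I d j) ∎)
      where
      open ≡-Reasoning
      alg : ∀ p h → p * (+ 2 * h) ≡ + 2 * (p * h)
      alg = solve-∀
      alg′ : ∀ q → 1ℤ + q - 1ℤ ≡ q
      alg′ = solve-∀
      p-1 : + p - 1ℤ ≡ + 2 * + h
      p-1 = trans (cong (λ q → + q - 1ℤ) p-odd) (trans (alg′ (+ (2 ℕ.* h))) (ℤP.pos-* 2 h))
      sum-toℕ : ∑ {p} (λ k → + toℕ k) ≡ + p * + h
      sum-toℕ = ℤP.*-cancelˡ-≡ (+ 2) _ _ (trans (∑-toℕ p) (trans (cong (+ p *_) p-1) (alg (+ p) (+ h))))

    C : Fin B → Set
    C j = 𝑇 j ≡ j × ¬ 𝑆 j ≡ j

    C? : ∀ j → Dec (C j)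
    C? j with 𝑇 j ≟ j | 𝑆 j ≟ j
    ... | no ¬t  | _      = no (λ c → ¬t (proj₁ c))
    ... | yes _  | yes s= = no (λ c → proj₂ c s=)
    ... | yes t= | no ¬s  = yes (t= , ¬s)

    v′ : ∀ j → Dec (C j) → ℤ
    v′ j (yes _) = - I w (ρ j)
    v′ j (no _)  = 0ℤ

    -- An invariant vector with `v + I w` divisible by `p` at every fixed point of `𝑇`. There `I w`
    -- is constant modulo `p` on an `𝑆`-orbit, and its value at the representative is subtracted; at
    -- common fixed points it is already a multiple of `p`, and `v` is zero.
    v : Fin B → ℤ
    v j = v′ j (C? j)

    v-yes : ∀ j → C j → v j ≡ - I w (ρ j)
    v-yes j c = go (C? j)
      where
      go : (q : Dec (C j)) → v′ j q ≡ - I w (ρ j)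
      go (yes _) = refl
      go (no ¬c) = ⊥-elim (¬c c)

    v-no : ∀ j → ¬ C j → v j ≡ 0ℤ
    v-no j ¬c = go (C? j)
      where
      go : (q : Dec (C j)) → v′ j q ≡ 0ℤ
      go (yes c) = ⊥-elim (¬c c)
      go (no _)  = refl

    v-S : ∀ j → v (𝑆 j) ≡ v j
    v-S j = go (C? j)
      where
      up : C j → C (𝑆 j)
      up (t= , ¬s) = trans (sym (ST j)) (cong 𝑆 t=) , ¬s ∘ periodic-injective 𝑆 p Sᵖ
      down : C (𝑆 j) → C j
      down (t= , ¬s) = periodic-injective 𝑆 p Sᵖ (trans (ST j) t=) , ¬s ∘ cong 𝑆
      go : Dec (C j) → v (𝑆 j) ≡ v j
      go (yes c) = trans (v-yes (𝑆 j) (up c)) (trans (cong (λ q → - I w q) (ρ-S j)) (sym (v-yes j c)))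
      go (no ¬c) = trans (v-no (𝑆 j) (¬c ∘ down)) (sym (v-no j ¬c))

    v-T : ∀ j → v (𝑇 j) ≡ v j
    v-T j = go (C? (𝑇 j))
      where
      go : Dec (C (𝑇 j)) → v (𝑇 j) ≡ v j
      go (yes c) = cong v (periodic-injective 𝑇 p Tᵖ (proj₁ c))
      go (no ¬c) = trans (v-no (𝑇 j) ¬c) (sym (v-no j (λ c → ¬c (subst C (sym (proj₁ c)) c))))

    iter-id : ∀ k (j : Fin B) → iter id k j ≡ j
    iter-id k j = iter-fix id k refl

    -- Ĥ⁰ of a cyclic group of order `p`: the case of two commuting maps with the identity as the
    -- first.
    norm-of : (G : Fin B → Fin B) → (∀ j → iter G p j ≡ j) → ∀ f → (∀ j → f (G j) ≡ f j) →
      (∀ j → G j ≡ j → ∃ λ q → f j ≡ + p * q) → ∃ λ (r : Fin B → ℤ) → ∀ j → f j ≡ N p G r j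
    norm-of G Gᵖ f fG div = let (r , _ , e) = CommutingMaps.invariant-norm p pr id G (λ _ → refl) (iter-id p) Gᵖ f (λ _ → refl) fG
                                              (λ { j (c , fix) → div j (trans (sym (iter-id c (G j))) fix) }) in r , e

    v+w-norm : ∃ λ (q : Fin B → ℤ) → ∀ j → v j + I w j ≡ N p 𝑇 q j
    v+w-norm = norm-of 𝑇 Tᵖ (λ j → v j + I w j) (λ j → cong₂ _+_ (v-T j) (trans (sym (I-T w j)) (I-cong w-t j))) div
      where
      alg : ∀ a p Z → - (a + p * Z) + a ≡ p * - Z
      alg = solve-∀
      div : ∀ j → 𝑇 j ≡ j → ∃ λ q → v j + I w j ≡ + p * q
      div j t= = go (𝑆 j ≟ j)
        where
        go : Dec (𝑆 j ≡ j) → ∃ λ q → v j + I w j ≡ + p * q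
        go (yes s=) = let (Z , e) = I-w-fixed j s= in Z , trans (cong₂ _+_ (v-no j (λ c → proj₂ c s=)) e) (ℤP.+-identityˡ (+ p * Z))
        go (no ¬s) = let (k , e) = ρ-∼ j
                         (Z , q) = I-w-∼ k j t= in
          - Z , trans (cong (_+ I w j) (trans (v-yes j (t= , ¬s)) (cong -_ (trans (cong (I w) (sym e)) q)))) (alg (I w j) (+ p) Z)

    q₀ : Fin B → ℤ
    q₀ = proj₁ v+w-norm

    -- Where `v` is nonzero, `𝑇` fixes and `𝑆` moves the point, so s^c t with c prime to p moves it
    -- too, and `v` is a norm already in `P`. If p divides c, `v + I w` is a norm, and it equals `v`
    -- in `F`.
    v-norm : ∀ c → ∃ λ x → ∀ i → Π v i ≡ Π (N p (λ j → iter 𝑆 c (𝑇 j)) x) i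
    v-norm c = go (residue c) refl
      where
      G : Fin B → Fin B
      G j = iter 𝑆 c (𝑇 j)
      T-iterS : ∀ c j → 𝑇 (iter 𝑆 c j) ≡ iter 𝑆 c (𝑇 j)
      T-iterS c j = iter-map 𝑇 {𝑆} {𝑆} (λ y → sym (ST y)) c j
      iterG : ∀ k j → iter G k j ≡ iter 𝑆 (k ℕ.* c) (iter 𝑇 k j)
      iterG zero    j = refl
      iterG (suc k) j = trans (cong G (iterG k j)) (trans (cong (iter 𝑆 c) (T-iterS (k ℕ.* c) (iter 𝑇 k j)))
        (sym (iter-+ 𝑆 c (k ℕ.* c) (𝑇 (iter 𝑇 k j)))))
      Gᵖ : ∀ j → iter G p j ≡ j
      Gᵖ j = trans (iterG p j) (trans (cong (iter 𝑆 (p ℕ.* c)) (Tᵖ j)) (trans (cong (λ k → iter 𝑆 k j) (ℕP.*-comm p c)) (iter-* 𝑆 c p (Sᵖ j))))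
      v-iterS : ∀ c j → v (iter 𝑆 c j) ≡ v j
      v-iterS zero    j = refl
      v-iterS (suc c) j = trans (v-S _) (v-iterS c j)
      iter-≗ : ∀ (F G : Fin B → Fin B) → (∀ j → F j ≡ G j) → ∀ k j → iter F k j ≡ iter G k j
      iter-≗ F G e zero    j = refl
      iter-≗ F G e (suc k) j = trans (e _) (cong G (iter-≗ F G e k j))
      go : (k : Fin p) → residue c ≡ k → ∃ λ x → ∀ i → Π v i ≡ Π (N p G x) i
      go k eq = go′ (toℕ k) refl
        where
        S^c : ∀ j → iter 𝑆 c j ≡ iter 𝑆 (toℕ k) j
        S^c j = trans (sym (iter-residue 𝑆 Sᵖ c j)) (cong (λ k → iter 𝑆 (toℕ k) j) eq)
        go′ : ∀ m → toℕ k ≡ m → ∃ λ x → ∀ i → Π v i ≡ Π (N p G x) i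
        go′ zero k0 = q₀ , λ i → sym (Π-mod {N p G q₀} {v} w (λ j → trans
            (∑-cong {p} (λ l → cong q₀ (iter-≗ G 𝑇 (λ j → trans (S^c (𝑇 j)) (cong (λ m → iter 𝑆 m (𝑇 j)) k0)) (toℕ l) j)))
            (sym (proj₂ v+w-norm j))) i)
        go′ (suc m) km = let (r , e) = norm-of G Gᵖ v (λ j → trans (v-iterS c (𝑇 j)) (v-T j)) div in
            r , λ i → Linear.lin-cong Π-lin e i
          where
          div : ∀ j → G j ≡ j → ∃ λ q → v j ≡ + p * q
          div j fix = 0ℤ , trans (v-no j (λ { (t= , ¬s) → ¬s (S-fix t=) })) (sym (ℤP.*-zeroʳ (+ p)))
            where
            S-fix : 𝑇 j ≡ j → 𝑆 j ≡ j
            S-fix t= = coprime-one (λ i → iter 𝑆 i j ≡ j) refl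
              (λ i i′ a b → trans (iter-+ 𝑆 i i′ j) (trans (cong (iter 𝑆 i) b) a))
              (λ i i′ a b → trans (cong (iter 𝑆 i) (sym b)) (trans (sym (iter-+ 𝑆 i i′ j)) a))
              (prime⇒coprime pr (suc m) (ℕ.s≤s ℕ.z≤n) (subst (ℕ._< p) km (FinP.toℕ<n k)))
              (trans (cong (λ m → iter 𝑆 m j) (sym km)) (trans (sym (S^c j)) (trans (cong (iter 𝑆 c) (sym t=)) fix))) (Sᵖ j)

    Result : Set
    Result = ∃ λ (u : Vect B) → ∃ λ (y : Vect n) → ∃ λ (z : Vect n) →
        (∀ j → + e * v j ≡ N p 𝑇 u j + I z j) × (∀ j → u (𝑆 j) ≡ u j + I y j)

    transferred : Result
    transferred = transfer-norm pr v (Linear.lin-cong Π-lin v-S) (Linear.lin-cong Π-lin v-T) v-norm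

  -- Let e v = N_T u + I z with (S - 1) u = I y. Then e q₀ - u has norm I (z + e w), zero in `F`, so
  -- a second transfer writes e times it as (T - 1) u′ + I z′; hence the square of e. Now e (z + e
  -- w) - N_t z′ is compared at `s x₀` and `x₀`, and N_t y + (s - 1) z at `x₀` and `x₁`; as `w`
  -- drops by 1 modulo p from `x₀` to `s x₀`, p divides e².
  impossible : ⊥
  impossible = final transferred
    where
    final : Result → ⊥
    final (u , y , z , ev , uS) = final′ (transfer-cyclic pr q′ (λ i → trans (Linear.lin-cong Π-lin N-q′ i) (Π-I z+ew i)))
      where
      E : ℤ
      E = + e
      z+ew : Fin n → ℤ
      z+ew x = z x + E * w x
      q′ : Fin B → ℤ
      q′ j = E * q₀ j - u j

      N-q′ : ∀ j → N p 𝑇 q′ j ≡ I z+ew j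
      N-q′ j = begin
        N p 𝑇 q′ j ≡⟨ ∑-− {p} (λ k → E * q₀ (iter 𝑇 (toℕ k) j)) (λ k → u (iter 𝑇 (toℕ k) j)) ⟩
        ∑ {p} (λ k → E * q₀ (iter 𝑇 (toℕ k) j)) - N p 𝑇 u j
          ≡⟨ cong (_- N p 𝑇 u j) (trans (∑-*ˡ {p} E (λ k → q₀ (iter 𝑇 (toℕ k) j))) (cong (E *_) (sym (proj₂ v+w-norm j)))) ⟩
        E * (v j + I w j) - N p 𝑇 u j ≡⟨ combine₁ (ev j) (alg E (v j) (I w j) (N p 𝑇 u j) (I z j)) ⟩
        I z j + E * I w j ≡⟨ trans (I-+ z (λ x → E * w x) j) (cong (_+_ (I z j)) (I-* E w j)) ⟨
        I z+ew j ∎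
        where
        open ≡-Reasoning
        alg : ∀ e v w N z → e * (v + w) - N ≡ z + e * w + (e * v - (N + z))
        alg = solve-∀

      N-S : ∀ j → N p 𝑇 u (𝑆 j) ≡ N p 𝑇 u j + N p 𝑇 (I y) j
      N-S j = trans (∑-cong {p} (λ k → trans (cong u (sym (iter-map 𝑆 {𝑇} {𝑇} ST (toℕ k) j))) (uS (iter 𝑇 (toℕ k) j))))
        (∑-+ {p} (λ k → u (iter 𝑇 (toℕ k) j)) (λ k → I y (iter 𝑇 (toℕ k) j)))

      zy : ∀ x x′ → N p t y x + (z (s x) - z x) - 0ℤ ≡ N p t y x′ + (z (s x′) - z x′) - 0ℤ
      zy = I-equal sit (λ x → N p t y x + (z (s x) - z x)) (λ _ → 0ℤ) (λ j → begin
        I (λ x → N p t y x + (z (s x) - z x)) j ≡⟨ I-+ (N p t y) (λ x → z (s x) - z x) j ⟩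
        I (N p t y) j + I (λ x → z (s x) - z x) j
          ≡⟨ cong₂ _+_ (I-N t 𝑇 I-T y j) (trans (I-− (z ∘ s) z j) (cong (_- I z j) (I-S z j))) ⟩
        N p 𝑇 (I y) j + (I z (𝑆 j) - I z j)
          ≡⟨ combine₁ (sym (ev (𝑆 j))) (combine₁ (ev j) (combine₁ (cong (E *_) (v-S j)) (combine₁ (sym (N-S j))
               (alg E (v (𝑆 j)) (v j) (N p 𝑇 u (𝑆 j)) (N p 𝑇 u j) (N p 𝑇 (I y) j) (I z (𝑆 j)) (I z j))))) ⟩
        0ℤ ≡⟨ I-const 0ℤ j ⟨
        I (λ _ → 0ℤ) j ∎)
        where
        open ≡-Reasoning
        alg : ∀ e vS v NS N M zS z → M + (zS - z) ≡ 0ℤ + (NS + zS - e * vS) + (e * v - (N + z)) + (e * vS - e * v) + (N + M - NS)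
        alg = solve-∀

      Nsy : ∀ x x′ → N p s y x - 0ℤ ≡ N p s y x′ - 0ℤ
      Nsy = I-equal sit (N p s y) (λ _ → 0ℤ) (λ j → trans (I-N s 𝑆 I-S y j) (trans
        (combine₁ (trans (sym (∑-+ {p} (λ k → u (iter 𝑆 (toℕ k) j)) (λ k → I y (iter 𝑆 (toℕ k) j))))
            (trans (∑-cong {p} (λ k → sym (uS (iter 𝑆 (toℕ k) j)))) (N-pull p 𝑆 Sᵖ u j)))
          (alg (N p 𝑆 u j) (N p 𝑆 (I y) j))) (sym (I-const 0ℤ j))))
        where
        alg : ∀ a b → b ≡ 0ℤ + (a + b - a)
        alg = solve-∀

      -- `N p s y` is constant, and at a letter fixed by s it is `p` times `y`. All translates of
      -- `x₁` under t are fixed by s.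
      y-t : ∀ k → y (iter t k x₁) ≡ y x₁
      y-t k = ℤP.*-cancelˡ-≡ (+ p) _ _ (combine₁ (Nsy (iter t k x₁) x₁) (combine₁ (sym (N-fixed s y fix)) (combine₁ (N-fixed s y s-x₁)
        (alg (+ p * y (iter t k x₁)) (+ p * y x₁) (N p s y (iter t k x₁)) (N p s y x₁)))))
        where
        fix : s (iter t k x₁) ≡ iter t k x₁
        fix = trans (iter-map s {t} {t} st k x₁) (cong (iter t k) s-x₁)
        alg : ∀ a b a′ b′ → a ≡ b + (a′ - 0ℤ - (b′ - 0ℤ)) + (a - a′) + (b′ - b)
        alg = solve-∀

      N-y-x₁ : N p t y x₁ ≡ + p * y x₁
      N-y-x₁ = trans (∑-cong {p} (λ k → y-t (toℕ k))) (∑-const p (y x₁))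

      h₂ : + p * y x₀ + (z (s x₀) - z x₀) ≡ + p * y x₁
      h₂ = combine₁ (zy x₀ x₁) (combine₁ (sym (N-fixed t y t-x₀)) (combine₁ N-y-x₁ (combine₁ (cong z s-x₁)
        (alg (+ p * y x₀) (z (s x₀) - z x₀) (+ p * y x₁) (N p t y x₀) (N p t y x₁) (z (s x₁)) (z x₁)))))
        where
        alg : ∀ a d b a′ b′ zs z → a + d ≡ b + (a′ + d - 0ℤ - (b′ + (zs - z) - 0ℤ)) + (a - a′) + (b′ - b) + (zs - z)
        alg = solve-∀

      h₃ : w (s x₀) ≡ w x₀ + + p * d x₀ - 1ℤ
      h₃ = trans (w-s x₀) (cong (λ q → w x₀ + + p * d x₀ - q) χ-x₀)

      final′ : (∃ λ (u′ : Vect B) → ∃ λ (z′ : Vect n) → ∀ j → E * q′ j ≡ u′ (𝑇 j) - u′ j + I z′ j) → ⊥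
      final′ (u′ , z′ , eq′) = ∤-* pr p∤e p∤e (+-∣ Z (trans (ℤP.pos-* e e)
          (combine₁ (sym h₁) (combine₁ (cong (E *_) h₂) (combine₁ (cong (E * E *_) h₃)
            (alg E (+ p) (z x₀) (z (s x₀)) (w x₀) (w (s x₀)) (d x₀) (y x₀) (y x₁) (z′ x₀) (z′ (s x₀))))))))
        where
        Z : ℤ
        Z = E * (y x₁ - y x₀) + E * E * d x₀ - z′ (s x₀) + z′ x₀
        alg : ∀ E p z0 z1 w0 w1 d y0 y1 Z0 Z1 → E * E ≡ p * (E * (y1 - y0) + E * E * d - Z1 + Z0)
          + (E * (z0 + E * w0) - p * Z0 - (E * (z1 + E * w1) - p * Z1))
          + (E * (p * y0 + (z1 - z0)) - E * (p * y1)) + (E * E * w1 - E * E * (w0 + p * d - 1ℤ))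
        alg = solve-∀
        I-eq : ∀ j → I (λ x → E * z+ew x) j ≡ I (N p t z′) j
        I-eq j = begin
          I (λ x → E * z+ew x) j ≡⟨ I-* E z+ew j ⟩
          E * I z+ew j ≡⟨ cong (E *_) (N-q′ j) ⟨
          E * N p 𝑇 q′ j ≡⟨ ∑-*ˡ {p} E (λ k → q′ (iter 𝑇 (toℕ k) j)) ⟨
          ∑ {p} (λ k → E * q′ (iter 𝑇 (toℕ k) j)) ≡⟨ ∑-cong {p} (λ k → eq′ (iter 𝑇 (toℕ k) j)) ⟩
          ∑ {p} (λ k → u′ (𝑇 (iter 𝑇 (toℕ k) j)) - u′ (iter 𝑇 (toℕ k) j) + I z′ (iter 𝑇 (toℕ k) j))
            ≡⟨ trans (∑-+ {p} (λ k → u′ (𝑇 (iter 𝑇 (toℕ k) j)) - u′ (iter 𝑇 (toℕ k) j)) (λ k → I z′ (iter 𝑇 (toℕ k) j)))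
                 (cong (_+ N p 𝑇 (I z′) j) (∑-− {p} (λ k → u′ (𝑇 (iter 𝑇 (toℕ k) j))) (λ k → u′ (iter 𝑇 (toℕ k) j)))) ⟩
          N p 𝑇 (u′ ∘ 𝑇) j - N p 𝑇 u′ j + N p 𝑇 (I z′) j
            ≡⟨ combine₁ (N-pull p 𝑇 Tᵖ u′ j) (alg′ (N p 𝑇 (u′ ∘ 𝑇) j) (N p 𝑇 u′ j) (N p 𝑇 (I z′) j)) ⟩
          N p 𝑇 (I z′) j ≡⟨ I-N t 𝑇 I-T z′ j ⟨
          I (N p t z′) j ∎
          where
          open ≡-Reasoning
          alg′ : ∀ a b c → a - b + c ≡ c + (a - b)
          alg′ = solve-∀
        h₁ : E * (z (s x₀) + E * w (s x₀)) - + p * z′ (s x₀) ≡ E * (z x₀ + E * w x₀) - + p * z′ x₀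
        h₁ = trans (cong (λ q → E * z+ew (s x₀) - q) (sym (N-fixed t z′ (trans (sym (st x₀)) (cong s t-x₀)))))
          (trans (I-equal sit (λ x → E * z+ew x) (N p t z′) I-eq (s x₀) x₀)
            (cong (λ q → E * z+ew x₀ - q) (N-fixed t z′ t-x₀)))

-- Explicit commuting even permutations of the letters

module Letters {A : Set} {n : ℕ} (to : Fin n → A) (from : A → Fin n)
  (from-to : ∀ x → from (to x) ≡ x) (to-from : ∀ a → to (from a) ≡ a) where

  lift : (A → A) → Fin n → Fin n
  lift σ x = from (σ (to x))

  lift-∘ : ∀ σ τ x → lift σ (lift τ x) ≡ from (σ (τ (to x)))
  lift-∘ σ τ x = cong (from ∘ σ) (to-from (τ (to x)))

  to-iter : ∀ σ k x → to (iter (lift σ) k x) ≡ iter σ k (to x)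
  to-iter σ k x = iter-map to {lift σ} {σ} (λ x → to-from (σ (to x))) k x

  lift-commute : ∀ {σ τ} → (∀ a → σ (τ a) ≡ τ (σ a)) → ∀ x → lift σ (lift τ x) ≡ lift τ (lift σ x)
  lift-commute {σ} {τ} e x = trans (lift-∘ σ τ x) (trans (cong from (e (to x))) (sym (lift-∘ τ σ x)))

  lift-periodic : ∀ {σ} p → (∀ a → iter σ p a ≡ a) → ∀ x → iter (lift σ) p x ≡ x
  lift-periodic {σ} p e x = trans (sym (from-to _)) (trans (cong from (trans (to-iter σ p x) (e (to x)))) (from-to x))

  module _ (fm : FunctionsModConstants n) {p : ℕ} (pr : Prime p) {σ τ : A → A} (√σ √τ : A → A)
    (σ-square : ∀ a → √σ (√σ a) ≡ σ a) (τ-square : ∀ a → √τ (√τ a) ≡ τ a)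
    (στ : ∀ a → σ (τ a) ≡ τ (σ a)) (σᵖ : ∀ a → iter σ p a ≡ a) (τᵖ : ∀ a → iter τ p a ≡ a) where

    private
      instance
        p≢0 : ℕ.NonZero p
        p≢0 = prime⇒nonZero pr

      even : ∀ {σ : A → A} (√σ : A → A) → (∀ a → √σ (√σ a) ≡ σ a) → (∀ a → iter σ p a ≡ a) → InA (tabulate (lift σ))
      even {σ} √σ sq per = InA-of-square (lift √σ) (lift σ)
        (λ x y e → periodic-injective (lift σ) p (lift-periodic {σ} p per)
          (trans (sym (root x)) (trans (cong (lift √σ) e) (root y)))) root
        where
        root : ∀ x → lift √σ (lift √σ x) ≡ lift σ x
        root x = trans (lift-∘ √σ √σ x) (cong from (sq (to x)))

    situation-of : FlasqueClassPInvertible p (FunctionsModConstants.lattice fm) → Situation n p (lift σ) (lift τ)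
    situation-of (P , F , glP , _ , exact , permP , _ , inv) =
      situation fm p (lift σ) (lift τ) (even √σ σ-square σᵖ) (even √τ τ-square τᵖ) (lift-commute {σ} {τ} στ)
        (lift-periodic {σ} p σᵖ) (lift-periodic {τ} p τᵖ) P F glP exact permP (pInvertible⇒int pr F inv)

-- The Klein four-group acting regularly. A product of two disjoint transpositions is the square of
-- a four-cycle, hence even.
s₄ t₄ √s₄ √t₄ : Fin 4 → Fin 4
s₄ 0F = 1F
s₄ 1F = 0F
s₄ 2F = 3F
s₄ 3F = 2F
t₄ 0F = 2F
t₄ 1F = 3F
t₄ 2F = 0F
t₄ 3F = 1F
√s₄ 0F = 2F
√s₄ 1F = 3F
√s₄ 2F = 1F
√s₄ 3F = 0F
√t₄ 0F = 1F
√t₄ 1F = 2F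
√t₄ 2F = 3F
√t₄ 3F = 0F

by-cases₄ : ∀ {f g : Fin 4 → Fin 4} → f 0F ≡ g 0F → f 1F ≡ g 1F → f 2F ≡ g 2F → f 3F ≡ g 3F → ∀ q → f q ≡ g q
by-cases₄ a b c d 0F = a
by-cases₄ a b c d 1F = b
by-cases₄ a b c d 2F = c
by-cases₄ a b c d 3F = d

s₄²≡id : ∀ q → s₄ (s₄ q) ≡ q
s₄²≡id = by-cases₄ refl refl refl refl
t₄²≡id : ∀ q → t₄ (t₄ q) ≡ q
t₄²≡id = by-cases₄ refl refl refl refl
st₄ : ∀ q → s₄ (t₄ q) ≡ t₄ (s₄ q)
st₄ = by-cases₄ refl refl refl refl
√s₄²≡s₄ : ∀ q → √s₄ (√s₄ q) ≡ s₄ q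
√s₄²≡s₄ = by-cases₄ refl refl refl refl
√t₄²≡t₄ : ∀ q → √t₄ (√t₄ q) ≡ t₄ q
√t₄²≡t₄ = by-cases₄ refl refl refl refl

module Blocks (k m : ℕ) where
  blockOf : Fin (k ℕ.* m) → Fin k × Fin m
  blockOf = Fin.remQuot {k} m

  ofBlock : Fin k × Fin m → Fin (k ℕ.* m)
  ofBlock (i , q) = Fin.combine i q

  ofBlock-blockOf : ∀ x → ofBlock (blockOf x) ≡ x
  ofBlock-blockOf = FinP.combine-remQuot {k} m

  blockOf-ofBlock : ∀ a → blockOf (ofBlock a) ≡ a
  blockOf-ofBlock (i , q) = FinP.remQuot-combine i q

  onBlock : (Fin m → Fin m) → Fin k × Fin m → Fin k × Fin m
  onBlock σ (i , q) = i , σ q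

¬invertible-4∣n : ∀ j (fm : FunctionsModConstants (suc j ℕ.* 4)) → ¬ FlasqueClassPInvertible 2 (FunctionsModConstants.lattice fm)
¬invertible-4∣n j fm inv = FreeKlein.impossible
    (L.situation-of fm prime[2] {σ} {τ} (onBlock √s₄) (onBlock √t₄)
      (λ { (i , q) → cong (i ,_) (√s₄²≡s₄ q) }) (λ { (i , q) → cong (i ,_) (√t₄²≡t₄ q) })
      στ σ² (λ { (i , q) → cong (i ,_) (t₄²≡id q) }) inv)
    (L.lift-commute {σ} {τ} στ) (L.lift-periodic {σ} 2 σ²) (E ∘ blockOf) NE (ofBlock (0F , 0F)) Ex₀ Esx₀
  where
  open Blocks (suc j) 4
  module L = Letters blockOf ofBlock ofBlock-blockOf blockOf-ofBlock
  σ τ : Fin (suc j) × Fin 4 → Fin (suc j) × Fin 4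
  σ = onBlock s₄
  τ = onBlock t₄
  στ : ∀ a → σ (τ a) ≡ τ (σ a)
  στ (i , q) = cong (i ,_) (st₄ q)
  σ² : ∀ a → σ (σ a) ≡ a
  σ² (i , q) = cong (i ,_) (s₄²≡id q)
  -- One letter of every regular orbit, so that the translates under the four group elements add up
  -- to 1.
  E : Fin (suc j) × Fin 4 → ℤ
  E (i , q) = ind ⌊ q ≟ 0F ⌋
  NEA : ∀ a → E a + E (σ a) + E (τ a) + E (σ (τ a)) ≡ 1ℤ
  NEA (i , 0F) = refl
  NEA (i , 1F) = refl
  NEA (i , 2F) = refl
  NEA (i , 3F) = refl
  s t : Fin (suc j ℕ.* 4) → Fin (suc j ℕ.* 4)
  s = L.lift σ
  t = L.lift τ
  E-s : ∀ x → E (blockOf (s x)) ≡ E (σ (blockOf x))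
  E-s x = cong E (blockOf-ofBlock (σ (blockOf x)))
  E-t : ∀ x → E (blockOf (t x)) ≡ E (τ (blockOf x))
  E-t x = cong E (blockOf-ofBlock (τ (blockOf x)))
  E-st : ∀ x → E (blockOf (s (t x))) ≡ E (σ (τ (blockOf x)))
  E-st x = trans (E-s (t x)) (cong (E ∘ σ) (blockOf-ofBlock (τ (blockOf x))))
  NE : ∀ x → E (blockOf x) + E (blockOf (s x)) + E (blockOf (t x)) + E (blockOf (s (t x))) ≡ 1ℤ
  NE x = trans (cong₂ _+_ (cong₂ _+_ (cong (_+_ (E (blockOf x))) (E-s x)) (E-t x)) (E-st x)) (NEA (blockOf x))
  x₀ : Fin (suc j ℕ.* 4)
  x₀ = ofBlock (0F , 0F)
  Ex₀ : E (blockOf x₀) + E (blockOf (t x₀)) ≡ 1ℤ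
  Ex₀ = trans (cong (_+_ (E (blockOf x₀))) (E-t x₀)) (cong (λ a → E a + E (τ a)) (blockOf-ofBlock (0F , 0F)))
  Esx₀ : E (blockOf (s x₀)) + E (blockOf (t (s x₀))) ≡ 0ℤ
  Esx₀ = trans (cong₂ _+_ (E-s x₀) (trans (E-t (s x₀)) (cong (E ∘ τ) (blockOf-ofBlock (σ (blockOf x₀))))))
    (cong (λ a → E (σ a) + E (τ (σ a))) (blockOf-ofBlock (0F , 0F)))

-- The orbits {0,1}, {2,3} and {4,5} have stabilisers generated by s, t and st. Each involution
-- exchanges two pairs and is the square of a four-cycle; exchanging a single pair would be odd.
s₆ t₆ √s₆ √t₆ : Fin 6 → Fin 6
s₆ 0F = 0F
s₆ 1F = 1F
s₆ 2F = 3F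
s₆ 3F = 2F
s₆ 4F = 5F
s₆ 5F = 4F
t₆ 0F = 1F
t₆ 1F = 0F
t₆ 2F = 2F
t₆ 3F = 3F
t₆ 4F = 5F
t₆ 5F = 4F
√s₆ 0F = 0F
√s₆ 1F = 1F
√s₆ 2F = 4F
√s₆ 4F = 3F
√s₆ 3F = 5F
√s₆ 5F = 2F
√t₆ 2F = 2F
√t₆ 3F = 3F
√t₆ 0F = 4F
√t₆ 4F = 1F
√t₆ 1F = 5F
√t₆ 5F = 0F

by-cases₆ : ∀ {f g : Fin 6 → Fin 6} → f 0F ≡ g 0F → f 1F ≡ g 1F → f 2F ≡ g 2F → f 3F ≡ g 3F → f 4F ≡ g 4F → f 5F ≡ g 5F →
  ∀ q → f q ≡ g q
by-cases₆ a b c d e f 0F = a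
by-cases₆ a b c d e f 1F = b
by-cases₆ a b c d e f 2F = c
by-cases₆ a b c d e f 3F = d
by-cases₆ a b c d e f 4F = e
by-cases₆ a b c d e f 5F = f

¬invertible-n≡2mod4 : ∀ j (fm : FunctionsModConstants (6 ℕ.+ j ℕ.* 4)) → ¬ FlasqueClassPInvertible 2 (FunctionsModConstants.lattice fm)
¬invertible-n≡2mod4 j fm inv = BiquadraticOrbits.impossible
    (L.situation-of fm prime[2] {σ} {τ} (onParts √s₆ √s₄) (onParts √t₆ √t₄)
      (parts √s₆ √s₄ √s₆ √s₄ s₆ s₄ (by-cases₆ refl refl refl refl refl refl) √s₄²≡s₄)
      (parts √t₆ √t₄ √t₆ √t₄ t₆ t₄ (by-cases₆ refl refl refl refl refl refl) √t₄²≡t₄)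
      στ (involutive s₆ s₄ (by-cases₆ refl refl refl refl refl refl) s₄²≡id)
      (involutive t₆ t₄ (by-cases₆ refl refl refl refl refl refl) t₄²≡id) inv)
    (L.lift-commute {σ} {τ} στ) (from (inj₁ 0F)) (from (inj₁ 2F)) (from (inj₁ 4F))
    (cong (from ∘ σ) (to-from (inj₁ 0F))) (cong (from ∘ τ) (to-from (inj₁ 2F)))
    (trans (cong (from ∘ σ) (to-from (inj₁ 4F))) (sym (cong (from ∘ τ) (to-from (inj₁ 4F)))))
    (c ∘ to) (D ∘ to)
    (λ x → trans (cong₂ _+_ (at-s c x) (trans (at-t c (s x)) (at-s (c ∘ τ) x))) (trans (c-σ (to x)) (cong (_+_ (c (to x))) (sym (at-t c x)))))
    (λ x → trans (cong₂ _+_ (cong (_+_ (c (to x))) (at-t c x)) (cong (_+_ (D (to x))) (trans (at-s D (t x)) (at-t (D ∘ σ) x)))) (c-D (to x)))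
    (trans (cong (_+_ (c (to (from (inj₁ 2F))))) (at-t c (from (inj₁ 2F)))) (cong (λ a → c a + c (τ a)) (to-from (inj₁ 2F))))
    (trans (cong (_+_ (c (to (from (inj₁ 4F))))) (at-t c (from (inj₁ 4F)))) (cong (λ a → c a + c (τ a)) (to-from (inj₁ 4F))))
  where
  open Blocks j 4
  A : Set
  A = Fin 6 ⊎ (Fin j × Fin 4)
  to : Fin (6 ℕ.+ j ℕ.* 4) → A
  to x = Sum.map₂ blockOf (Fin.splitAt 6 x)
  from : A → Fin (6 ℕ.+ j ℕ.* 4)
  from a = Fin.join 6 (j ℕ.* 4) (Sum.map₂ ofBlock a)
  map₂-inverse : ∀ {P Q R : Set} (f : Q → R) (g : R → Q) → (∀ q → g (f q) ≡ q) → ∀ (a : P ⊎ Q) → Sum.map₂ g (Sum.map₂ f a) ≡ a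
  map₂-inverse f g e (inj₁ _) = refl
  map₂-inverse f g e (inj₂ q) = cong inj₂ (e q)
  from-to : ∀ x → from (to x) ≡ x
  from-to x = trans (cong (Fin.join 6 (j ℕ.* 4)) (map₂-inverse blockOf ofBlock ofBlock-blockOf (Fin.splitAt 6 x))) (FinP.join-splitAt 6 (j ℕ.* 4) x)
  to-from : ∀ a → to (from a) ≡ a
  to-from a = trans (cong (Sum.map₂ blockOf) (FinP.splitAt-join 6 (j ℕ.* 4) (Sum.map₂ ofBlock a))) (map₂-inverse ofBlock blockOf blockOf-ofBlock a)
  module L = Letters to from from-to to-from
  onParts : (Fin 6 → Fin 6) → (Fin 4 → Fin 4) → A → A
  onParts f g = Sum.map f (onBlock g)
  parts : ∀ f g f′ g′ f″ g″ → (∀ q → f (f′ q) ≡ f″ q) → (∀ q → g (g′ q) ≡ g″ q) → ∀ a → onParts f g (onParts f′ g′ a) ≡ onParts f″ g″ a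
  parts f g f′ g′ f″ g″ e e′ (inj₁ q)       = cong inj₁ (e q)
  parts f g f′ g′ f″ g″ e e′ (inj₂ (i , q)) = cong (λ q → inj₂ (i , q)) (e′ q)
  involutive : ∀ f g → (∀ q → f (f q) ≡ q) → (∀ q → g (g q) ≡ q) → ∀ a → onParts f g (onParts f g a) ≡ a
  involutive f g e e′ (inj₁ q)       = cong inj₁ (e q)
  involutive f g e e′ (inj₂ (i , q)) = cong (λ q → inj₂ (i , q)) (e′ q)
  σ τ : A → A
  σ = onParts s₆ s₄
  τ = onParts t₆ t₄
  s t : Fin (6 ℕ.+ j ℕ.* 4) → Fin (6 ℕ.+ j ℕ.* 4)
  s = L.lift σ
  t = L.lift τ
  στ : ∀ a → σ (τ a) ≡ τ (σ a)
  στ a = trans (parts s₆ s₄ t₆ t₄ (s₆ ∘ t₆) (s₄ ∘ t₄) (λ _ → refl) (λ _ → refl) a)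
    (sym (parts t₆ t₄ s₆ s₄ (s₆ ∘ t₆) (s₄ ∘ t₄) (by-cases₆ refl refl refl refl refl refl) (λ q → sym (st₄ q)) a))
  -- (1 + t) c is the indicator of the orbit {4,5}; `D` takes one letter of each pair exchanged by
  -- st outside that orbit.
  c D : A → ℤ
  c (inj₁ q) = ind ⌊ q ≟ 4F ⌋
  c (inj₂ _) = 0ℤ
  D (inj₁ 0F) = 1ℤ
  D (inj₁ 2F) = 1ℤ
  D (inj₁ _)  = 0ℤ
  D (inj₂ (_ , 0F)) = 1ℤ
  D (inj₂ (_ , 1F)) = 1ℤ
  D (inj₂ (_ , _))  = 0ℤ
  at-s : ∀ (f : A → ℤ) x → f (to (s x)) ≡ f (σ (to x))
  at-s f x = cong f (to-from (σ (to x)))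
  at-t : ∀ (f : A → ℤ) x → f (to (t x)) ≡ f (τ (to x))
  at-t f x = cong f (to-from (τ (to x)))
  c-σ : ∀ a → c (σ a) + c (τ (σ a)) ≡ c a + c (τ a)
  c-σ (inj₁ 0F) = refl
  c-σ (inj₁ 1F) = refl
  c-σ (inj₁ 2F) = refl
  c-σ (inj₁ 3F) = refl
  c-σ (inj₁ 4F) = refl
  c-σ (inj₁ 5F) = refl
  c-σ (inj₂ _) = refl
  c-D : ∀ a → c a + c (τ a) + (D a + D (σ (τ a))) ≡ 1ℤ
  c-D (inj₁ 0F) = refl
  c-D (inj₁ 1F) = refl
  c-D (inj₁ 2F) = refl
  c-D (inj₁ 3F) = refl
  c-D (inj₁ 4F) = refl
  c-D (inj₁ 5F) = refl
  c-D (inj₂ (_ , 0F)) = refl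
  c-D (inj₂ (_ , 1F)) = refl
  c-D (inj₂ (_ , 2F)) = refl
  c-D (inj₂ (_ , 3F)) = refl

module Rotation (p : ℕ) .{{_ : ℕ.NonZero p}} where

  rot : ℕ → Fin p → Fin p
  rot c q = Fin.fromℕ< (m%n<n (toℕ q ℕ.+ c) p)

  toℕ-rot : ∀ c q → toℕ (rot c q) ≡ (toℕ q ℕ.+ c) ℕ.% p
  toℕ-rot c q = FinP.toℕ-fromℕ< (m%n<n (toℕ q ℕ.+ c) p)

  private
    mod-+ : ∀ a c → (a ℕ.% p ℕ.+ c) ℕ.% p ≡ (a ℕ.+ c) ℕ.% p
    mod-+ a c = trans (%-distribˡ-+ (a ℕ.% p) c p) (trans (cong (λ b → (b ℕ.+ c ℕ.% p) ℕ.% p) (m%n%n≡m%n a p)) (sym (%-distribˡ-+ a c p)))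

  rot-+ : ∀ c c′ q → rot c (rot c′ q) ≡ rot (c′ ℕ.+ c) q
  rot-+ c c′ q = FinP.toℕ-injective (trans (toℕ-rot c (rot c′ q)) (trans (cong (λ a → (a ℕ.+ c) ℕ.% p) (toℕ-rot c′ q))
    (trans (mod-+ (toℕ q ℕ.+ c′) c) (trans (cong (ℕ._% p) (ℕP.+-assoc (toℕ q) c′ c)) (sym (toℕ-rot (c′ ℕ.+ c) q))))))

  rot-0 : ∀ q → rot 0 q ≡ q
  rot-0 q = FinP.toℕ-injective (trans (toℕ-rot 0 q) (trans (cong (ℕ._% p) (ℕP.+-identityʳ (toℕ q))) (m<n⇒m%n≡m (FinP.toℕ<n q))))

  rot-p+ : ∀ c q → rot (c ℕ.+ p) q ≡ rot c q
  rot-p+ c q = FinP.toℕ-injective (trans (toℕ-rot (c ℕ.+ p) q) (trans (cong (ℕ._% p) (sym (ℕP.+-assoc (toℕ q) c p)))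
    (trans ([m+n]%n≡m%n (toℕ q ℕ.+ c) p) (sym (toℕ-rot c q)))))

  rot-comm : ∀ (k q : Fin p) → rot (toℕ k) q ≡ rot (toℕ q) k
  rot-comm k q = FinP.toℕ-injective (trans (toℕ-rot (toℕ k) q) (trans (cong (ℕ._% p) (ℕP.+-comm (toℕ q) (toℕ k))) (sym (toℕ-rot (toℕ q) k))))

  iter-rot : ∀ c q → iter (rot 1) c q ≡ rot c q
  iter-rot zero    q = sym (rot-0 q)
  iter-rot (suc c) q = trans (cong (rot 1) (iter-rot c q)) (trans (rot-+ 1 c q) (cong (λ d → rot d q) (ℕP.+-comm c 1)))

  rot-period : ∀ q → iter (rot 1) p q ≡ q
  rot-period q = trans (iter-rot p q) (trans (rot-p+ 0 q) (rot-0 q))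

  rot-inverse : ∀ c q → c ℕ.≤ p → rot (p ℕ.∸ c) (rot c q) ≡ q
  rot-inverse c q c≤p = trans (rot-+ (p ℕ.∸ c) c q) (trans (cong (λ d → rot d q) (ℕP.m+[n∸m]≡n c≤p)) (trans (rot-p+ 0 q) (rot-0 q)))

  rot-inverse′ : ∀ c q → c ℕ.≤ p → rot c (rot (p ℕ.∸ c) q) ≡ q
  rot-inverse′ c q c≤p = trans (rot-+ c (p ℕ.∸ c) q) (trans (cong (λ d → rot d q) (ℕP.m∸n+n≡m c≤p)) (trans (rot-p+ 0 q) (rot-0 q)))

  -- Addition modulo `p` is symmetric, so the number of steps and the starting point may be
  -- exchanged, and the sum runs over a rotation of all of `Fin p`.
  ∑-rot : ∀ (q q₀ : Fin p) → ∑ {p} (λ k → ind ⌊ iter (rot 1) (toℕ k) q ≟ q₀ ⌋) ≡ 1ℤ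
  ∑-rot q q₀ = trans (∑-cong {p} (λ k → cong (λ x → ind ⌊ x ≟ q₀ ⌋) (trans (iter-rot (toℕ k) q) (rot-comm k q))))
    (trans (∑-bij (rot (toℕ q)) (rot (p ℕ.∸ toℕ q)) (λ i → rot-inverse (toℕ q) i q≤p) (λ j → rot-inverse′ (toℕ q) j q≤p) (λ x → ind ⌊ x ≟ q₀ ⌋))
      (trans (∑-cong (λ x → sym (ℤP.*-identityˡ (ind ⌊ x ≟ q₀ ⌋)))) (∑-δʳ q₀ (λ _ → 1ℤ))))
    where
    q≤p = ℕP.<⇒≤ (FinP.toℕ<n q)

¬invertible-odd : ∀ k p h → Prime p → p ≡ suc (2 ℕ.* h) → (fm : FunctionsModConstants (suc (suc k) ℕ.* p)) →
  ¬ FlasqueClassPInvertible p (FunctionsModConstants.lattice fm)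
¬invertible-odd k p@(suc p-1) h pr p-odd fm inv = OddPrime.impossible
    (L.situation-of fm pr {σ} {τ} (first-block half) (other-blocks half) √σ² √τ² στ σᵖ τᵖ inv) pr h p-odd
    (L.lift-commute {σ} {τ} στ) (L.lift-periodic {σ} p σᵖ) (d ∘ blockOf) (τ₀ ∘ blockOf)
    (λ x → trans (cong d (blockOf-ofBlock (τ (blockOf x)))) (d-τ (blockOf x)))
    (λ x → trans (cong₂ _+_ (χ-at x) (∑-cong {p} (λ l → cong τ₀ (L.to-iter τ (toℕ l) x)))) (χ-τ₀ (blockOf x)))
    (ofBlock (0F , 0F)) (cong (ofBlock ∘ τ) (blockOf-ofBlock (0F , 0F)))
    (trans (χ-at (ofBlock (0F , 0F))) (trans (cong χ (blockOf-ofBlock (0F , 0F))) (χ-0 0F)))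
    (ofBlock (1F , 0F)) (cong (ofBlock ∘ σ) (blockOf-ofBlock (1F , 0F)))
  where
  open Blocks (suc (suc k)) p
  open Rotation p
  module L = Letters blockOf ofBlock ofBlock-blockOf blockOf-ofBlock
  A : Set
  A = Fin (suc (suc k)) × Fin p
  first-block other-blocks : (Fin p → Fin p) → A → A
  first-block f (0F , q)        = 0F , f q
  first-block f (Fin.suc i , q) = Fin.suc i , q
  other-blocks f (0F , q)        = 0F , q
  other-blocks f (Fin.suc i , q) = Fin.suc i , f q
  -- 2 (h + 1) = p + 1, so this is a square root of the rotation by one; it certifies evenness.
  half : Fin p → Fin p
  half = rot (suc h)
  half² : ∀ q → half (half q) ≡ rot 1 q
  half² q = trans (rot-+ (suc h) (suc h) q) (trans (cong (λ c → rot c q) eq) (rot-p+ 1 q))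
    where
    eq : suc h ℕ.+ suc h ≡ 1 ℕ.+ p
    eq = trans (cong suc (trans (ℕP.+-suc h h) (cong (λ z → suc (h ℕ.+ z)) (sym (ℕP.+-identityʳ h))))) (cong suc (sym p-odd))
  σ τ : A → A
  σ = first-block (rot 1)
  τ = other-blocks (rot 1)
  √σ² : ∀ a → first-block half (first-block half a) ≡ σ a
  √σ² (0F , q)        = cong (0F ,_) (half² q)
  √σ² (Fin.suc i , q) = refl
  √τ² : ∀ a → other-blocks half (other-blocks half a) ≡ τ a
  √τ² (0F , q)        = refl
  √τ² (Fin.suc i , q) = cong (Fin.suc i ,_) (half² q)
  στ : ∀ a → σ (τ a) ≡ τ (σ a)
  στ (0F , q)        = refl
  στ (Fin.suc i , q) = refl
  iter-σ-0 : ∀ c q → iter σ c (0F , q) ≡ (0F , iter (rot 1) c q)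
  iter-σ-0 c q = sym (iter-map {B = A} (0F ,_) {rot 1} {σ} (λ _ → refl) c q)
  iter-τ-suc : ∀ c i q → iter τ c (Fin.suc i , q) ≡ (Fin.suc i , iter (rot 1) c q)
  iter-τ-suc c i q = sym (iter-map {B = A} (Fin.suc i ,_) {rot 1} {τ} (λ _ → refl) c q)
  σᵖ : ∀ a → iter σ p a ≡ a
  σᵖ (0F , q)        = trans (iter-σ-0 p q) (cong (0F ,_) (rot-period q))
  σᵖ (Fin.suc i , q) = iter-fix σ p {Fin.suc i , q} refl
  τᵖ : ∀ a → iter τ p a ≡ a
  τᵖ (0F , q)        = iter-fix τ p {0F , q} refl
  τᵖ (Fin.suc i , q) = trans (iter-τ-suc p i q) (cong (Fin.suc i ,_) (rot-period q))
  -- One letter of the first block for `d` and one letter of each other block for `τ₀`, so that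
  -- their norms under s and t are complementary indicators.
  d τ₀ χ : A → ℤ
  d (0F , q)        = ind ⌊ q ≟ 0F ⌋
  d (Fin.suc i , q) = 0ℤ
  τ₀ (0F , q)        = 0ℤ
  τ₀ (Fin.suc i , q) = ind ⌊ q ≟ 0F ⌋
  χ a = ∑ {p} (λ l → d (iter σ (toℕ l) a))
  χ-at : ∀ x → ∑ {p} (λ l → d (blockOf (iter (L.lift σ) (toℕ l) x))) ≡ χ (blockOf x)
  χ-at x = ∑-cong {p} (λ l → cong d (L.to-iter σ (toℕ l) x))
  d-τ : ∀ a → d (τ a) ≡ d a
  d-τ (0F , q)        = refl
  d-τ (Fin.suc i , q) = refl
  χ-0 : ∀ q → χ (0F , q) ≡ 1ℤ
  χ-0 q = trans (∑-cong {p} (λ l → cong d (iter-σ-0 (toℕ l) q))) (∑-rot q 0F)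
  χ-τ₀ : ∀ a → χ a + ∑ {p} (λ l → τ₀ (iter τ (toℕ l) a)) ≡ 1ℤ
  χ-τ₀ (0F , q) = cong₂ _+_ (χ-0 q) (∑-zero {p} (λ l → cong τ₀ (iter-fix τ (toℕ l) {0F , q} refl)))
  χ-τ₀ (Fin.suc i , q) = cong₂ _+_ (∑-zero {p} (λ l → cong d (iter-fix σ (toℕ l) {Fin.suc i , q} refl)))
    (trans (∑-cong {p} (λ l → cong τ₀ (iter-τ-suc (toℕ l) i q))) (∑-rot q 0F))

-- Prime divisors of composite n

J-functions-≥3 : ∀ n → 3 ℕ.≤ n → Σ (FunctionsModConstants n) λ fm → FunctionsModConstants.lattice fm ≡ J n
J-functions-≥3 (suc (suc (suc k))) _ = J-functions k , refl
J-functions-≥3 (suc (suc zero)) (ℕ.s≤s (ℕ.s≤s ()))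
J-functions-≥3 (suc zero) (ℕ.s≤s ())

even-or-odd : ∀ q → (∃ λ h → q ≡ 2 ℕ.* h) ⊎ (∃ λ h → q ≡ suc (2 ℕ.* h))
even-or-odd zero = inj₁ (0 , refl)
even-or-odd (suc q) with even-or-odd q
... | inj₁ (h , refl) = inj₂ (h , refl)
... | inj₂ (h , refl) = inj₁ (suc h , cong suc (sym (ℕP.+-suc h (h ℕ.+ 0))))

odd-prime : ∀ {p} → Prime p → ¬ p ≡ 2 → ∃ λ h → p ≡ suc (2 ℕ.* h)
odd-prime {p} pr p≢2 with even-or-odd p
... | inj₂ odd = odd
... | inj₁ (h , p≡2h) with prime⇒irreducible pr (divides {2} {p} h (trans p≡2h (ℕP.*-comm 2 h)))
...   | inj₂ 2≡p = ⊥-elim (p≢2 (sym 2≡p))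

private
  twice : ∀ h → 2 ℕ.* h ℕ.* 2 ≡ h ℕ.* 4
  twice h = trans (cong (ℕ._* 2) (ℕP.*-comm 2 h)) (ℕP.*-assoc h 2 2)

¬invertible-J-odd : ∀ n k p → Prime p → ¬ p ≡ 2 → n ≡ suc (suc k) ℕ.* p → 3 ℕ.≤ n → ¬ FlasqueClassPInvertible p (J n)
¬invertible-J-odd n k p pr p≢2 n≡ 3≤n inv =
  let (h , p-odd) = odd-prime pr p≢2
      (fm , eq) = J-functions-≥3 n 3≤n
  in go h p-odd n≡ fm (subst (FlasqueClassPInvertible p) (sym eq) inv)
  where
  go : ∀ h → p ≡ suc (2 ℕ.* h) → n ≡ suc (suc k) ℕ.* p → (fm : FunctionsModConstants n) →
    ¬ FlasqueClassPInvertible p (FunctionsModConstants.lattice fm)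
  go h p-odd refl fm = ¬invertible-odd k p h pr p-odd fm

¬invertible-J-2 : ∀ n q → (∃ λ h → q ≡ 2 ℕ.* h) ⊎ (∃ λ h → q ≡ suc (2 ℕ.* h)) → n ≡ q ℕ.* 2 → 3 ℕ.≤ n →
  ¬ FlasqueClassPInvertible 2 (J n)
¬invertible-J-2 n q parity n≡ 3≤n inv = go parity (subst (FlasqueClassPInvertible 2) (sym (proj₂ fm,eq)) inv)
  where
  fm,eq = J-functions-≥3 n 3≤n
  go₄ : ∀ j → n ≡ suc j ℕ.* 4 → (fm : FunctionsModConstants n) → ¬ FlasqueClassPInvertible 2 (FunctionsModConstants.lattice fm)
  go₄ j refl fm = ¬invertible-4∣n j fm
  go₆ : ∀ j → n ≡ 6 ℕ.+ j ℕ.* 4 → (fm : FunctionsModConstants n) → ¬ FlasqueClassPInvertible 2 (FunctionsModConstants.lattice fm)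
  go₆ j refl fm = ¬invertible-n≡2mod4 j fm
  3≰ : ∀ {m} → m ℕ.≤ 2 → n ≡ m → ⊥
  3≰ m≤2 refl = ℕP.<⇒≱ 3≤n m≤2
  go : (∃ λ h → q ≡ 2 ℕ.* h) ⊎ (∃ λ h → q ≡ suc (2 ℕ.* h)) → ¬ FlasqueClassPInvertible 2 (FunctionsModConstants.lattice (proj₁ fm,eq))
  -- The quotients 0 and 1 contradict n ≥ 3; otherwise 2 (2h + 2) = 4 (h + 1) and 2 (2h + 3) = 6 +
  -- 4h.
  go (inj₁ (zero , eq))  _ = 3≰ {0} ℕ.z≤n (trans n≡ (cong (ℕ._* 2) eq))
  go (inj₂ (zero , eq))  _ = 3≰ {2} ℕP.≤-refl (trans n≡ (cong (ℕ._* 2) eq))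
  go (inj₁ (suc h , eq)) = go₄ h (trans n≡ (trans (cong (ℕ._* 2) eq) (twice (suc h)))) (proj₁ fm,eq)
  go (inj₂ (suc h , eq)) = go₆ h (trans n≡ (trans (cong (ℕ._* 2) eq) (cong (2 ℕ.+_) (twice (suc h))))) (proj₁ fm,eq)

¬invertible : ∀ n p → 2 ℕ.≤ n → Prime p → ¬ Prime n → p ∣ n → ¬ FlasqueClassPInvertible p (J n)
¬invertible n p 2≤n pr ¬pn (divides q n≡) = go (p ℕ.≟ 2)
  where
  3≤n : 3 ℕ.≤ n
  3≤n = ℕP.≤∧≢⇒< 2≤n (λ { refl → ¬pn prime[2] })
  -- A quotient of 1 would make n the prime p. The second block provides the letter fixed by s.
  2≤q : ∀ q → n ≡ q ℕ.* p → ∃ λ k → q ≡ suc (suc k)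
  2≤q zero          n≡ = ⊥-elim (ℕP.<⇒≱ 2≤n (subst (ℕ._≤ 1) (sym n≡) ℕ.z≤n))
  2≤q (suc zero)    n≡ = ⊥-elim (¬pn (subst Prime (sym (trans n≡ (ℕP.+-identityʳ p))) pr))
  2≤q (suc (suc k)) n≡ = k , refl
  go : Dec (p ≡ 2) → ¬ FlasqueClassPInvertible p (J n)
  go (no p≢2)  = let (k , q≡) = 2≤q q n≡ in ¬invertible-J-odd n k p pr p≢2 (trans n≡ (cong (ℕ._* p) q≡)) 3≤n
  go (yes refl) = ¬invertible-J-2 n q (even-or-odd q) n≡ 3≤n

-- Finite sets and permutation lattices

record FinSet : Set₁ where
  field
    Carrier : Set
    size    : ℕ
    to      : Carrier → Fin size
    from    : Fin size → Carrier
    from-to : ∀ x → from (to x) ≡ x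
    to-from : ∀ i → to (from i) ≡ i

  to-injective : ∀ {x y} → to x ≡ to y → x ≡ y
  to-injective e = trans (sym (from-to _)) (trans (cong from e) (from-to _))



finSet : ℕ → FinSet
finSet n = record { Carrier = Fin n ; size = n ; to = id ; from = id ; from-to = λ _ → refl ; to-from = λ _ → refl }

_⊎ᶠ_ : FinSet → FinSet → FinSet
A ⊎ᶠ B = record
  { Carrier = A.Carrier ⊎ B.Carrier
  ; size = A.size ℕ.+ B.size
  ; to = λ x → Fin.join A.size B.size (Sum.map A.to B.to x)
  ; from = λ i → Sum.map A.from B.from (Fin.splitAt A.size i)
  ; from-to = λ x → trans (cong (Sum.map A.from B.from) (FinP.splitAt-join A.size B.size (Sum.map A.to B.to x))) (inv x)
  ; to-from = λ i → trans (cong (Fin.join A.size B.size) (inv′ (Fin.splitAt A.size i))) (FinP.join-splitAt A.size B.size i)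
  }
  where
  module A = FinSet A
  module B = FinSet B
  inv : ∀ x → Sum.map A.from B.from (Sum.map A.to B.to x) ≡ x
  inv (inj₁ x) = cong inj₁ (A.from-to x)
  inv (inj₂ x) = cong inj₂ (B.from-to x)
  inv′ : ∀ x → Sum.map A.to B.to (Sum.map A.from B.from x) ≡ x
  inv′ (inj₁ x) = cong inj₁ (A.to-from x)
  inv′ (inj₂ x) = cong inj₂ (B.to-from x)

_×ᶠ_ : FinSet → FinSet → FinSet
A ×ᶠ B = record
  { Carrier = A.Carrier × B.Carrier
  ; size = A.size ℕ.* B.size
  ; to = λ x → Fin.combine (A.to (proj₁ x)) (B.to (proj₂ x))
  ; from = λ i → A.from (proj₁ (Fin.remQuot {A.size} B.size i)) , B.from (proj₂ (Fin.remQuot {A.size} B.size i))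
  ; from-to = λ x → trans (cong (λ q → A.from (proj₁ q) , B.from (proj₂ q)) (FinP.remQuot-combine (A.to (proj₁ x)) (B.to (proj₂ x))))
      (cong₂ _,_ (A.from-to (proj₁ x)) (B.from-to (proj₂ x)))
  ; to-from = λ i → trans (cong₂ Fin.combine (A.to-from _) (B.to-from _)) (FinP.combine-remQuot {A.size} B.size i)
  }
  where
  module A = FinSet A
  module B = FinSet B

module _ (n : ℕ) where

  private
    #tables : ℕ → ℕ
    #tables zero    = 1
    #tables (suc k) = n ℕ.* #tables k

    toIndex : ∀ {k} → Vec (Fin n) k → Fin (#tables k)
    toIndex Vec.[]      = 0F
    toIndex (x Vec.∷ v) = Fin.combine x (toIndex v)

    fromIndex : ∀ k → Fin (#tables k) → Vec (Fin n) k
    fromIndex zero    _ = Vec.[]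
    fromIndex (suc k) i = proj₁ (Fin.remQuot {n} (#tables k) i) Vec.∷ fromIndex k (proj₂ (Fin.remQuot {n} (#tables k) i))

    fromIndex-toIndex : ∀ {k} (v : Vec (Fin n) k) → fromIndex k (toIndex v) ≡ v
    fromIndex-toIndex Vec.[]      = refl
    fromIndex-toIndex (x Vec.∷ v) = trans (cong (λ q → proj₁ q Vec.∷ fromIndex _ (proj₂ q)) (FinP.remQuot-combine x (toIndex v)))
      (cong (x Vec.∷_) (fromIndex-toIndex v))

    toIndex-fromIndex : ∀ k i → toIndex (fromIndex k i) ≡ i
    toIndex-fromIndex zero    0F = refl
    toIndex-fromIndex (suc k) i  = trans (cong (Fin.combine (proj₁ (Fin.remQuot {n} (#tables k) i))) (toIndex-fromIndex k _))
      (FinP.combine-remQuot {n} (#tables k) i)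

  tables : ℕ → FinSet
  tables k = record { Carrier = Vec (Fin n) k ; size = #tables k ; to = toIndex ; from = fromIndex k
                    ; from-to = fromIndex-toIndex ; to-from = toIndex-fromIndex k }

filterFin : ∀ {m} (P : Fin m → Bool) → ∃ λ k → Σ (Fin k → Σ (Fin m) (T ∘ P)) λ f → Σ (Σ (Fin m) (T ∘ P) → Fin k) λ g →
  (∀ x → f (g x) ≡ x) × (∀ i → g (f i) ≡ i)
filterFin {zero}  P = 0 , (λ ()) , (λ { (() , _) }) , (λ { (() , _) }) , λ ()
filterFin {suc m} P with filterFin (P ∘ Fin.suc) | P 0F in eq
... | k , f , g , fg , gf | true = suc k , f′ , g′ , fg′ , gf′
  where
  f′ : Fin (suc k) → Σ (Fin (suc m)) (T ∘ P)
  f′ 0F          = 0F , subst T (sym eq) tt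
  f′ (Fin.suc i) = Fin.suc (proj₁ (f i)) , proj₂ (f i)
  g′ : Σ (Fin (suc m)) (T ∘ P) → Fin (suc k)
  g′ (0F , _)        = 0F
  g′ (Fin.suc x , t) = Fin.suc (g (x , t))
  fg′ : ∀ x → f′ (g′ x) ≡ x
  fg′ (0F , t)        = cong (0F ,_) (T-irrelevant _ t)
  fg′ (Fin.suc x , t) = cong (λ q → Fin.suc (proj₁ q) , proj₂ q) (fg (x , t))
  gf′ : ∀ i → g′ (f′ i) ≡ i
  gf′ 0F          = refl
  gf′ (Fin.suc i) = cong Fin.suc (gf i)
... | k , f , g , fg , gf | false = k , f′ , g′ , fg′ , gf
  where
  f′ : Fin k → Σ (Fin (suc m)) (T ∘ P)
  f′ i = Fin.suc (proj₁ (f i)) , proj₂ (f i)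
  g′ : Σ (Fin (suc m)) (T ∘ P) → Fin k
  g′ (0F , t)        = ⊥-elim (subst T eq t)
  g′ (Fin.suc x , t) = g (x , t)
  fg′ : ∀ x → f′ (g′ x) ≡ x
  fg′ (0F , t)        = ⊥-elim (subst T eq t)
  fg′ (Fin.suc x , t) = cong (λ q → Fin.suc (proj₁ q) , proj₂ q) (fg (x , t))

subset : (A : FinSet) → (FinSet.Carrier A → Bool) → FinSet
subset A P = record
  { Carrier = Σ A.Carrier (T ∘ P)
  ; size = proj₁ e
  ; to = λ { (x , t) → g (A.to x , subst (T ∘ P) (sym (A.from-to x)) t) }
  ; from = λ i → A.from (proj₁ (f i)) , proj₂ (f i)
  ; from-to = λ { (x , t) → Σ-≡ (trans (cong (A.from ∘ proj₁) (fg _)) (A.from-to x)) }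
  ; to-from = λ i → trans (cong g (Σ-≡′ (A.to-from (proj₁ (f i))))) (gf i)
  }
  where
  module A = FinSet A
  e = filterFin (P ∘ A.from)
  f = proj₁ (proj₂ e)
  g = proj₁ (proj₂ (proj₂ e))
  fg = proj₁ (proj₂ (proj₂ (proj₂ e)))
  gf = proj₂ (proj₂ (proj₂ (proj₂ e)))
  Σ-≡ : ∀ {p q : Σ A.Carrier (T ∘ P)} → proj₁ p ≡ proj₁ q → p ≡ q
  Σ-≡ {x , t} {.x , t′} refl = cong (x ,_) (T-irrelevant t t′)
  Σ-≡′ : ∀ {p q : Σ (Fin A.size) (T ∘ P ∘ A.from)} → proj₁ p ≡ proj₁ q → p ≡ q
  Σ-≡′ {x , t} {.x , t′} refl = cong (x ,_) (T-irrelevant t t′)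

-- `Perm n` contains all tables, so the composition law is restricted to injective ones. It covers
-- odd permutations too: the sets built below carry an action of the whole symmetric group.
record GSet (n : ℕ) : Set₁ where
  infixr 8 _▹_
  field
    set  : FinSet
  open FinSet set public
  field
    _▹_  : Perm n → Carrier → Carrier
    ▹-id : ∀ ω → idP ▹ ω ≡ ω
    ▹-∘  : ∀ g h → Inj g → Inj h → ∀ ω → (g ∘P h) ▹ ω ≡ g ▹ h ▹ ω

  ▹-inverseˡ : ∀ g → Inj g → ∀ ω → g ⁻¹ ▹ g ▹ ω ≡ ω
  ▹-inverseˡ g ig ω = trans (sym (▹-∘ (g ⁻¹) g (⁻¹-Inj g ig) ig ω)) (trans (cong (_▹ ω) (perm-ext ((g ⁻¹) ∘P g) idP
    (λ x → trans (∘P-∙ (g ⁻¹) g x) (trans (inverseˡ g ig x) (sym (idP-∙ x)))))) (▹-id ω))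

  ▹-inverseʳ : ∀ g → Inj g → ∀ ω → g ▹ g ⁻¹ ▹ ω ≡ ω
  ▹-inverseʳ g ig ω = trans (sym (▹-∘ g (g ⁻¹) ig (⁻¹-Inj g ig) ω)) (trans (cong (_▹ ω) (perm-ext (g ∘P (g ⁻¹)) idP
    (λ x → trans (∘P-∙ g (g ⁻¹) x) (trans (inverseʳ g ig x) (sym (idP-∙ x)))))) (▹-id ω))

  σ : Perm n → Fin size → Fin size
  σ g i = to (g ▹ from i)

  σ-∘ : ∀ g h → Inj g → Inj h → ∀ i → σ (g ∘P h) i ≡ σ g (σ h i)
  σ-∘ g h ig ih i = cong to (trans (▹-∘ g h ig ih (from i)) (cong (g ▹_) (sym (from-to _))))

  permLattice : RawLattice n
  permLattice = record { rank = size ; act = λ g i j → ind ⌊ i ≟ σ g j ⌋ }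

  perm-act : ∀ g → Inj g → ∀ v ω → (act permLattice g ⊛ v) (to ω) ≡ v (to (g ⁻¹ ▹ ω))
  perm-act g ig v ω = trans (push-inverse (σ g) (σ (g ⁻¹))
      (λ i → trans (cong (λ z → to (g ▹ z)) (from-to _)) (trans (cong to (▹-inverseʳ g ig (from i))) (to-from i)))
      (λ i → trans (cong (λ z → to (g ⁻¹ ▹ z)) (from-to _)) (trans (cong to (▹-inverseˡ g ig (from i))) (to-from i)))
      v (to ω)) (cong (λ z → v (to (g ⁻¹ ▹ z))) (from-to ω))

  perm-isGLattice : IsGLattice permLattice
  perm-isGLattice = (λ i j → cong (λ z → ind ⌊ i ≟ z ⌋) (trans (cong to (▹-id (from j))) (to-from j)))
    , λ g h ag ah i k → trans (cong (λ z → ind ⌊ i ≟ z ⌋) (σ-∘ g h (InA⇒Inj g ag) (InA⇒Inj h ah) k))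
        (sym (∑-δʳ (σ h k) (λ j → ind ⌊ i ≟ σ g j ⌋)))

  perm-isPermutation : IsPermutation permLattice
  perm-isPermutation = 1M , 1M , (λ i j → 1M-⊛ (λ k → 1M k j) i) , (λ i j → 1M-⊛ (λ k → 1M k j) i)
    , λ g ag → σ g , λ j i → ∑-δʳ j (λ k → ind ⌊ i ≟ σ g k ⌋)

module _ {m k : ℕ} (f : Vect m → Vect k) (lin : Linear f) where

  matrix : Mat k m
  matrix i j = f (λ l → ind ⌊ l ≟ j ⌋) i

  matrix-⊛ : ∀ v i → (matrix ⊛ v) i ≡ f v i
  matrix-⊛ v i = begin
    ∑ (λ j → f (λ l → ind ⌊ l ≟ j ⌋) i * v j) ≡⟨ ∑-cong (λ j → trans (ℤP.*-comm _ (v j)) (sym (lin-* (v j) (λ l → ind ⌊ l ≟ j ⌋) i))) ⟩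
    ∑ (λ j → f (λ l → v j * ind ⌊ l ≟ j ⌋) i) ≡⟨ lin-∑ (λ j l → v j * ind ⌊ l ≟ j ⌋) i ⟨
    f (λ l → ∑ (λ j → v j * ind ⌊ l ≟ j ⌋)) i
      ≡⟨ lin-cong (λ l → trans (∑-cong (λ j → ℤP.*-comm (v j) (ind ⌊ l ≟ j ⌋))) (∑-δ l v)) i ⟩
    f v i ∎
    where
    open Linear lin
    open ≡-Reasoning

-- Bézout relations for integer vectors

record BézoutVector {m : ℕ} (v : Vec ℤ m) : Set where
  field
    d   : ℤ
    u c : Fin m → ℤ
    combination : ∑ (λ l → u l * lookup v l) ≡ d
    multiple    : ∀ l → lookup v l ≡ c l * d

private
  Identity₂ : ℤ → ℤ → Set
  Identity₂ a b = ∃ λ g → ∃ λ x → ∃ λ y → ∃ λ α → ∃ λ β → x * a + y * b ≡ g × a ≡ α * g × b ≡ β * g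

  bézout-ℕ : ∀ a b → Identity₂ (+ a) (+ b)
  bézout-ℕ a b with Bézout.lemma a b
  ... | Bézout.result d gcd (Bézout.+- x y eq) = + d , + x , - (+ y) , quot (proj₁ div) , quot (proj₂ div) ,
      combine₁ (sym (trans (cong +_ eq) (ℤP.pos-* x a))) (combine₁ (trans (ℤP.pos-+ d (y ℕ.* b)) (cong (_+_ (+ d)) (ℤP.pos-* y b))) (alg (+ x) (+ a) (+ y) (+ b) (+ d) (+ (d ℕ.+ y ℕ.* b))))
      , eqn (proj₁ div) , eqn (proj₂ div)
    where
    div = GCD.commonDivisor gcd
    quot : ∀ {a} → d ∣ a → ℤ
    quot (divides q _) = + q
    eqn : ∀ {a} (e : d ∣ a) → + a ≡ quot e * + d
    eqn (divides q eq) = trans (cong +_ eq) (ℤP.pos-* q d)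
    alg : ∀ x a y b d s → x * a + - y * b ≡ d + (x * a - s) + (s - (d + y * b))
    alg = solve-∀
  ... | Bézout.result d gcd (Bézout.-+ x y eq) = + d , - (+ x) , + y , quot (proj₁ div) , quot (proj₂ div) ,
      combine₁ (sym (trans (cong +_ eq) (ℤP.pos-* y b))) (combine₁ (trans (ℤP.pos-+ d (x ℕ.* a)) (cong (_+_ (+ d)) (ℤP.pos-* x a))) (alg (+ x) (+ a) (+ y) (+ b) (+ d) (+ (d ℕ.+ x ℕ.* a))))
      , eqn (proj₁ div) , eqn (proj₂ div)
    where
    div = GCD.commonDivisor gcd
    quot : ∀ {a} → d ∣ a → ℤ
    quot (divides q _) = + q
    eqn : ∀ {a} (e : d ∣ a) → + a ≡ quot e * + d
    eqn (divides q eq) = trans (cong +_ eq) (ℤP.pos-* q d)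
    alg : ∀ x a y b d s → - x * a + y * b ≡ d + (y * b - s) + (s - (d + x * a))
    alg = solve-∀

  unit : ∀ a → ∃ λ ε → ε * a ≡ + ∣ a ∣ × ε * + ∣ a ∣ ≡ a
  unit (+ n)      = 1ℤ , ℤP.*-identityˡ (+ n) , ℤP.*-identityˡ (+ n)
  unit (-[1+ n ]) = - 1ℤ , ℤP.-1*i≡-i (-[1+ n ]) , ℤP.-1*i≡-i (+ suc n)

  bézout₂ : ∀ a b → Identity₂ a b
  bézout₂ a b =
    let (g , x , y , α , β , e , ea , eb) = bézout-ℕ ∣ a ∣ ∣ b ∣
        (ε , ε₁ , ε₂) = unit a
        (η , η₁ , η₂) = unit b
    in g , x * ε , y * η , ε * α , η * β
      , trans (cong₂ _+_ (trans (ℤP.*-assoc x ε a) (cong (x *_) ε₁)) (trans (ℤP.*-assoc y η b) (cong (y *_) η₁))) e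
      , trans (sym ε₂) (trans (cong (ε *_) ea) (sym (ℤP.*-assoc ε α g)))
      , trans (sym η₂) (trans (cong (η *_) eb) (sym (ℤP.*-assoc η β g)))

abstract
  bézout : ∀ {m} (v : Vec ℤ m) → BézoutVector v
  bézout Vec.[] = record { d = 0ℤ ; u = λ () ; c = λ () ; combination = refl ; multiple = λ () }
  bézout (a Vec.∷ v) =
    let open BézoutVector (bézout v)
        (g , x , y , α , β , e , ea , ed) = bézout₂ a d
    in record
      { d = g
      ; u = λ { 0F → x ; (Fin.suc l) → y * u l }
      ; c = λ { 0F → α ; (Fin.suc l) → c l * β }
      ; combination = trans (cong (_+_ (x * a)) (trans (∑-cong (λ l → ℤP.*-assoc y (u l) (lookup v l)))
          (trans (∑-*ˡ y (λ l → u l * lookup v l)) (cong (y *_) combination)))) e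
      ; multiple = λ { 0F → ea ; (Fin.suc l) → trans (multiple l) (trans (cong (c l *_) ed) (sym (ℤP.*-assoc (c l) β g))) }
      }

-- The embedding of J into P and its cokernel

module Resolution {n : ℕ} (fm : FunctionsModConstants n) where

  open FunctionsModConstants fm

  private
    X : Set
    X = Fin n

  sizes : Vec X n → Vec ℤ n
  sizes ℓ = tabulate (λ l → ∑ (λ z → ind ⌊ lookup ℓ z ≟ l ⌋))

  Ωset : FinSet
  Ωset = (finSet n ×ᶠ finSet n) ⊎ᶠ (tables n n ×ᶠ finSet n)

  -- The linear forms on J by which J is embedded in a permutation lattice: the differences
  -- a x - a y and, for a labelling ℓ of the letters with Bézout relation ∑ u_l #_l = d
  -- between the sizes #_l = c_l d of its classes, the forms ∑_{ℓ z = l} a z - c_l ∑ u_{ℓ z} a z.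
  ψ : FinSet.Carrier Ωset → X → ℤ
  ψ (inj₁ (x , y)) z = ind ⌊ x ≟ z ⌋ - ind ⌊ y ≟ z ⌋
  ψ (inj₂ (ℓ , l)) z = ind ⌊ lookup ℓ z ≟ l ⌋ - c l * u (lookup ℓ z)
    where open BézoutVector (bézout (sizes ℓ))

  ∑-label : ∀ (ℓ : Vec X n) (f : X → ℤ) → ∑ (λ z → f (lookup ℓ z)) ≡ ∑ (λ l → f l * lookup (sizes ℓ) l)
  ∑-label ℓ f = begin
    ∑ (λ z → f (lookup ℓ z))                               ≡⟨ ∑-cong (λ z → sym (∑-δ (lookup ℓ z) f)) ⟩
    ∑ (λ z → ∑ (λ l → ind ⌊ lookup ℓ z ≟ l ⌋ * f l))       ≡⟨ ∑-swap (λ z l → ind ⌊ lookup ℓ z ≟ l ⌋ * f l) ⟩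
    ∑ (λ l → ∑ (λ z → ind ⌊ lookup ℓ z ≟ l ⌋ * f l))
      ≡⟨ ∑-cong (λ l → trans (∑-*ʳ (λ z → ind ⌊ lookup ℓ z ≟ l ⌋) (f l)) (trans (ℤP.*-comm _ (f l))
           (cong (f l *_) (sym (lookup∘tabulate (λ l → ∑ (λ z → ind ⌊ lookup ℓ z ≟ l ⌋)) l))))) ⟩
    ∑ (λ l → f l * lookup (sizes ℓ) l) ∎
    where open ≡-Reasoning

  ∑-ind : ∀ {m} (x : Fin m) → ∑ (λ z → ind ⌊ x ≟ z ⌋) ≡ 1ℤ
  ∑-ind x = trans (∑-cong (λ z → sym (ℤP.*-identityʳ (ind ⌊ x ≟ z ⌋)))) (∑-δ x (λ _ → 1ℤ))

  -- What makes the forms well defined modulo constants. For a labelling, the class `l` has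
  -- `c l * d` letters, and the `u` summed over the labels of all letters give `d`.
  ∑-ψ : ∀ ω → ∑ (ψ ω) ≡ 0ℤ
  ∑-ψ (inj₁ (x , y)) = trans (∑-− (λ z → ind ⌊ x ≟ z ⌋) (λ z → ind ⌊ y ≟ z ⌋)) (cong₂ _-_ (∑-ind x) (∑-ind y))
  ∑-ψ (inj₂ (ℓ , l)) = begin
    ∑ (λ z → ind ⌊ lookup ℓ z ≟ l ⌋ - c l * u (lookup ℓ z)) ≡⟨ ∑-− (λ z → ind ⌊ lookup ℓ z ≟ l ⌋) (λ z → c l * u (lookup ℓ z)) ⟩
    ∑ (λ z → ind ⌊ lookup ℓ z ≟ l ⌋) - ∑ (λ z → c l * u (lookup ℓ z))
      ≡⟨ cong₂ _-_ (trans (sym (lookup∘tabulate (λ l → ∑ (λ z → ind ⌊ lookup ℓ z ≟ l ⌋)) l)) (multiple l))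
           (trans (∑-*ˡ (c l) (λ z → u (lookup ℓ z))) (cong (c l *_) (trans (∑-label ℓ u) combination))) ⟩
    c l * d - c l * d ≡⟨ ℤP.+-inverseʳ (c l * d) ⟩
    0ℤ ∎
    where
    open ≡-Reasoning
    open BézoutVector (bézout (sizes ℓ))

  relabel : Perm n → Vec X n → Vec X n
  relabel g ℓ = tabulate (λ z → lookup ℓ (g ⁻¹ ∙ z))

  lookup-relabel : ∀ g ℓ z → lookup (relabel g ℓ) z ≡ lookup ℓ (g ⁻¹ ∙ z)
  lookup-relabel g ℓ z = lookup∘tabulate (λ z → lookup ℓ (g ⁻¹ ∙ z)) z

  Ω : GSet n
  Ω = record
    { set = Ωset
    ; _▹_ = λ { g (inj₁ (x , y)) → inj₁ (g ∙ x , g ∙ y) ; g (inj₂ (ℓ , l)) → inj₂ (relabel g ℓ , l) }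
    ; ▹-id = λ { (inj₁ (x , y)) → cong₂ (λ x y → inj₁ (x , y)) (idP-∙ x) (idP-∙ y)
               ; (inj₂ (ℓ , l)) → cong (λ ℓ → inj₂ (ℓ , l)) (perm-ext (relabel idP ℓ) ℓ
                   (λ z → trans (lookup-relabel idP ℓ z) (cong (lookup ℓ) (idP⁻¹ z)))) }
    ; ▹-∘ = λ { g h ig ih (inj₁ (x , y)) → cong₂ (λ x y → inj₁ (x , y)) (∘P-∙ g h x) (∘P-∙ g h y)
              ; g h ig ih (inj₂ (ℓ , l)) → cong (λ ℓ → inj₂ (ℓ , l)) (perm-ext (relabel (g ∘P h) ℓ) (relabel g (relabel h ℓ))
                  (λ z → trans (lookup-relabel (g ∘P h) ℓ z) (trans (cong (lookup ℓ) (∘P-⁻¹ g h ig ih z))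
                    (sym (trans (lookup-relabel g (relabel h ℓ) z) (lookup-relabel h ℓ (g ⁻¹ ∙ z))))))) }
    }

  open GSet Ω public using () renaming (permLattice to P; _▹_ to _▹Ω_; perm-isGLattice to P-isGLattice; perm-isPermutation to P-isPermutation; Carrier to ΩC)
  module Ω = GSet Ω

  -- The Bézout coefficients are chosen from the vector of sizes alone, so all relabellings share
  -- them; this makes `ψ` equivariant.
  sizes-relabel : ∀ g → Inj g → ∀ ℓ → sizes (relabel g ℓ) ≡ sizes ℓ
  sizes-relabel g ig ℓ = tabulate-cong (λ l → trans (sym (∑-perm g ig (λ z → ind ⌊ lookup (relabel g ℓ) z ≟ l ⌋)))
    (∑-cong (λ z → cong (λ q → ind ⌊ q ≟ l ⌋) (trans (lookup-relabel g ℓ (g ∙ z)) (cong (lookup ℓ) (inverseˡ g ig z))))))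

  ψ-▹ : ∀ g → Inj g → ∀ ω z → ψ (g ▹Ω ω) (g ∙ z) ≡ ψ ω z
  ψ-▹ g ig (inj₁ (x , y)) z = cong₂ _-_ (ind-⇔ (g ∙ x ≟ g ∙ z) (x ≟ z) (ig x z) (cong (g ∙_))) (ind-⇔ (g ∙ y ≟ g ∙ z) (y ≟ z) (ig y z) (cong (g ∙_)))
  ψ-▹ g ig (inj₂ (ℓ , l)) z = cong₂ (λ q s → ind ⌊ q ≟ l ⌋ - BézoutVector.c (bézout s) l * BézoutVector.u (bézout s) q)
    (trans (lookup-relabel g ℓ (g ∙ z)) (cong (lookup ℓ) (inverseˡ g ig z))) (sizes-relabel g ig ℓ)

  I : (X → ℤ) → Vect Ω.size
  I f i = ∑ (λ z → ψ (Ω.from i) z * f z)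

  I-linear : Linear I
  I-linear = ⊛-linear (λ i z → ψ (Ω.from i) z)

  I-to : ∀ f ω → I f (Ω.to ω) ≡ ∑ (λ z → ψ ω z * f z)
  I-to f ω = cong (λ ω → ∑ (λ z → ψ ω z * f z)) (Ω.from-to ω)

  I-const : ∀ c i → I (λ _ → c) i ≡ 0ℤ
  I-const c i = trans (∑-*ʳ (ψ (Ω.from i)) c) (trans (cong (_* c) (∑-ψ (Ω.from i))) (ℤP.*-zeroˡ c))

  private module Iᴸ = Linear I-linear

  I-shift : ∀ f c i → I (λ x → f x - c) i ≡ I f i
  I-shift f c i = trans (Iᴸ.lin-− f (λ _ → c) i) (trans (cong (λ q → I f i - q) (I-const c i)) (ℤP.+-identityʳ (I f i)))

  I-pair : ∀ f x y → I f (Ω.to (inj₁ (x , y))) ≡ f x - f y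
  I-pair f x y = trans (I-to f (inj₁ (x , y))) (trans (∑-cong (λ z → alg (ind ⌊ x ≟ z ⌋) (ind ⌊ y ≟ z ⌋) (f z)))
    (trans (∑-− (λ z → ind ⌊ x ≟ z ⌋ * f z) (λ z → ind ⌊ y ≟ z ⌋ * f z)) (cong₂ _-_ (∑-δ x f) (∑-δ y f))))
    where
    alg : ∀ a b c → (a - b) * c ≡ a * c - b * c
    alg = solve-∀

  I-act : ∀ g → Inj g → ∀ f i → (act P g ⊛ I f) i ≡ I (λ x → f (g ⁻¹ ∙ x)) i
  I-act g ig f i = trans (cong (act P g ⊛ I f) (sym (Ω.to-from i))) (trans (Ω.perm-act g ig (I f) ω) (trans (I-to f (g ⁻¹ ▹Ω ω))
    (trans (sym (∑-perm (g ⁻¹) (⁻¹-Inj g ig) (λ z → ψ (g ⁻¹ ▹Ω ω) z * f z)))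
      (∑-cong (λ z → cong (_* f (g ⁻¹ ∙ z)) (ψ-▹ (g ⁻¹) (⁻¹-Inj g ig) ω z))))))
    where ω = Ω.from i

  -- The coordinates at the pairs (x , a) with x ≢ a recover an element of J from its image;
  -- the others serve as coordinates of the cokernel.
  keep : ΩC → Bool
  keep (inj₁ (x , y)) = not (⌊ y ≟ a ⌋ ∧ not ⌊ x ≟ a ⌋)
  keep (inj₂ _)       = true

  ¬keep : ∀ ω → ¬ T (keep ω) → ∃ λ x → ¬ x ≡ a × ω ≡ inj₁ (x , a)
  ¬keep (inj₁ (x , y)) ¬k with y ≟ a | x ≟ a
  ... | yes refl | no x≢a = x , x≢a , refl
  ... | yes refl | yes _  = ⊥-elim (¬k tt)
  ... | no _     | _      = ⊥-elim (¬k tt)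
  ¬keep (inj₂ _) ¬k = ⊥-elim (¬k tt)

  keep-base : ∀ x → ¬ x ≡ a → ¬ T (keep (inj₁ (x , a)))
  keep-base x x≢a with a ≟ a | x ≟ a
  ... | yes _ | yes e = λ _ → x≢a e
  ... | yes _ | no _  = λ ()
  ... | no ne | _     = λ _ → ne refl

  module Ω′ = FinSet (subset Ωset keep)

  emb : Fin Ω′.size → Fin Ω.size
  emb k = Ω.to (proj₁ (Ω′.from k))

  emb-injective : ∀ k l → emb k ≡ emb l → k ≡ l
  emb-injective k l e = trans (sym (Ω′.to-from k)) (trans (cong Ω′.to (pair (Ω′.from k) (Ω′.from l) (Ω.to-injective e))) (Ω′.to-from l))
    where
    pair : ∀ (p q : Σ ΩC (T ∘ keep)) → proj₁ p ≡ proj₁ q → p ≡ q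
    pair (x , t) (.x , t′) refl = cong (x ,_) (T-irrelevant t t′)

  emb-hits : ∀ i → T (keep (Ω.from i)) → ∃ λ k → emb k ≡ i
  emb-hits i t = Ω′.to (Ω.from i , t) , trans (cong (Ω.to ∘ proj₁) (Ω′.from-to (Ω.from i , t))) (Ω.to-from i)

  emb-keep : ∀ k → T (keep (Ω.from (emb k)))
  emb-keep k = subst (T ∘ keep) (sym (Ω.from-to (proj₁ (Ω′.from k)))) (proj₂ (Ω′.from k))

  section : Vect Ω′.size → Vect Ω.size
  section f i = ∑ (λ k → ind ⌊ i ≟ emb k ⌋ * f k)

  section-linear : Linear section
  section-linear = ⊛-linear (λ i k → ind ⌊ i ≟ emb k ⌋)

  section-emb : ∀ f k → section f (emb k) ≡ f k
  section-emb f k = trans (∑-cong (λ l → cong (_* f l) (ind-⇔ (emb k ≟ emb l) (k ≟ l) (emb-injective k l) (cong emb)))) (∑-δ k f)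

  section-base : ∀ f x → ¬ x ≡ a → section f (Ω.to (inj₁ (x , a))) ≡ 0ℤ
  section-base f x x≢a = ∑-zero (λ k → cong (_* f k) (ind-no (Ω.to (inj₁ (x , a)) ≟ emb k)
    (λ e → keep-base x x≢a (subst (T ∘ keep) (trans (cong Ω.from (sym e)) (Ω.from-to (inj₁ (x , a)))) (emb-keep k)))))

  lift : Vect Ω.size → X → ℤ
  lift v x = (1ℤ - ind ⌊ x ≟ a ⌋) * v (Ω.to (inj₁ (x , a)))

  lift-≢ : ∀ v x → ¬ x ≡ a → lift v x ≡ v (Ω.to (inj₁ (x , a)))
  lift-≢ v x x≢a = trans (cong (λ q → (1ℤ - q) * v (Ω.to (inj₁ (x , a)))) (ind-no (x ≟ a) x≢a)) (ℤP.*-identityˡ _)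

  lift-a : ∀ v → lift v a ≡ 0ℤ
  lift-a v = trans (cong (λ q → (1ℤ - q) * v (Ω.to (inj₁ (a , a)))) (ind-yes (a ≟ a) refl)) (ℤP.*-zeroˡ (v (Ω.to (inj₁ (a , a)))))

  lift-linear : Linear lift
  lift-linear = record
    { lin-cong = λ e x → cong ((1ℤ - ind ⌊ x ≟ a ⌋) *_) (e (Ω.to (inj₁ (x , a))))
    ; lin-+ = λ u v x → ℤP.*-distribˡ-+ (1ℤ - ind ⌊ x ≟ a ⌋) (u (Ω.to (inj₁ (x , a)))) (v (Ω.to (inj₁ (x , a))))
    ; lin-* = λ c v x → comm (1ℤ - ind ⌊ x ≟ a ⌋) c (v (Ω.to (inj₁ (x , a))))
    }
    where
    comm : ∀ x y z → x * (y * z) ≡ y * (x * z)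
    comm = solve-∀

  lift-I : ∀ f x → lift (I f) x ≡ f x - f a
  lift-I f x with x ≟ a
  ... | yes refl = trans (ℤP.*-zeroˡ (I f (Ω.to (inj₁ (a , a))))) (sym (ℤP.+-inverseʳ (f a)))
  ... | no x≢a = trans (ℤP.*-identityˡ _) (I-pair f x a)

  -- Subtracting the element of `J` with the same base coordinates kills the image of `I` and leaves
  -- arbitrary values at the kept coordinates, so the cokernel is free.
  proj : Vect Ω.size → Vect Ω′.size
  proj v k = v (emb k) - I (lift v) (emb k)

  private
    IL-linear : Linear (I ∘ lift)
    IL-linear = ∘-linear I-linear lift-linear

  proj-linear : Linear proj
  proj-linear = record
    { lin-cong = λ e k → cong₂ _-_ (e (emb k)) (IL.lin-cong e (emb k))
    ; lin-+ = λ u v k → trans (cong (λ q → u (emb k) + v (emb k) - q) (IL.lin-+ u v (emb k))) (alg (u (emb k)) (v (emb k)) (I (lift u) (emb k)) (I (lift v) (emb k)))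
    ; lin-* = λ c v k → trans (cong (λ q → c * v (emb k) - q) (IL.lin-* c v (emb k))) (alg′ c (v (emb k)) (I (lift v) (emb k)))
    }
    where
    module IL = Linear IL-linear
    alg : ∀ a b c d → a + b - (c + d) ≡ a - c + (b - d)
    alg = solve-∀
    alg′ : ∀ c x y → c * x - c * y ≡ c * (x - y)
    alg′ = solve-∀

  module πᴸ = Linear proj-linear

  proj-I : ∀ f k → proj (I f) k ≡ 0ℤ
  proj-I f k = trans (cong (λ q → I f (emb k) - q) (trans (Iᴸ.lin-cong (lift-I f) (emb k)) (I-shift f (f a) (emb k)))) (ℤP.+-inverseʳ (I f (emb k)))

  proj-section : ∀ f k → proj (section f) k ≡ f k
  proj-section f k = trans (cong₂ _-_ (section-emb f k) (trans (Iᴸ.lin-cong lift0 (emb k)) (Iᴸ.lin-0 (emb k)))) (ℤP.+-identityʳ (f k))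
    where
    lift0 : ∀ x → lift (section f) x ≡ 0ℤ
    lift0 x with x ≟ a
    ... | yes refl = ℤP.*-zeroˡ (section f (Ω.to (inj₁ (a , a))))
    ... | no x≢a = trans (ℤP.*-identityˡ _) (section-base f x x≢a)

  decompose : ∀ v i → v i ≡ section (proj v) i + I (lift v) i
  decompose v i = go (T? (keep (Ω.from i)))
    where
    cancel : ∀ x y → x ≡ x - y + y
    cancel = solve-∀
    go : Dec (T (keep (Ω.from i))) → v i ≡ section (proj v) i + I (lift v) i
    go (yes t) = let (k , e) = emb-hits i t in subst (λ i → v i ≡ section (proj v) i + I (lift v) i) e
      (trans (cancel (v (emb k)) (I (lift v) (emb k))) (cong (λ q → q + I (lift v) (emb k)) (sym (section-emb (proj v) k))))
    go (no ¬t) = let (x , x≢a , ω≡) = ¬keep (Ω.from i) ¬t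
                     i≡ = trans (cong Ω.to (sym ω≡)) (Ω.to-from i)
      in subst (λ i → v i ≡ section (proj v) i + I (lift v) i) i≡
        (sym (trans (cong₂ _+_ (section-base (proj v) x x≢a) (trans (I-pair (lift v) x a) (cong₂ _-_ (lift-≢ v x x≢a) (lift-a v))))
          (strip (v (Ω.to (inj₁ (x , a)))))))
      where
      strip : ∀ q → 0ℤ + (q - 0ℤ) ≡ q
      strip = solve-∀

∑-injective : ∀ {m} (σ : Fin m → Fin m) → (∀ i j → σ i ≡ σ j → i ≡ j) → (f : Fin m → ℤ) → ∑ (f ∘ σ) ≡ ∑ f
∑-injective σ inj f = ∑-bij σ (λ j → proj₁ (injective⇒hits σ inj j)) (λ i → inj _ _ (proj₂ (injective⇒hits σ inj (σ i))))
  (λ j → proj₂ (injective⇒hits σ inj j)) f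

module SubgroupElements {n : ℕ} (H : Subgroup n) where

  K : ℕ
  K = List.length (elts H)

  h : Fin K → Perm n
  h = List.lookup (elts H)

  h-InA : ∀ k → InA (h k)
  h-InA k = inA H (∈-lookup k)

  h-Inj : ∀ k → Inj (h k)
  h-Inj k = InA⇒Inj (h k) (h-InA k)

  one : Fin K
  one = Any.index (hasId H)

  h-one : h one ≡ idP
  h-one = sym (AnyP.lookup-index (hasId H))

  K≢0 : ℕ.NonZero K
  K≢0 = ℕ.>-nonZero (ℕP.≤-<-trans ℕ.z≤n (FinP.toℕ<n one))

  mul : Fin K → Fin K → Fin K
  mul k l = Any.index (closed H (∈-lookup {xs = elts H} k) (∈-lookup {xs = elts H} l))

  h-mul : ∀ k l → h (mul k l) ≡ h k ∘P h l
  h-mul k l = sym (AnyP.lookup-index (closed H (∈-lookup {xs = elts H} k) (∈-lookup {xs = elts H} l)))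

  h-mul-∙ : ∀ k l x → h (mul k l) ∙ x ≡ h k ∙ h l ∙ x
  h-mul-∙ k l x = trans (cong (_∙ x) (h-mul k l)) (∘P-∙ (h k) (h l) x)

  h-injective : ∀ k l → (∀ x → h k ∙ x ≡ h l ∙ x) → k ≡ l
  h-injective k l e = lookup-injective (unique H) k l (perm-ext (h k) (h l) e)

  mul-injectiveˡ : ∀ k l l′ → mul k l ≡ mul k l′ → l ≡ l′
  mul-injectiveˡ k l l′ e = h-injective l l′ (λ x → h-Inj k _ _ (trans (sym (h-mul-∙ k l x)) (trans (cong (λ m → h m ∙ x) e) (h-mul-∙ k l′ x))))

  mul-injectiveʳ : ∀ l k k′ → mul k l ≡ mul k′ l → k ≡ k′
  mul-injectiveʳ l k k′ e = h-injective k k′ (λ x → trans (cong (h k ∙_) (sym (inverseʳ (h l) (h-Inj l) x)))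
    (trans (trans (sym (h-mul-∙ k l _)) (trans (cong (λ m → h m ∙ (h l ⁻¹ ∙ x)) e) (h-mul-∙ k′ l _)))
      (cong (h k′ ∙_) (inverseʳ (h l) (h-Inj l) x))))

  ∑-mul : ∀ k (f : Fin K → ℤ) → ∑ (λ l → f (mul k l)) ≡ ∑ f
  ∑-mul k = ∑-injective (mul k) (mul-injectiveˡ k)

  module Orbits {B : ℕ} (σ : Fin K → Fin B → Fin B) (σ-mul : ∀ k l i → σ (mul k l) i ≡ σ k (σ l i)) (σ-one : ∀ i → σ one i ≡ i) where

    R : Fin B → Fin B → Set
    R i j = ∃ λ k → σ k i ≡ j

    open Representative {R = R} (λ i j → FinP.any? (λ k → σ k i ≟ j)) (λ i → one , σ-one i) public

    rep-σ : ∀ k i → rep (σ k i) ≡ rep i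
    rep-σ k i = rep-cong (σ k i) i (λ { _ (l , e) → mul l k , trans (σ-mul l k i) e })
      -- Right multiplication by `h k` is injective on a finite set, hence onto; this takes the
      -- place of inverses in `H`.
      (λ { j (l , e) → let (m , q) = injective⇒hits (λ m → mul m k) (mul-injectiveʳ k) l in
           m , trans (sym (σ-mul m k i)) (trans (cong (λ l → σ l i) q) e) })

    orbit-coinvariants : (f : Fin B → ℤ) → (∀ i → ∑ (λ k → push (σ k) f i) ≡ 0ℤ) →
      ∃ λ (y : Fin K → Fin B → ℤ) → ∀ i → f i ≡ ∑ (λ k → push (σ k) (y k) i - y k i)
    orbit-coinvariants = coinvariants {{K≢0}} σ rep (λ j → proj₁ (rep-R j)) rep-σ (λ j → proj₂ (rep-R j))

module Cokernel {n : ℕ} (fm : FunctionsModConstants n) where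

  open FunctionsModConstants fm
  open Resolution fm

  private
    module Iᴸ = Linear I-linear
    module Sᴸ = Linear section-linear
    actP-linear : ∀ g → Linear (act P g ⊛_)
    actP-linear g = ⊛-linear (act P g)
    actF : Perm n → Vect Ω′.size → Vect Ω′.size
    actF g f = proj (act P g ⊛ section f)
    actF-linear : ∀ g → Linear (actF g)
    actF-linear g = ∘-linear proj-linear (∘-linear (actP-linear g) section-linear)

  F : RawLattice n
  F = record { rank = Ω′.size ; act = λ g → matrix (actF g) (actF-linear g) }

  F-act : ∀ g f k → (act F g ⊛ f) k ≡ proj (act P g ⊛ section f) k
  F-act g = matrix-⊛ (actF g) (actF-linear g)

  -- The part `I (lift v)` stays in the image of `I` under g, so nothing is lost by passing through
  -- the section.
  proj-act : ∀ g → Inj g → ∀ v k → proj (act P g ⊛ v) k ≡ (act F g ⊛ proj v) k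
  proj-act g ig v k = begin
    proj (act P g ⊛ v) k
      ≡⟨ πᴸ.lin-cong (λ i → trans (⊛-cong (act P g) (decompose v) i) (Linear.lin-+ (actP-linear g) (section (proj v)) (I (lift v)) i)) k ⟩
    proj (λ i → (act P g ⊛ section (proj v)) i + (act P g ⊛ I (lift v)) i) k
      ≡⟨ πᴸ.lin-+ (act P g ⊛ section (proj v)) (act P g ⊛ I (lift v)) k ⟩
    proj (act P g ⊛ section (proj v)) k + proj (act P g ⊛ I (lift v)) k
      ≡⟨ cong₂ _+_ (sym (F-act g (proj v) k)) (trans (πᴸ.lin-cong (I-act g ig (lift v)) k) (proj-I (λ x → lift v (g ⁻¹ ∙ x)) k)) ⟩
    (act F g ⊛ proj v) k + 0ℤ ≡⟨ ℤP.+-identityʳ _ ⟩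
    (act F g ⊛ proj v) k ∎
    where open ≡-Reasoning

  F-isGLattice : IsGLattice F
  F-isGLattice = ⊛⇒≈M {M = act F idP} {N = 1M} (λ f k → trans (F-act idP f k)
      (trans (πᴸ.lin-cong (λ i → trans (≈M⇒⊛ (proj₁ P-isGLattice) (section f) i) (1M-⊛ (section f) i)) k)
        (trans (proj-section f k) (sym (1M-⊛ f k)))))
    , λ g h ag ah → ⊛⇒≈M {M = act F (g ∘P h)} {N = act F g · act F h} (λ f k → begin
        (act F (g ∘P h) ⊛ f) k                      ≡⟨ F-act (g ∘P h) f k ⟩
        proj (act P (g ∘P h) ⊛ section f) k         ≡⟨ πᴸ.lin-cong (λ i → trans (≈M⇒⊛ (proj₂ P-isGLattice g h ag ah) (section f) i) (·-⊛ (act P g) (act P h) (section f) i)) k ⟩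
        proj (act P g ⊛ (act P h ⊛ section f)) k    ≡⟨ proj-act g (InA⇒Inj g ag) (act P h ⊛ section f) k ⟩
        (act F g ⊛ proj (act P h ⊛ section f)) k    ≡⟨ ⊛-cong (act F g) (F-act h f) k ⟨
        (act F g ⊛ (act F h ⊛ f)) k                 ≡⟨ ·-⊛ (act F g) (act F h) f k ⟨
        ((act F g · act F h) ⊛ f) k ∎)
    where open ≡-Reasoning

  i : Mat Ω.size r
  i = (λ j z → ψ (Ω.from j) z) · (λ z l → ind ⌊ z ≟ b l ⌋)

  i-⊛ : ∀ w j → (i ⊛ w) j ≡ I (ext w) j
  i-⊛ w j = ·-⊛ (λ j z → ψ (Ω.from j) z) (λ z l → ind ⌊ z ≟ b l ⌋) w j

  π : Mat Ω′.size Ω.size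
  π = matrix proj proj-linear

  π-⊛ : ∀ v k → (π ⊛ v) k ≡ proj v k
  π-⊛ = matrix-⊛ proj proj-linear

  kernel : ∀ v → (∀ k → proj v k ≡ 0ℤ) → ∀ j → v j ≡ I (lift v) j
  kernel v e j = trans (decompose v j) (trans (cong (λ q → q + I (lift v) j) (trans (Sᴸ.lin-cong e j) (Sᴸ.lin-0 j))) (ℤP.+-identityˡ (I (lift v) j)))

  exact : ShortExact lattice P F
  exact = i , π
    , (λ g ag → ⊛⇒≈M {M = i · act lattice g} {N = act P g · i} (λ w j → begin
        ((i · act lattice g) ⊛ w) j          ≡⟨ ·-⊛ i (act lattice g) w j ⟩
        (i ⊛ (act lattice g ⊛ w)) j          ≡⟨ i-⊛ (act lattice g ⊛ w) j ⟩
        I (ext (act lattice g ⊛ w)) j        ≡⟨ Iᴸ.lin-cong (ext-act g w) j ⟩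
        I (λ x → ext w (g ⁻¹ ∙ x) - ext w (g ⁻¹ ∙ a)) j ≡⟨ I-shift (λ x → ext w (g ⁻¹ ∙ x)) (ext w (g ⁻¹ ∙ a)) j ⟩
        I (λ x → ext w (g ⁻¹ ∙ x)) j         ≡⟨ I-act g (InA⇒Inj g ag) (ext w) j ⟨
        (act P g ⊛ I (ext w)) j              ≡⟨ ⊛-cong (act P g) (i-⊛ w) j ⟨
        (act P g ⊛ (i ⊛ w)) j                ≡⟨ ·-⊛ (act P g) i w j ⟨
        ((act P g · i) ⊛ w) j ∎))
    , (λ g ag → ⊛⇒≈M {M = π · act P g} {N = act F g · π} (λ v k → begin
        ((π · act P g) ⊛ v) k                ≡⟨ ·-⊛ π (act P g) v k ⟩
        (π ⊛ (act P g ⊛ v)) k                ≡⟨ π-⊛ (act P g ⊛ v) k ⟩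
        proj (act P g ⊛ v) k                 ≡⟨ proj-act g (InA⇒Inj g ag) v k ⟩
        (act F g ⊛ proj v) k                 ≡⟨ ⊛-cong (act F g) (π-⊛ v) k ⟨
        (act F g ⊛ (π ⊛ v)) k                ≡⟨ ·-⊛ (act F g) π v k ⟨
        ((act F g · π) ⊛ v) k ∎))
    , (λ w e l → begin
        w l                                  ≡⟨ res-ext w l ⟨
        ext w (b l) - ext w a                ≡⟨ I-pair (ext w) (b l) a ⟨
        I (ext w) (Ω.to (inj₁ (b l , a)))    ≡⟨ i-⊛ w (Ω.to (inj₁ (b l , a))) ⟨
        (i ⊛ w) (Ω.to (inj₁ (b l , a)))      ≡⟨ e (Ω.to (inj₁ (b l , a))) ⟩
        0ℤ ∎)
    , (λ y → section y , λ k → trans (π-⊛ (section y) k) (proj-section y k))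
    , (λ w k → trans (π-⊛ (i ⊛ w) k) (trans (πᴸ.lin-cong (i-⊛ w) k) (proj-I (ext w) k)))
    , (λ v e → res (lift v) , λ j → trans (i-⊛ (res (lift v)) j) (trans (Iᴸ.lin-cong (ext-res (lift v)) j)
        (trans (I-shift (lift v) (lift v a) j) (sym (kernel v (λ k → trans (sym (π-⊛ v k)) (e k)) j)))))
    where
    open ≡-Reasoning

-- Flasqueness of the cokernel

module _ {n : ℕ} (fm : FunctionsModConstants n) .{{_ : ℕ.NonZero n}} where

  open FunctionsModConstants fm
  open Resolution fm
  open Cokernel fm

  private module Iᴸ = Linear I-linear

  -- The two functions differ by a constant, and equal sums make n times it vanish. In this way
  -- invariance modulo constants becomes invariance, because translating a function does not change
  -- its sum.
  I-injective : ∀ f f′ → (∀ j → I f j ≡ I f′ j) → ∑ f ≡ ∑ f′ → ∀ x → f x ≡ f′ x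
  I-injective f f′ e s x = ℤP.i-j≡0⇒i≡j (f x) (f′ x) (*-cancelˡ-0 n (f x - f′ x) (begin
    + n * (f x - f′ x)                ≡⟨ ∑-const n (f x - f′ x) ⟨
    ∑ {n} (λ _ → f x - f′ x)          ≡⟨ ∑-cong (λ y → const y) ⟩
    ∑ (λ y → f y - f′ y)              ≡⟨ ∑-− f f′ ⟩
    ∑ f - ∑ f′                        ≡⟨ cong (_- ∑ f′) s ⟩
    ∑ f′ - ∑ f′                       ≡⟨ ℤP.+-inverseʳ (∑ f′) ⟩
    0ℤ ∎))
    where
    open ≡-Reasoning
    alg : ∀ a b c d → a - b ≡ c - d + (a - c - (b - d))
    alg = solve-∀
    const : ∀ y → f x - f′ x ≡ f y - f′ y
    const y = combine₁ (trans (sym (I-pair f x y)) (trans (e (Ω.to (inj₁ (x , y)))) (I-pair f′ x y))) (alg (f x) (f′ x) (f y) (f′ y))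

  module _ (H : Subgroup n) (x : Vect (rank F)) where

    open SubgroupElements H

    private
      module OX = Orbits (λ k x → h k ∙ x) h-mul-∙ (λ x → trans (cong (_∙ x) h-one) (idP-∙ x))
      module OΩ = Orbits (λ k → Ω.σ (h k))
        (λ k l i → trans (cong (λ g → Ω.σ g i) (h-mul k l)) (Ω.σ-∘ (h k) (h l) (h-Inj k) (h-Inj l) i))
        (λ i → trans (cong (λ g → Ω.σ g i) h-one) (trans (cong Ω.to (Ω.▹-id (Ω.from i))) (Ω.to-from i)))
      open OX using (rep; rep-R; rep-σ)

      v Nv : Vect Ω.size
      v = section x
      Nv j = ∑ (λ k → (act P (h k) ⊛ v) j)

      w : Fin n → ℤ
      w = lift Nv

      ℓ : Vec (Fin n) n
      ℓ = tabulate rep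

      ℓ-rep : ∀ z → lookup ℓ z ≡ rep z
      ℓ-rep = lookup∘tabulate rep

      open BézoutVector (bézout (sizes ℓ))

      V S : Fin n → ℤ
      V l = v (Ω.to (inj₂ (ℓ , l)))
      S l = lookup (sizes ℓ) l

      Nv-act : ∀ k j → (act P (h k) ⊛ Nv) j ≡ Nv j
      Nv-act k j = begin
        (act P (h k) ⊛ Nv) j                            ≡⟨ Linear.lin-∑ (⊛-linear (act P (h k))) (λ l → act P (h l) ⊛ v) j ⟩
        ∑ (λ l → (act P (h k) ⊛ (act P (h l) ⊛ v)) j)   ≡⟨ ∑-cong (λ l → sym (trans (≈M⇒⊛ (proj₂ P-isGLattice (h k) (h l) (h-InA k) (h-InA l)) v j) (·-⊛ (act P (h k)) (act P (h l)) v j))) ⟩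
        ∑ (λ l → (act P (h k ∘P h l) ⊛ v) j)            ≡⟨ ∑-cong (λ l → cong (λ g → (act P g ⊛ v) j) (sym (h-mul k l))) ⟩
        ∑ (λ l → (act P (h (mul k l)) ⊛ v) j)           ≡⟨ ∑-mul k (λ l → (act P (h l) ⊛ v) j) ⟩
        Nv j ∎
        where open ≡-Reasoning

      -- For `y` in the orbit of `l` this is the order of the stabiliser of `l`.
      m : Fin n → Fin n → ℤ
      m l y = ∑ (λ k → ind ⌊ y ≟ h k ∙ l ⌋)

      m-inv : ∀ l k y → m l (h k ∙ y) ≡ m l y
      m-inv l k y = trans (sym (∑-mul k (λ j → ind ⌊ h k ∙ y ≟ h j ∙ l ⌋))) (∑-cong (λ j →
        trans (cong (λ q → ind ⌊ h k ∙ y ≟ q ⌋) (h-mul-∙ k j l)) (ind-⇔ (h k ∙ y ≟ h k ∙ h j ∙ l) (y ≟ h j ∙ l) (h-Inj k _ _) (cong (h k ∙_)))))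

      m-rep : ∀ l y → m l (rep y) ≡ m l y
      m-rep l y = let (k , e) = rep-R y in trans (cong (m l) (sym e)) (m-inv l k y)

      rep-rep : ∀ y → rep (rep y) ≡ rep y
      rep-rep y = let (k , e) = rep-R y in trans (cong rep (sym e)) (rep-σ k y)

      -- Counting in two ways the pairs of a letter `z` and an index `k` with `z = h k ∙ l`.
      orbit-stabiliser : ∀ y → S (rep y) * m (rep y) y ≡ + K
      orbit-stabiliser y = begin
        S l * m l y                                     ≡⟨ cong (_* m l y) (lookup∘tabulate (λ l → ∑ (λ z → ind ⌊ lookup ℓ z ≟ l ⌋)) l) ⟩
        ∑ (λ z → ind ⌊ lookup ℓ z ≟ l ⌋) * m l y        ≡⟨ ∑-*ʳ (λ z → ind ⌊ lookup ℓ z ≟ l ⌋) (m l y) ⟨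
        ∑ (λ z → ind ⌊ lookup ℓ z ≟ l ⌋ * m l y)        ≡⟨ ∑-cong (λ z → term z (rep z ≟ l)) ⟩
        ∑ (λ z → m l z)                                 ≡⟨ ∑-swap (λ z k → ind ⌊ z ≟ h k ∙ l ⌋) ⟩
        ∑ (λ k → ∑ (λ z → ind ⌊ z ≟ h k ∙ l ⌋))         ≡⟨ ∑-cong (λ k → trans (∑-cong (λ z → sym (ℤP.*-identityˡ (ind ⌊ z ≟ h k ∙ l ⌋)))) (∑-δʳ (h k ∙ l) (λ _ → 1ℤ))) ⟩
        ∑ {K} (λ _ → 1ℤ)                                ≡⟨ trans (∑-const K 1ℤ) (ℤP.*-identityʳ (+ K)) ⟩
        + K ∎
        where
        open ≡-Reasoning
        l = rep y
        term : ∀ z → Dec (rep z ≡ l) → ind ⌊ lookup ℓ z ≟ l ⌋ * m l y ≡ m l z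
        term z (yes e) = trans (cong (_* m l y) (ind-yes (lookup ℓ z ≟ l) (trans (ℓ-rep z) e))) (trans (ℤP.*-identityˡ (m l y))
          (trans (sym (m-rep l y)) (trans (cong (m l) (sym e)) (m-rep l z))))
        term z (no ne) = trans (cong (_* m l y) (ind-no (lookup ℓ z ≟ l) (ne ∘ trans (sym (ℓ-rep z))))) (trans (ℤP.*-zeroˡ (m l y))
          (sym (∑-zero (λ k → ind-no (z ≟ h k ∙ l) (λ e → ne (trans (cong rep e) (trans (rep-σ k l) (rep-rep y))))))))

      -- The constant modulo which `w` will be a norm. It comes from the Bézout term of `ψ`: for
      -- invariant `w`, the u (ℓ y) w y summed over all letters give kk d.
      kk : ℤ
      kk = ∑ (λ l → u l * w l * c l)

      -- Concentrated on the orbit representatives, with the coordinates of `v` at the labelling by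
      -- orbits as values; its norm turns out to be `w - kk`.
      z : Fin n → ℤ
      z y = ind ⌊ rep y ≟ y ⌋ * V y

      Nz : Fin n → ℤ
      Nz y = ∑ (λ k → z (h k ⁻¹ ∙ y))

      v′ : Vect Ω.size
      v′ j = v j - I z j

    module _ (norm0 : ∀ i → ∑ (λ k → (act F (h k) ⊛ x) i) ≡ 0ℤ) where

      private
        Nv-I : ∀ j → Nv j ≡ I w j
        Nv-I = kernel Nv (λ i → trans (πᴸ.lin-∑ (λ k → act P (h k) ⊛ v) i) (trans (∑-cong (λ k → sym (F-act (h k) x i))) (norm0 i)))

        w-inv : ∀ k y → w (h k ⁻¹ ∙ y) ≡ w y
        w-inv k = I-injective (λ y → w (h k ⁻¹ ∙ y)) w
          (λ j → trans (sym (I-act (h k) (h-Inj k) w j)) (trans (⊛-cong (act P (h k)) (λ i → sym (Nv-I i)) j) (trans (Nv-act k j) (Nv-I j))))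
          (∑-perm (h k ⁻¹) (⁻¹-Inj (h k) (h-Inj k)) w)

        w-rep : ∀ y → w (rep y) ≡ w y
        w-rep y = let (k , e) = rep-R y in trans (sym (w-inv k (rep y))) (cong w (trans (cong (h k ⁻¹ ∙_) (sym e)) (inverseˡ (h k) (h-Inj k) y)))

        -- The labelling by orbits is fixed by `H`, so at its coordinates the norm is multiplication
        -- by the order of `H`.
        Nv-ℓ : ∀ l → Nv (Ω.to (inj₂ (ℓ , l))) ≡ + K * V l
        Nv-ℓ l = trans (∑-cong (λ k → trans (Ω.perm-act (h k) (h-Inj k) v (inj₂ (ℓ , l)))
            (cong (λ ℓ → v (Ω.to (inj₂ (ℓ , l)))) (perm-ext (relabel (h k ⁻¹) ℓ) ℓ (λ y → trans (lookup-relabel (h k ⁻¹) ℓ y)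
              (trans (ℓ-rep _) (trans (cong rep (⁻¹-unique (h k ⁻¹) (⁻¹-Inj (h k) (h-Inj k)) (h k ∙_) (inverseʳ (h k) (h-Inj k)) y))
                (trans (rep-σ k y) (sym (ℓ-rep y))))))))))
          (∑-const K (V l))

        -- The invariant function `w` is constant on the classes of `ℓ`, and `S l = c l * d`, so
        -- both terms of the form are multiples of `S l`.
        I-ℓ : ∀ l → I w (Ω.to (inj₂ (ℓ , l))) ≡ S l * (w l - kk)
        I-ℓ l = begin
          I w (Ω.to (inj₂ (ℓ , l))) ≡⟨ I-to w (inj₂ (ℓ , l)) ⟩
          ∑ (λ y → (ind ⌊ lookup ℓ y ≟ l ⌋ - c l * u (lookup ℓ y)) * w y)
            ≡⟨ ∑-cong (λ y → trans (alg (ind ⌊ lookup ℓ y ≟ l ⌋) (c l) (u (lookup ℓ y)) (w y)) (cong₂ _-_ (class y (lookup ℓ y ≟ l)) (cong (λ q → c l * (u (lookup ℓ y) * q)) (w-ℓ y)))) ⟩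
          ∑ (λ y → ind ⌊ lookup ℓ y ≟ l ⌋ * w l - c l * (u (lookup ℓ y) * w (lookup ℓ y)))
            ≡⟨ ∑-− (λ y → ind ⌊ lookup ℓ y ≟ l ⌋ * w l) (λ y → c l * (u (lookup ℓ y) * w (lookup ℓ y))) ⟩
          ∑ (λ y → ind ⌊ lookup ℓ y ≟ l ⌋ * w l) - ∑ (λ y → c l * (u (lookup ℓ y) * w (lookup ℓ y)))
            ≡⟨ cong₂ _-_ (trans (∑-*ʳ (λ y → ind ⌊ lookup ℓ y ≟ l ⌋) (w l)) (cong (_* w l) (sym (lookup∘tabulate (λ l → ∑ (λ z → ind ⌊ lookup ℓ z ≟ l ⌋)) l))))
                 (trans (∑-*ˡ (c l) (λ y → u (lookup ℓ y) * w (lookup ℓ y))) (cong (c l *_) weighted)) ⟩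
          S l * w l - c l * (kk * d) ≡⟨ cong (λ q → q * w l - c l * (kk * d)) (multiple l) ⟩
          c l * d * w l - c l * (kk * d) ≡⟨ alg′ (c l) d (w l) kk ⟩
          c l * d * (w l - kk) ≡⟨ cong (_* (w l - kk)) (multiple l) ⟨
          S l * (w l - kk) ∎
          where
          open ≡-Reasoning
          alg : ∀ a b e f → (a - b * e) * f ≡ a * f - b * (e * f)
          alg = solve-∀
          alg′ : ∀ a b e f → a * b * e - a * (f * b) ≡ a * b * (e - f)
          alg′ = solve-∀
          alg″ : ∀ a b e f → a * b * (e * f) ≡ a * b * e * f
          alg″ = solve-∀
          w-ℓ : ∀ y → w y ≡ w (lookup ℓ y)
          w-ℓ y = trans (sym (w-rep y)) (cong w (sym (ℓ-rep y)))
          class : ∀ y (e : Dec (lookup ℓ y ≡ l)) → ind ⌊ e ⌋ * w y ≡ ind ⌊ e ⌋ * w l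
          class y (yes e) = cong (1ℤ *_) (trans (w-ℓ y) (cong w e))
          class y (no _)  = trans (ℤP.*-zeroˡ (w y)) (sym (ℤP.*-zeroˡ (w l)))
          weighted : ∑ (λ y → u (lookup ℓ y) * w (lookup ℓ y)) ≡ kk * d
          weighted = trans (∑-label ℓ (λ l → u l * w l)) (trans (∑-cong (λ l → trans (cong (u l * w l *_) (multiple l)) (alg″ (u l) (w l) (c l) d)))
            (∑-*ʳ (λ l → u l * w l * c l) d))

        -- Both sides agree after multiplication by the orbit size `S l`: the coordinate of the norm
        -- has been evaluated twice, and orbit size times stabiliser order is the order of `H`. The
        -- orbit size is nonzero.
        divided : ∀ y → m (rep y) y * V (rep y) ≡ w y - kk
        divided y = trans (sym (ℤP.i-j≡0⇒i≡j (w l - kk) (m l y * V l) (nonzero (ℤP.i*j≡0⇒i≡0∨j≡0 (S l) zero′)))) (cong (_- kk) (w-rep y))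
          where
          l = rep y
          alg : ∀ s a b e → s * (a - b * e) ≡ 0ℤ + (s * a - s * b * e)
          alg = solve-∀
          zero′ : S l * (w l - kk - m l y * V l) ≡ 0ℤ
          zero′ = combine₁ (trans (sym (I-ℓ l)) (trans (sym (Nv-I _)) (trans (Nv-ℓ l) (cong (_* V l) (sym (orbit-stabiliser y)))))) (alg (S l) (w l - kk) (m l y) (V l))
          nonzero : S l ≡ 0ℤ ⊎ w l - kk - m l y * V l ≡ 0ℤ → w l - kk - m l y * V l ≡ 0ℤ
          nonzero (inj₂ e) = e
          nonzero (inj₁ e) = ⊥-elim (ℕ.≢-nonZero⁻¹ K {{K≢0}} (ℤP.+-injective (trans (sym (orbit-stabiliser y)) (trans (cong (_* m l y) e) (ℤP.*-zeroˡ (m l y))))))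

        Nz-w : ∀ y → Nz y ≡ w y - kk
        Nz-w y = trans (∑-cong term) (trans (∑-*ʳ (λ k → ind ⌊ y ≟ h k ∙ rep y ⌋) (V (rep y))) (divided y))
          where
          term : ∀ k → z (h k ⁻¹ ∙ y) ≡ ind ⌊ y ≟ h k ∙ rep y ⌋ * V (rep y)
          term k = go (rep y′ ≟ y′)
            where
            y′ = h k ⁻¹ ∙ y
            hy′ : h k ∙ y′ ≡ y
            hy′ = inverseʳ (h k) (h-Inj k) y
            rep-y′ : rep y′ ≡ rep y
            rep-y′ = trans (sym (rep-σ k y′)) (cong rep hy′)
            go : (e : Dec (rep y′ ≡ y′)) → ind ⌊ e ⌋ * V y′ ≡ ind ⌊ y ≟ h k ∙ rep y ⌋ * V (rep y)
            go (yes e) = cong₂ _*_ (sym (ind-yes (y ≟ h k ∙ rep y) (trans (sym hy′) (cong (h k ∙_) (trans (sym e) rep-y′))))) (cong V (trans (sym e) rep-y′))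
            go (no ne) = trans (ℤP.*-zeroˡ (V y′)) (sym (trans (cong (_* V (rep y)) (ind-no (y ≟ h k ∙ rep y)
              (λ e → ne (trans rep-y′ (h-Inj k _ _ (trans (sym e) (sym hy′))))))) (ℤP.*-zeroˡ (V (rep y)))))

        norm-v′ : ∀ j → ∑ (λ k → push (Ω.σ (h k)) v′ j) ≡ 0ℤ
        norm-v′ j = begin
          ∑ (λ k → (act P (h k) ⊛ v′) j)
            ≡⟨ ∑-cong (λ k → trans (Linear.lin-− (⊛-linear (act P (h k))) v (I z) j) (cong (λ q → (act P (h k) ⊛ v) j - q) (I-act (h k) (h-Inj k) z j))) ⟩
          ∑ (λ k → (act P (h k) ⊛ v) j - I (λ y → z (h k ⁻¹ ∙ y)) j) ≡⟨ ∑-− (λ k → (act P (h k) ⊛ v) j) (λ k → I (λ y → z (h k ⁻¹ ∙ y)) j) ⟩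
          Nv j - ∑ (λ k → I (λ y → z (h k ⁻¹ ∙ y)) j)
            ≡⟨ cong₂ _-_ (Nv-I j) (trans (sym (Iᴸ.lin-∑ (λ k y → z (h k ⁻¹ ∙ y)) j)) (trans (Iᴸ.lin-cong Nz-w j) (I-shift w kk j))) ⟩
          I w j - I w j ≡⟨ ℤP.+-inverseʳ (I w j) ⟩
          0ℤ ∎
          where open ≡-Reasoning

        coinv = OΩ.orbit-coinvariants v′ norm-v′

      -- Subtracting `I z` changes nothing in `F` and makes the norm in `P` zero, and Ĥ⁻¹ vanishes
      -- there.
      vanishing : ∃ λ (y : Fin K → Vect (rank F)) → ∀ i → x i ≡ ∑ (λ k → (act F (h k) ⊛ y k) i - y k i)
      vanishing = (λ k → proj (y k)) , λ i → begin
        x i                                   ≡⟨ proj-section x i ⟨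
        proj v i                              ≡⟨ alg (proj v i) ⟩
        proj v i - 0ℤ                         ≡⟨ cong (λ q → proj v i - q) (proj-I z i) ⟨
        proj v i - proj (I z) i               ≡⟨ πᴸ.lin-− v (I z) i ⟨
        proj v′ i                             ≡⟨ πᴸ.lin-cong (proj₂ coinv) i ⟩
        proj (λ j → ∑ (λ k → (act P (h k) ⊛ y k) j - y k j)) i ≡⟨ πᴸ.lin-∑ (λ k j → (act P (h k) ⊛ y k) j - y k j) i ⟩
        ∑ (λ k → proj (λ j → (act P (h k) ⊛ y k) j - y k j) i)
          ≡⟨ ∑-cong (λ k → trans (πᴸ.lin-− (act P (h k) ⊛ y k) (y k) i) (cong (λ q → q - proj (y k) i) (proj-act (h k) (h-Inj k) (y k) i))) ⟩
        ∑ (λ k → (act F (h k) ⊛ proj (y k)) i - proj (y k) i) ∎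
        where
        open ≡-Reasoning
        alg : ∀ q → q ≡ q - 0ℤ
        alg = solve-∀
        y = proj₁ coinv

  F-isFlasque : IsFlasque F
  F-isFlasque H x norm0 = vanishing H x norm0

-- Splittings of multiples of F, and the case p ∤ n

module Invertibility {n : ℕ} (fm : FunctionsModConstants n) where

  open FunctionsModConstants fm
  open Resolution fm
  open Cokernel fm

  private module Iᴸ = Linear I-linear

  -- A splitting of e·F is determined on P: a map P → Q vanishing on J descends to F.
  invertible-from : ∀ {p} (Q : GSet n) → let module Q = GSet Q in
    (L : Vect Ω.size → Vect Q.size) → Linear L → (∀ f i → L (I f) i ≡ 0ℤ) →
    (∀ g → Inj g → ∀ v i → L (act P g ⊛ v) i ≡ (act Q.permLattice g ⊛ L v) i) →
    (ρ : Vect Q.size → Vect Ω′.size) → Linear ρ → (∀ g → Inj g → ∀ q k → ρ (act Q.permLattice g ⊛ q) k ≡ (act F g ⊛ ρ q) k) →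
    (e : ℕ) → ¬ p ∣ e → (∀ v k → ρ (L v) k ≡ + e * proj v k) → IntInvertible p F
  invertible-from Q L L-lin L-I L-act ρ ρ-lin ρ-act e p∤e ρL =
    Q.permLattice , Q.perm-isGLattice , Q.perm-isPermutation , ι , ρM , e , p∤e
    , (λ g ag → ⊛⇒≈M {M = ι · act F g} {N = act Q.permLattice g · ι} (λ f i → begin
        ((ι · act F g) ⊛ f) i                     ≡⟨ ·-⊛ ι (act F g) f i ⟩
        (ι ⊛ (act F g ⊛ f)) i                     ≡⟨ ι-⊛ (act F g ⊛ f) i ⟩
        L (section (act F g ⊛ f)) i               ≡⟨ L.lin-cong (Linear.lin-cong section-linear (F-act g f)) i ⟩
        L (section (proj (act P g ⊛ section f))) i ≡⟨ L-proj (act P g ⊛ section f) i ⟨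
        L (act P g ⊛ section f) i                 ≡⟨ L-act g (InA⇒Inj g ag) (section f) i ⟩
        (act Q.permLattice g ⊛ L (section f)) i   ≡⟨ ⊛-cong (act Q.permLattice g) (ι-⊛ f) i ⟨
        (act Q.permLattice g ⊛ (ι ⊛ f)) i         ≡⟨ ·-⊛ (act Q.permLattice g) ι f i ⟨
        ((act Q.permLattice g · ι) ⊛ f) i ∎))
    , (λ g ag → ⊛⇒≈M {M = ρM · act Q.permLattice g} {N = act F g · ρM} (λ q k → begin
        ((ρM · act Q.permLattice g) ⊛ q) k        ≡⟨ ·-⊛ ρM (act Q.permLattice g) q k ⟩
        (ρM ⊛ (act Q.permLattice g ⊛ q)) k        ≡⟨ ρ-⊛ (act Q.permLattice g ⊛ q) k ⟩
        ρ (act Q.permLattice g ⊛ q) k             ≡⟨ ρ-act g (InA⇒Inj g ag) q k ⟩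
        (act F g ⊛ ρ q) k                         ≡⟨ ⊛-cong (act F g) (ρ-⊛ q) k ⟨
        (act F g ⊛ (ρM ⊛ q)) k                    ≡⟨ ·-⊛ (act F g) ρM q k ⟨
        ((act F g · ρM) ⊛ q) k ∎))
    , ⊛⇒≈M {M = ρM · ι} {N = λ i j → + e * 1M i j} (λ f k → begin
        ((ρM · ι) ⊛ f) k                          ≡⟨ ·-⊛ ρM ι f k ⟩
        (ρM ⊛ (ι ⊛ f)) k                          ≡⟨ trans (ρ-⊛ (ι ⊛ f) k) (Linear.lin-cong ρ-lin (ι-⊛ f) k) ⟩
        ρ (L (section f)) k                       ≡⟨ ρL (section f) k ⟩
        + e * proj (section f) k                  ≡⟨ cong (+ e *_) (trans (proj-section f k) (sym (1M-⊛ f k))) ⟩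
        + e * ∑ (λ j → 1M k j * f j)              ≡⟨ ∑-*ˡ (+ e) (λ j → 1M k j * f j) ⟨
        ∑ (λ j → + e * (1M k j * f j))            ≡⟨ ∑-cong (λ j → ℤP.*-assoc (+ e) (1M k j) (f j)) ⟨
        ∑ (λ j → + e * 1M k j * f j) ∎)
    where
    open ≡-Reasoning
    module Q = GSet Q
    module L = Linear L-lin
    ι-lin : Linear (L ∘ section)
    ι-lin = ∘-linear L-lin section-linear
    ι : Mat Q.size Ω′.size
    ι = matrix (L ∘ section) ι-lin
    ι-⊛ = matrix-⊛ (L ∘ section) ι-lin
    ρM : Mat Ω′.size Q.size
    ρM = matrix ρ ρ-lin
    ρ-⊛ = matrix-⊛ ρ ρ-lin
    L-proj : ∀ v i → L v i ≡ L (section (proj v)) i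
    L-proj v i = trans (L.lin-cong (decompose v) i) (trans (L.lin-+ (section (proj v)) (I (lift v)) i)
      (trans (cong (_+_ (L (section (proj v)) i)) (L-I (lift v) i)) (ℤP.+-identityʳ _)))

  -- Applied to the differences `f x - f y`, `row` returns n f minus a constant. So `I ∘ row` is
  -- multiplication by n on the image of `J`, and n minus it vanishes there while inducing n on `F`.
  invertible-p∤n : ∀ {p} → ¬ p ∣ n → IntInvertible p F
  invertible-p∤n p∤n = invertible-from Ω L L-lin L-I L-act proj proj-linear proj-act n p∤n
    (λ v k → trans (πᴸ.lin-− (λ j → + n * v j) (I (row v)) k) (trans (cong₂ _-_ (πᴸ.lin-* (+ n) v k) (proj-I (row v) k)) (ℤP.+-identityʳ _)))
    where
    row : Vect Ω.size → Fin n → ℤ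
    row v x = ∑ (λ y → v (Ω.to (inj₁ (x , y))))
    row-lin : Linear row
    row-lin = record
      { lin-cong = λ e x → ∑-cong (λ y → e (Ω.to (inj₁ (x , y))))
      ; lin-+ = λ u v x → ∑-+ (λ y → u (Ω.to (inj₁ (x , y)))) (λ y → v (Ω.to (inj₁ (x , y))))
      ; lin-* = λ c v x → ∑-*ˡ c (λ y → v (Ω.to (inj₁ (x , y))))
      }
    module IR = Linear (∘-linear I-linear row-lin)
    L : Vect Ω.size → Vect Ω.size
    L v j = + n * v j - I (row v) j
    L-lin : Linear L
    L-lin = record
      { lin-cong = λ e j → cong₂ (λ a b → + n * a - b) (e j) (IR.lin-cong e j)
      ; lin-+ = λ u v j → trans (cong (λ q → + n * (u j + v j) - q) (IR.lin-+ u v j)) (alg (+ n) (u j) (v j) (I (row u) j) (I (row v) j))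
      ; lin-* = λ c v j → trans (cong (λ q → + n * (c * v j) - q) (IR.lin-* c v j)) (alg′ (+ n) c (v j) (I (row v) j))
      }
      where
      alg : ∀ n u v a b → n * (u + v) - (a + b) ≡ n * u - a + (n * v - b)
      alg = solve-∀
      alg′ : ∀ n c v a → n * (c * v) - c * a ≡ c * (n * v - a)
      alg′ = solve-∀
    L-I : ∀ f j → L (I f) j ≡ 0ℤ
    L-I f j = trans (cong (λ q → + n * I f j - q) (trans (Iᴸ.lin-cong row-I j) (trans (I-shift (λ x → + n * f x) (∑ f) j) (Iᴸ.lin-* (+ n) f j)))) (ℤP.+-inverseʳ (+ n * I f j))
      where
      row-I : ∀ x → row (I f) x ≡ + n * f x - ∑ f
      row-I x = trans (∑-cong (λ y → I-pair f x y)) (trans (∑-− (λ _ → f x) f) (cong (_- ∑ f) (∑-const n (f x))))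
    L-act : ∀ g → Inj g → ∀ v j → L (act P g ⊛ v) j ≡ (act P g ⊛ L v) j
    L-act g ig v j = sym (trans (Linear.lin-− (⊛-linear (act P g)) (λ j → + n * v j) (I (row v)) j)
      (cong₂ _-_ (Linear.lin-* (⊛-linear (act P g)) (+ n) v j) (trans (I-act g ig (row v) j) (Iᴸ.lin-cong row-act j))))
      where
      row-act : ∀ x → row v (g ⁻¹ ∙ x) ≡ row (act P g ⊛ v) x
      row-act x = trans (sym (∑-perm (g ⁻¹) (⁻¹-Inj g ig) (λ y → v (Ω.to (inj₁ (g ⁻¹ ∙ x , y))))))
        (∑-cong (λ y → sym (Ω.perm-act g ig v (inj₁ (x , y)))))

-- Splitting F along full cycles

maxUpTo : ℕ → (ℕ → ℤ) → ℤ
maxUpTo zero    f = f 0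
maxUpTo (suc m) f = maxUpTo m f ⊔ f (suc m)

maxUpTo-cong : ∀ m {f g : ℕ → ℤ} → (∀ k → f k ≡ g k) → maxUpTo m f ≡ maxUpTo m g
maxUpTo-cong zero    e = e 0
maxUpTo-cong (suc m) e = cong₂ _⊔_ (maxUpTo-cong m e) (e (suc m))

maxUpTo-+ : ∀ m f c → maxUpTo m (λ k → f k + c) ≡ maxUpTo m f + c
maxUpTo-+ zero    f c = refl
maxUpTo-+ (suc m) f c = trans (cong (_⊔ (f (suc m) + c)) (maxUpTo-+ m f c))
  (sym (ℤP.mono-≤-distrib-⊔ {f = λ x → x + c} (ℤP.+-monoˡ-≤ c) (maxUpTo m f) (f (suc m))))

maxUpTo-first : ∀ m f → f 0 ℤ.≤ maxUpTo m f
maxUpTo-first zero    f = ℤP.≤-refl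
maxUpTo-first (suc m) f = ℤP.≤-trans (maxUpTo-first m f) (ℤP.i≤i⊔j (maxUpTo m f) (f (suc m)))

maxUpTo-last : ∀ m f → f m ℤ.≤ maxUpTo m f
maxUpTo-last zero    f = ℤP.≤-refl
maxUpTo-last (suc m) f = ℤP.i≤j⊔i (maxUpTo m f) (f (suc m))

maxUpTo-suc : ∀ m f → f 0 ⊔ maxUpTo m (f ∘ suc) ≡ maxUpTo (suc m) f
maxUpTo-suc zero    f = refl
maxUpTo-suc (suc m) f = trans (sym (ℤP.⊔-assoc (f 0) (maxUpTo m (f ∘ suc)) (f (suc (suc m))))) (cong (_⊔ f (suc (suc m))) (maxUpTo-suc m f))

-- The value `f (suc m)` entering the window equals the value `f 0` leaving it.
maxUpTo-shift : ∀ m f → f (suc m) ≡ f 0 → maxUpTo m (f ∘ suc) ≡ maxUpTo m f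
maxUpTo-shift m f e = begin
  maxUpTo m (f ∘ suc)          ≡⟨ ℤP.i≤j⇒i⊔j≡j (subst (ℤ._≤ maxUpTo m (f ∘ suc)) e (maxUpTo-last m (f ∘ suc))) ⟨
  f 0 ⊔ maxUpTo m (f ∘ suc)    ≡⟨ maxUpTo-suc m f ⟩
  maxUpTo m f ⊔ f (suc m)      ≡⟨ cong (maxUpTo m f ⊔_) e ⟩
  maxUpTo m f ⊔ f 0            ≡⟨ ℤP.i≥j⇒i⊔j≡i (maxUpTo-first m f) ⟩
  maxUpTo m f ∎
  where open ≡-Reasoning

module _ {n : ℕ} (f : Fin n → Fin n) (hits : ∀ y → ∃ λ x → f x ≡ y) where

  private
    pre : Fin n → Fin n
    pre y = proj₁ (hits y)
    pre-injective : ∀ x y → pre x ≡ pre y → x ≡ y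
    pre-injective x y e = trans (sym (proj₂ (hits x))) (trans (cong f e) (proj₂ (hits y)))

  -- The chosen preimages form an injective, hence bijective, self-map, whose inverse is `f`.
  surjective⇒injective : ∀ x y → f x ≡ f y → x ≡ y
  surjective⇒injective x y e with injective⇒hits pre pre-injective x | injective⇒hits pre pre-injective y
  ... | x′ , refl | y′ , refl = cong pre (trans (sym (proj₂ (hits x′))) (trans e (proj₂ (hits y′))))

  ∑-surjective : (w : Fin n → ℤ) → ∑ (w ∘ f) ≡ ∑ w
  ∑-surjective = ∑-injective f surjective⇒injective

pointᴳ : ∀ n → GSet n
pointᴳ n = record { set = finSet 1 ; _▹_ = λ _ x → x ; ▹-id = λ _ → refl ; ▹-∘ = λ _ _ _ _ _ → refl }

_⊎ᴳ_ _×ᴳ_ : ∀ {n} → GSet n → GSet n → GSet n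
A ⊎ᴳ B = record
  { set = A.set ⊎ᶠ B.set
  ; _▹_ = λ g → Sum.map (g A.▹_) (g B.▹_)
  ; ▹-id = λ { (inj₁ x) → cong inj₁ (A.▹-id x) ; (inj₂ x) → cong inj₂ (B.▹-id x) }
  ; ▹-∘ = λ { g h ig ih (inj₁ x) → cong inj₁ (A.▹-∘ g h ig ih x) ; g h ig ih (inj₂ x) → cong inj₂ (B.▹-∘ g h ig ih x) }
  }
  where
  module A = GSet A
  module B = GSet B
A ×ᴳ B = record
  { set = A.set ×ᶠ B.set
  ; _▹_ = λ { g (x , y) → g A.▹ x , g B.▹ y }
  ; ▹-id = λ { (x , y) → cong₂ _,_ (A.▹-id x) (B.▹-id y) }
  ; ▹-∘ = λ { g h ig ih (x , y) → cong₂ _,_ (A.▹-∘ g h ig ih x) (B.▹-∘ g h ig ih y) }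
  }
  where
  module A = GSet A
  module B = GSet B

-- An n-cycle, described by transitivity of its powers. Bounding the exponents makes this decidable.
Full : ∀ {n} → (Fin n → Fin n) → Set
Full {n} c = ∀ x y → ∃ λ (k : Fin n) → iter c (toℕ k) x ≡ y

Full-hits : ∀ {n} {c : Fin n → Fin n} → Full c → ∀ y → ∃ λ x → c x ≡ y
Full-hits {c = c} full y = let (k , e) = full (c y) y in iter c (toℕ k) y , trans (iter-suc c (toℕ k) y) e

full? : ∀ {n} (c : Fin n → Fin n) → Dec (Full c)
full? {n} c = FinP.all? (λ x → FinP.all? (λ y → FinP.any? (λ (k : Fin n) → iter c (toℕ k) x ≟ y)))

abstract
  isFull : ∀ {n} → Perm n → Bool
  isFull c = ⌊ full? (c ∙_) ⌋

  isFull⇒Full : ∀ {n} (c : Perm n) → T (isFull c) → Full (c ∙_)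
  isFull⇒Full c = T-⌊⌋ (full? (c ∙_))

  Full⇒isFull : ∀ {n} (c : Perm n) → Full (c ∙_) → T (isFull c)
  Full⇒isFull c = ⌊⌋-T (full? (c ∙_))

module FullCycles (n : ℕ) where

  cycles : FinSet
  cycles = subset (tables n n) isFull

  open FinSet cycles using () renaming (Carrier to Y)

  Y-≡ : ∀ {c c′ : Y} → (∀ x → proj₁ c ∙ x ≡ proj₁ c′ ∙ x) → c ≡ c′
  Y-≡ {c , t} {c′ , t′} e = go (perm-ext c c′ e) t t′
    where
    go : ∀ {c c′ : Perm n} → c ≡ c′ → (t : T (isFull c)) (t′ : T (isFull c′)) → _≡_ {A = Y} (c , t) (c′ , t′)
    go {c} refl t t′ = cong (c ,_) (T-irrelevant t t′)

  conjugate : (g : Perm n) → Inj g → Perm n → Perm n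
  conjugate g _ c = tabulate (λ x → g ∙ c ∙ g ⁻¹ ∙ x)

  conjugate-∙ : ∀ g ig c x → conjugate g ig c ∙ x ≡ g ∙ c ∙ g ⁻¹ ∙ x
  conjugate-∙ g ig c x = lookup∘tabulate (λ x → g ∙ c ∙ g ⁻¹ ∙ x) x

  conjugate-full : ∀ g (ig : Inj g) c → T (isFull c) → T (isFull (conjugate g ig c))
  conjugate-full g ig c t = Full⇒isFull (conjugate g ig c) (λ x y →
    let (k , e) = isFull⇒Full c t (g ⁻¹ ∙ x) (g ⁻¹ ∙ y) in
    k , trans (cong (iter (conjugate g ig c ∙_) (toℕ k)) (sym (inverseʳ g ig x)))
      (trans (sym (iter-map (g ∙_) {c ∙_} {conjugate g ig c ∙_}
          (λ z → sym (trans (conjugate-∙ g ig c (g ∙ z)) (cong (λ q → g ∙ c ∙ q) (inverseˡ g ig z)))) (toℕ k) (g ⁻¹ ∙ x)))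
        (trans (cong (g ∙_) e) (inverseʳ g ig y))))

  -- The action of a table that is not a permutation is irrelevant.
  private
    act′ : (g : Perm n) → Dec (T (isBijective g)) → Y → Y
    act′ g (yes b) (c , t) = conjugate g (isBijective⇒Inj g b) c , conjugate-full g (isBijective⇒Inj g b) c t
    act′ g (no _)  c       = c

    act-∙ : ∀ g → Inj g → (d : Dec (T (isBijective g))) → ∀ c x → proj₁ (act′ g d c) ∙ x ≡ g ∙ proj₁ c ∙ g ⁻¹ ∙ x
    act-∙ g ig (yes b) (c , t) x = conjugate-∙ g (isBijective⇒Inj g b) c x
    act-∙ g ig (no ¬b) c x = ⊥-elim (¬b (Inj⇒isBijective g ig))

  _▹Y_ : Perm n → Y → Y
  g ▹Y c = act′ g (T? (isBijective g)) c

  ▹Y-∙ : ∀ g → Inj g → ∀ c x → proj₁ (g ▹Y c) ∙ x ≡ g ∙ proj₁ c ∙ g ⁻¹ ∙ x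
  ▹Y-∙ g ig = act-∙ g ig (T? (isBijective g))

  cyclesᴳ : GSet n
  cyclesᴳ = record
    { set = cycles
    ; _▹_ = _▹Y_
    ; ▹-id = λ c → Y-≡ (λ x → trans (▹Y-∙ idP idP-Inj c x) (trans (idP-∙ _) (cong (proj₁ c ∙_) (idP⁻¹ x))))
    ; ▹-∘ = λ g h ig ih c → Y-≡ (λ x → trans (▹Y-∙ (g ∘P h) (∘P-Inj g h ig ih) c x) (trans (∘P-∙ g h _)
        (sym (trans (▹Y-∙ g ig (h ▹Y c) x) (cong (g ∙_) (trans (▹Y-∙ h ih c _) (cong (λ q → h ∙ proj₁ c ∙ q) (sym (∘P-⁻¹ g h ig ih x)))))))))
    }

module CyclicSplitting {m : ℕ} (fm : FunctionsModConstants (suc m)) where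

  private
    n : ℕ
    n = suc m

  open FunctionsModConstants fm
  open Resolution fm
  open Cokernel fm
  open Invertibility fm
  open FullCycles n

  private module Iᴸ = Linear I-linear

  partial : (Fin n → Fin n) → ΩC → Fin n → ℕ → ℤ
  partial c ω x zero    = 0ℤ
  partial c ω x (suc k) = partial c ω x k - ψ ω (iter c (suc k) x)

  -- The antiderivative of ψ ω along the cycle c with minimum zero.  Being canonical, it is
  -- natural in c and ω.
  Ψ : (Fin n → Fin n) → ΩC → Fin n → ℤ
  Ψ c ω x = maxUpTo m (partial c ω x)

  module _ (c : Fin n → Fin n) (full : Full c) where

    partial-shift : ∀ ω x k → partial c ω (c x) k ≡ partial c ω x (suc k) + ψ ω (c x)
    partial-shift ω x zero    = alg (ψ ω (c x))
      where
      alg : ∀ z → 0ℤ ≡ 0ℤ - z + z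
      alg = solve-∀
    partial-shift ω x (suc k) = trans (cong₂ (λ a b → a - ψ ω b) (partial-shift ω x k) (sym (iter-suc c (suc k) x)))
      (alg (partial c ω x (suc k)) (ψ ω (c x)) (ψ ω (iter c (suc (suc k)) x)))
      where
      alg : ∀ a b d → a + b - d ≡ a - d + b
      alg = solve-∀

    partial-∑ : ∀ ω x k → partial c ω x k ≡ - ∑ {k} (λ i → ψ ω (iter c (suc (toℕ i)) x))
    partial-∑ ω x zero    = refl
    partial-∑ ω x (suc k) = trans (cong (_- ψ ω (iter c (suc k) x)) (partial-∑ ω x k))
      (trans (alg (∑ {k} (λ i → ψ ω (iter c (suc (toℕ i)) x))) (ψ ω (iter c (suc k) x))) (cong -_ (sym (∑-last k (λ i → ψ ω (iter c (suc i) x))))))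
      where
      alg : ∀ a b → - a - b ≡ - (a + b)
      alg = solve-∀

    -- After a full turn `ψ ω` has been summed over all letters, and this sum is zero.
    partial-period : ∀ ω x → partial c ω x n ≡ 0ℤ
    partial-period ω x = trans (partial-∑ ω x n) (cong -_ (trans (∑-surjective (λ i → iter c (suc (toℕ i)) x)
      (λ y → let (k , e) = full (c x) y in k , trans (iter-suc c (toℕ k) x) e) (ψ ω)) (∑-ψ ω)))

    Ψ-c : ∀ ω x → Ψ c ω (c x) ≡ Ψ c ω x + ψ ω (c x)
    Ψ-c ω x = trans (maxUpTo-cong m (partial-shift ω x)) (trans (maxUpTo-+ m (partial c ω x ∘ suc) (ψ ω (c x)))
      (cong (λ q → q + ψ ω (c x)) (maxUpTo-shift m (partial c ω x) (partial-period ω x))))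

    -- `α` and `β` are the maps P → ℤ[X] → P. Here ℤ[X] contains `J` through f - f ∘ c, the quotient
    -- map being the sum over all letters.
    α : Vect Ω.size → Fin n → ℤ
    α v x = v (Ω.to (inj₁ (x , c x)))

    β : (Fin n → ℤ) → Vect Ω.size
    β f i = ∑ (λ x → Ψ c (Ω.from i) x * f x)

    β-linear : Linear β
    β-linear = ⊛-linear (λ i x → Ψ c (Ω.from i) x)

    α-linear : Linear α
    α-linear = record { lin-cong = λ e x → e (Ω.to (inj₁ (x , c x))) ; lin-+ = λ _ _ _ → refl ; lin-* = λ _ _ _ → refl }

    α-I : ∀ f x → α (I f) x ≡ f x - f (c x)
    α-I f x = I-pair f x (c x)

    -- Summation by parts along the cycle moves the difference from `f` to `Ψ`, whose difference is
    -- `ψ`. So `β ∘ α` is the identity on the image of `J`.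
    β-difference : ∀ f i → β (λ x → f x - f (c x)) i ≡ I f i
    β-difference f i = begin
      ∑ (λ x → Ψ c ω x * (f x - f (c x)))   ≡⟨ ∑-cong (λ x → alg (Ψ c ω x) (f x) (f (c x))) ⟩
      ∑ (λ x → Ψ c ω x * f x - Ψ c ω x * f (c x)) ≡⟨ ∑-− (λ x → Ψ c ω x * f x) (λ x → Ψ c ω x * f (c x)) ⟩
      ∑ (λ x → Ψ c ω x * f x) - ∑ (λ x → Ψ c ω x * f (c x))
        ≡⟨ cong (_- ∑ (λ x → Ψ c ω x * f (c x))) (∑-surjective c (Full-hits full) (λ x → Ψ c ω x * f x)) ⟨
      ∑ (λ x → Ψ c ω (c x) * f (c x)) - ∑ (λ x → Ψ c ω x * f (c x)) ≡⟨ ∑-− (λ x → Ψ c ω (c x) * f (c x)) (λ x → Ψ c ω x * f (c x)) ⟨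
      ∑ (λ x → Ψ c ω (c x) * f (c x) - Ψ c ω x * f (c x))
        ≡⟨ ∑-cong (λ x → trans (cong (λ q → q * f (c x) - Ψ c ω x * f (c x)) (Ψ-c ω x)) (alg′ (Ψ c ω x) (ψ ω (c x)) (f (c x)))) ⟩
      ∑ (λ x → ψ ω (c x) * f (c x))         ≡⟨ ∑-surjective c (Full-hits full) (λ x → ψ ω x * f x) ⟩
      I f i ∎
      where
      open ≡-Reasoning
      ω = Ω.from i
      alg : ∀ a b d → a * (b - d) ≡ a * b - a * d
      alg = solve-∀
      alg′ : ∀ a b d → (a + b) * d - a * d ≡ b * d
      alg′ = solve-∀

    private
      δ : Fin n → Fin n → ℤ
      δ x y = ind ⌊ x ≟ y ⌋

      module πβ = Linear (∘-linear proj-linear β-linear)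

    -- `proj ∘ β` kills all f - f ∘ c, hence factors through the sum of the values; `γ` is its value
    -- at sum 1.
    γ : Vect Ω′.size
    γ = proj (β (δ a))

    private
      γ-step : ∀ x k → proj (β (δ (c x))) k ≡ proj (β (δ x)) k
      γ-step x k = ℤP.i-j≡0⇒i≡j _ _ (trans (sym (πβ.lin-− (δ (c x)) (δ x) k)) (trans
        (πβ.lin-cong (λ y → cong (λ q → δ (c x) y - q) (ind-⇔ (x ≟ y) (c x ≟ c y) (cong c) (surjective⇒injective c (Full-hits full) x y))) k)
        (trans (πᴸ.lin-cong (β-difference (δ (c x))) k) (proj-I (δ (c x)) k))))

      γ-iter : ∀ l x k → proj (β (δ (iter c l x))) k ≡ proj (β (δ x)) k
      γ-iter zero    x k = refl
      γ-iter (suc l) x k = trans (γ-step (iter c l x) k) (γ-iter l x k)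

    proj-β : ∀ f k → proj (β f) k ≡ ∑ f * γ k
    proj-β f k = begin
      proj (β f) k                              ≡⟨ πβ.lin-cong (λ y → sym (∑-δʳ y f)) k ⟩
      proj (β (λ y → ∑ (λ x → f x * δ x y))) k  ≡⟨ πβ.lin-∑ (λ x y → f x * δ x y) k ⟩
      ∑ (λ x → proj (β (λ y → f x * δ x y)) k)  ≡⟨ ∑-cong (λ x → trans (πβ.lin-* (f x) (δ x) k) (cong (f x *_) (trans (cong (λ z → proj (β (δ z)) k) (sym (proj₂ (full a x)))) (γ-iter (toℕ (proj₁ (full a x))) a k)))) ⟩
      ∑ (λ x → f x * γ k)                       ≡⟨ ∑-*ʳ f (γ k) ⟩
      ∑ f * γ k ∎
      where open ≡-Reasoning

  -- Naturality: c′ is the conjugate of c by g⁻¹.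
  module _ (g : Perm n) (ig : Inj g) (c c′ : Fin n → Fin n) (conj : ∀ y → g ∙ c′ y ≡ c (g ∙ y)) where

    Ψ-natural : ∀ ω y → Ψ c ω (g ∙ y) ≡ Ψ c′ (g ⁻¹ ▹Ω ω) y
    Ψ-natural ω y = maxUpTo-cong m partial-natural
      where
      partial-natural : ∀ k → partial c ω (g ∙ y) k ≡ partial c′ (g ⁻¹ ▹Ω ω) y k
      partial-natural zero    = refl
      partial-natural (suc k) = cong₂ _-_ (partial-natural k) (begin
        ψ ω (iter c (suc k) (g ∙ y))        ≡⟨ cong (ψ ω) (sym (iter-map (g ∙_) {c′} {c} conj (suc k) y)) ⟩
        ψ ω (g ∙ iter c′ (suc k) y)         ≡⟨ ψ-▹ (g ⁻¹) (⁻¹-Inj g ig) ω (g ∙ iter c′ (suc k) y) ⟨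
        ψ (g ⁻¹ ▹Ω ω) (g ⁻¹ ∙ g ∙ iter c′ (suc k) y) ≡⟨ cong (ψ (g ⁻¹ ▹Ω ω)) (inverseˡ g ig _) ⟩
        ψ (g ⁻¹ ▹Ω ω) (iter c′ (suc k) y) ∎)
        where open ≡-Reasoning

    β-natural : ∀ (full : Full c) (full′ : Full c′) f ω → β c full f (Ω.to ω) ≡ β c′ full′ (λ y → f (g ∙ y)) (Ω.to (g ⁻¹ ▹Ω ω))
    β-natural full full′ f ω = trans (cong (λ ω → ∑ (λ x → Ψ c ω x * f x)) (Ω.from-to ω))
      (trans (sym (∑-perm g ig (λ x → Ψ c ω x * f x))) (trans (∑-cong (λ y → cong (_* f (g ∙ y)) (Ψ-natural ω y)))
        (cong (λ ω → ∑ (λ y → Ψ c′ ω y * f (g ∙ y))) (sym (Ω.from-to (g ⁻¹ ▹Ω ω))))))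

  -- One copy of P ⊕ ℤ for every full cycle. Conjugation permutes the copies and carries the
  -- splitting attached to a cycle to that attached to its conjugate.
  Qᴳ : GSet n
  Qᴳ = cyclesᴳ ×ᴳ (Ω ⊎ᴳ pointᴳ n)

  private
    module Y = GSet cyclesᴳ
    module Q = GSet Qᴳ

    fn : Y.Carrier → Fin n → Fin n
    fn y x = proj₁ y ∙ x

    fl : ∀ y → Full (fn y)
    fl y = isFull⇒Full (proj₁ y) (proj₂ y)

    conj⁻¹ : ∀ g → Inj g → ∀ y z → g ∙ fn (g ⁻¹ Y.▹ y) z ≡ fn y (g ∙ z)
    conj⁻¹ g ig y z = trans (cong (g ∙_) (▹Y-∙ (g ⁻¹) (⁻¹-Inj g ig) y z)) (trans (inverseʳ g ig _)
      (cong (fn y) (⁻¹-unique (g ⁻¹) (⁻¹-Inj g ig) (g ∙_) (inverseʳ g ig) z)))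

    rest : Y.Carrier → Vect Ω.size → Vect Ω.size
    rest y v j = v j - β (fn y) (fl y) (α (fn y) (fl y) v) j

    rest-linear : ∀ y → Linear (rest y)
    rest-linear y = record
      { lin-cong = λ e j → cong₂ _-_ (e j) (βα.lin-cong e j)
      ; lin-+ = λ u v j → trans (cong (λ q → u j + v j - q) (βα.lin-+ u v j)) (alg (u j) (v j) (βα u j) (βα v j))
      ; lin-* = λ c v j → trans (cong (λ q → c * v j - q) (βα.lin-* c v j)) (alg′ c (v j) (βα v j))
      }
      where
      βα : Vect Ω.size → Vect Ω.size
      βα v = β (fn y) (fl y) (α (fn y) (fl y) v)
      module βα = Linear (∘-linear (β-linear (fn y) (fl y)) (α-linear (fn y) (fl y)))
      alg : ∀ u v a b → u + v - (a + b) ≡ u - a + (v - b)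
      alg = solve-∀
      alg′ : ∀ c v a → c * v - c * a ≡ c * (v - a)
      alg′ = solve-∀

    total : Y.Carrier → Vect Ω.size → ℤ
    total y v = ∑ (α (fn y) (fl y) v)

    L′ : Q.Carrier → Vect Ω.size → ℤ
    L′ (y , inj₁ ω) v = rest y v (Ω.to ω)
    L′ (y , inj₂ _) v = total y v

    L : Vect Ω.size → Vect Q.size
    L v i = L′ (Q.from i) v

    L-linear : Linear L
    L-linear = record
      { lin-cong = λ e i → cong′ (Q.from i) e
      ; lin-+ = λ u v i → add (Q.from i) u v
      ; lin-* = λ c v i → mul (Q.from i) c v
      }
      where
      cong′ : ∀ q {u v} → (∀ j → u j ≡ v j) → L′ q u ≡ L′ q v
      cong′ (y , inj₁ ω) e = Linear.lin-cong (rest-linear y) e (Ω.to ω)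
      cong′ (y , inj₂ _) e = ∑-cong (λ x → e (Ω.to (inj₁ (x , fn y x))))
      add : ∀ q u v → L′ q (λ j → u j + v j) ≡ L′ q u + L′ q v
      add (y , inj₁ ω) u v = Linear.lin-+ (rest-linear y) u v (Ω.to ω)
      add (y , inj₂ _) u v = ∑-+ (α (fn y) (fl y) u) (α (fn y) (fl y) v)
      mul : ∀ q c v → L′ q (λ j → c * v j) ≡ c * L′ q v
      mul (y , inj₁ ω) c v = Linear.lin-* (rest-linear y) c v (Ω.to ω)
      mul (y , inj₂ _) c v = ∑-*ˡ c (α (fn y) (fl y) v)

    L-I : ∀ f i → L (I f) i ≡ 0ℤ
    L-I f i = go (Q.from i)
      where
      go : ∀ q → L′ q (I f) ≡ 0ℤ
      go (y , inj₁ ω) = trans (cong (λ q → I f (Ω.to ω) - q) (trans (Linear.lin-cong (β-linear (fn y) (fl y)) (α-I (fn y) (fl y) f) (Ω.to ω))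
        (β-difference (fn y) (fl y) f (Ω.to ω)))) (ℤP.+-inverseʳ (I f (Ω.to ω)))
      go (y , inj₂ _) = trans (∑-cong (α-I (fn y) (fl y) f)) (trans (∑-− f (f ∘ fn y))
        (trans (cong (λ q → ∑ f - q) (∑-surjective (fn y) (Full-hits (fl y)) f)) (ℤP.+-inverseʳ (∑ f))))

    α-act : ∀ g (ig : Inj g) y v x → α (fn y) (fl y) (act P g ⊛ v) (g ∙ x) ≡ α (fn (g ⁻¹ Y.▹ y)) (fl (g ⁻¹ Y.▹ y)) v x
    α-act g ig y v x = trans (Ω.perm-act g ig v (inj₁ (g ∙ x , fn y (g ∙ x))))
      (cong₂ (λ s t → v (Ω.to (inj₁ (s , t)))) (inverseˡ g ig x) (trans (cong (g ⁻¹ ∙_) (sym (conj⁻¹ g ig y x))) (inverseˡ g ig _)))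

    L-act : ∀ g → Inj g → ∀ v i → L (act P g ⊛ v) i ≡ (act Q.permLattice g ⊛ L v) i
    L-act g ig v i = trans (go (Q.from i)) (sym (trans (cong (act Q.permLattice g ⊛ L v) (sym (Q.to-from i)))
      (trans (Q.perm-act g ig (L v) (Q.from i)) (cong (λ q → L′ q v) (Q.from-to (g ⁻¹ Q.▹ Q.from i))))))
      where
      go : ∀ q → L′ q (act P g ⊛ v) ≡ L′ (g ⁻¹ Q.▹ q) v
      go (y , inj₁ ω) = cong₂ _-_ (Ω.perm-act g ig v ω)
        (trans (β-natural g ig (fn y) (fn (g ⁻¹ Y.▹ y)) (conj⁻¹ g ig y) (fl y) (fl (g ⁻¹ Y.▹ y)) (α (fn y) (fl y) (act P g ⊛ v)) ω)
          (Linear.lin-cong (β-linear (fn (g ⁻¹ Y.▹ y)) (fl (g ⁻¹ Y.▹ y))) (α-act g ig y v) (Ω.to (g ⁻¹ ▹Ω ω))))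
      go (y , inj₂ _) = trans (sym (∑-perm g ig (α (fn y) (fl y) (act P g ⊛ v)))) (∑-cong (α-act g ig y v))

    slice : Vect Q.size → Y.Carrier → Vect Ω.size
    slice q y j = q (Q.to (y , inj₁ (Ω.from j)))

    tip : Vect Q.size → Y.Carrier → ℤ
    tip q y = q (Q.to (y , inj₂ 0F))

    γY : Y.Carrier → Vect Ω′.size
    γY y = γ (fn y) (fl y)

    term : Vect Q.size → Y.Carrier → Vect Ω′.size
    term q y k = proj (slice q y) k + tip q y * γY y k

    ρ : Vect Q.size → Vect Ω′.size
    ρ q k = ∑ (λ i → term q (Y.from i) k)

    ρ-linear : Linear ρ
    ρ-linear = record
      { lin-cong = λ e k → ∑-cong (λ i → cong₂ (λ a b → a + b * γY (Y.from i) k) (πᴸ.lin-cong (λ j → e (Q.to (Y.from i , inj₁ (Ω.from j)))) k) (e (Q.to (Y.from i , inj₂ 0F))))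
      ; lin-+ = λ u v k → trans (∑-cong (λ i → trans (cong (λ a → a + tip (λ j → u j + v j) (Y.from i) * γY (Y.from i) k) (πᴸ.lin-+ (slice u (Y.from i)) (slice v (Y.from i)) k))
            (alg (proj (slice u (Y.from i)) k) (proj (slice v (Y.from i)) k) (tip u (Y.from i)) (tip v (Y.from i)) (γY (Y.from i) k))))
          (∑-+ (λ i → term u (Y.from i) k) (λ i → term v (Y.from i) k))
      ; lin-* = λ c v k → trans (∑-cong (λ i → trans (cong (λ a → a + tip (λ j → c * v j) (Y.from i) * γY (Y.from i) k) (πᴸ.lin-* c (slice v (Y.from i)) k))
            (alg′ c (proj (slice v (Y.from i)) k) (tip v (Y.from i)) (γY (Y.from i) k))))
          (∑-*ˡ c (λ i → term v (Y.from i) k))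
      }
      where
      alg : ∀ a b s t g → a + b + (s + t) * g ≡ a + s * g + (b + t * g)
      alg = solve-∀
      alg′ : ∀ c a s g → c * a + c * s * g ≡ c * (a + s * g)
      alg′ = solve-∀

    -- The base letter `a` may be moved by g, but a delta function at any letter has sum 1 and
    -- therefore gives the same `γ`.
    γ-act : ∀ g → Inj g → ∀ y k → γY y k ≡ (act F g ⊛ γY (g ⁻¹ Y.▹ y)) k
    γ-act g ig y k = begin
      γY y k                                        ≡⟨ ℤP.*-identityˡ (γY y k) ⟨
      1ℤ * γY y k                                   ≡⟨ cong (_* γY y k) (trans (∑-perm (g ⁻¹) (⁻¹-Inj g ig) (λ x → ind ⌊ a ≟ x ⌋)) (∑-ind a)) ⟨
      ∑ (λ x → ind ⌊ a ≟ g ⁻¹ ∙ x ⌋) * γY y k       ≡⟨ proj-β (fn y) (fl y) (λ x → ind ⌊ a ≟ g ⁻¹ ∙ x ⌋) k ⟨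
      proj (β (fn y) (fl y) (λ x → ind ⌊ a ≟ g ⁻¹ ∙ x ⌋)) k ≡⟨ πᴸ.lin-cong natural k ⟩
      proj (act P g ⊛ β (fn y′) (fl y′) (λ x → ind ⌊ a ≟ x ⌋)) k ≡⟨ proj-act g ig (β (fn y′) (fl y′) (λ x → ind ⌊ a ≟ x ⌋)) k ⟩
      (act F g ⊛ γY y′) k ∎
      where
      open ≡-Reasoning
      y′ = g ⁻¹ Y.▹ y
      natural : ∀ j → β (fn y) (fl y) (λ x → ind ⌊ a ≟ g ⁻¹ ∙ x ⌋) j ≡ (act P g ⊛ β (fn y′) (fl y′) (λ x → ind ⌊ a ≟ x ⌋)) j
      natural j = subst (λ j → β (fn y) (fl y) (λ x → ind ⌊ a ≟ g ⁻¹ ∙ x ⌋) j ≡ (act P g ⊛ β (fn y′) (fl y′) (λ x → ind ⌊ a ≟ x ⌋)) j) (Ω.to-from j)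
        (trans (β-natural g ig (fn y) (fn y′) (conj⁻¹ g ig y) (fl y) (fl y′) (λ x → ind ⌊ a ≟ g ⁻¹ ∙ x ⌋) ω)
          (trans (Linear.lin-cong (β-linear (fn y′) (fl y′)) (λ x → cong (λ z → ind ⌊ a ≟ z ⌋) (inverseˡ g ig x)) (Ω.to (g ⁻¹ ▹Ω ω)))
            (sym (Ω.perm-act g ig (β (fn y′) (fl y′) (λ x → ind ⌊ a ≟ x ⌋)) ω))))
        where ω = Ω.from j

    ρ-act : ∀ g → Inj g → ∀ q k → ρ (act Q.permLattice g ⊛ q) k ≡ (act F g ⊛ ρ q) k
    ρ-act g ig q k = begin
      ∑ (λ i → term (act Q.permLattice g ⊛ q) (Y.from i) k)         ≡⟨ ∑-cong {Y.size} (λ i → pointwise (Y.from i)) ⟩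
      ∑ (λ i → (act F g ⊛ term q (g ⁻¹ Y.▹ Y.from i)) k)            ≡⟨ ∑-cong {Y.size} (λ i → cong (λ y → (act F g ⊛ term q y) k) (sym (Y.from-to (g ⁻¹ Y.▹ Y.from i)))) ⟩
      ∑ (λ i → (act F g ⊛ term q (Y.from (Y.σ (g ⁻¹) i))) k)
        ≡⟨ ∑-bij (Y.σ (g ⁻¹)) (Y.σ g)
             (λ i → trans (cong (λ y → Y.to (g Y.▹ y)) (Y.from-to _)) (trans (cong Y.to (Y.▹-inverseʳ g ig (Y.from i))) (Y.to-from i)))
             (λ i → trans (cong (λ y → Y.to (g ⁻¹ Y.▹ y)) (Y.from-to _)) (trans (cong Y.to (Y.▹-inverseˡ g ig (Y.from i))) (Y.to-from i)))
             (λ i → (act F g ⊛ term q (Y.from i)) k) ⟩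
      ∑ (λ i → (act F g ⊛ term q (Y.from i)) k)                     ≡⟨ Linear.lin-∑ (⊛-linear (act F g)) (λ i → term q (Y.from i)) k ⟨
      (act F g ⊛ ρ q) k ∎
      where
      open ≡-Reasoning
      slice-act : ∀ y j → slice (act Q.permLattice g ⊛ q) y j ≡ (act P g ⊛ slice q (g ⁻¹ Y.▹ y)) j
      slice-act y j = trans (Q.perm-act g ig q (y , inj₁ (Ω.from j)))
        (sym (trans (cong (act P g ⊛ slice q (g ⁻¹ Y.▹ y)) (sym (Ω.to-from j))) (trans (Ω.perm-act g ig (slice q (g ⁻¹ Y.▹ y)) (Ω.from j))
          (cong (λ ω → q (Q.to (g ⁻¹ Y.▹ y , inj₁ ω))) (Ω.from-to (g ⁻¹ ▹Ω Ω.from j))))))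
      pointwise : ∀ y → term (act Q.permLattice g ⊛ q) y k ≡ (act F g ⊛ term q (g ⁻¹ Y.▹ y)) k
      pointwise y = trans (cong₂ _+_ (trans (πᴸ.lin-cong (slice-act y) k) (proj-act g ig (slice q y′) k))
          (cong₂ _*_ (Q.perm-act g ig q (y , inj₂ 0F)) (γ-act g ig y k)))
        (sym (trans (Linear.lin-+ (⊛-linear (act F g)) (proj (slice q y′)) (λ k → tip q y′ * γY y′ k) k)
          (cong (_+_ ((act F g ⊛ proj (slice q y′)) k)) (Linear.lin-* (⊛-linear (act F g)) (tip q y′) (γY y′) k))))
        where y′ = g ⁻¹ Y.▹ y

    -- Each cycle contributes `proj v`: what `β (α v)` removes from it in the first summand is the
    -- sum of `α v` times `γ`, and this is what the last coordinate restores.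
    ρ-L : ∀ v k → ρ (L v) k ≡ + Y.size * proj v k
    ρ-L v k = trans (∑-cong {Y.size} (λ i → one (Y.from i))) (∑-const Y.size (proj v k))
      where
      cancel : ∀ a b → a - b + b ≡ a
      cancel = solve-∀
      one : ∀ y → term (L v) y k ≡ proj v k
      one y = trans (cong₂ _+_ (trans (πᴸ.lin-cong (λ j → trans (cong (λ q → L′ q v) (Q.from-to (y , inj₁ (Ω.from j)))) (cong (rest y v) (Ω.to-from j))) k)
            (πᴸ.lin-− v (β (fn y) (fl y) (α (fn y) (fl y) v)) k))
          (trans (cong (λ q → L′ q v * γY y k) (Q.from-to (y , inj₂ 0F))) (sym (proj-β (fn y) (fl y) (α (fn y) (fl y) v) k))))
        (cancel (proj v k) (proj (β (fn y) (fl y) (α (fn y) (fl y) v)) k))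

  invertible-cycles : ∀ {p} → ¬ p ∣ FinSet.size cycles → IntInvertible p F
  invertible-cycles p∤Y = invertible-from Qᴳ L L-linear L-I L-act ρ ρ-linear ρ-act Y.size p∤Y ρ-L

-- Lehmer codes of permutations

encode : ∀ {m} → Permutation m m → Fin (m !)
encode {zero}  π = 0F
encode {suc m} π = Fin.combine (π ⟨$⟩ʳ 0F) (encode (remove 0F π))

decode : ∀ {m} → Fin (m !) → Permutation m m
decode {zero}  _ = Perm′.id
decode {suc m} i = insert 0F (proj₁ (Fin.remQuot {suc m} (m !) i)) (decode (proj₂ (Fin.remQuot {suc m} (m !) i)))

suc-remove : ∀ {m} (π : Permutation (suc m) (suc m)) k → π ⟨$⟩ʳ Fin.suc k ≡ Fin.punchIn (π ⟨$⟩ʳ 0F) (remove 0F π ⟨$⟩ʳ k)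
suc-remove π k = trans (sym (insert-remove 0F π (Fin.suc k))) (insert-punchIn 0F (π ⟨$⟩ʳ 0F) (remove 0F π) k)

encode-injective : ∀ {m} (π ρ : Permutation m m) → encode π ≡ encode ρ → ∀ k → π ⟨$⟩ʳ k ≡ ρ ⟨$⟩ʳ k
encode-injective {suc m} π ρ e = go
  where
  first= : π ⟨$⟩ʳ 0F ≡ ρ ⟨$⟩ʳ 0F
  first= = FinP.combine-injectiveˡ (π ⟨$⟩ʳ 0F) (encode (remove 0F π)) (ρ ⟨$⟩ʳ 0F) (encode (remove 0F ρ)) e
  go : ∀ k → π ⟨$⟩ʳ k ≡ ρ ⟨$⟩ʳ k
  go 0F          = first=
  go (Fin.suc k) = trans (suc-remove π k) (trans (cong₂ Fin.punchIn first=
    (encode-injective (remove 0F π) (remove 0F ρ) (FinP.combine-injectiveʳ (π ⟨$⟩ʳ 0F) (encode (remove 0F π)) (ρ ⟨$⟩ʳ 0F) (encode (remove 0F ρ)) e) k))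
    (sym (suc-remove ρ k)))

decode-injective : ∀ {m} (i j : Fin (m !)) → (∀ k → decode {m} i ⟨$⟩ʳ k ≡ decode j ⟨$⟩ʳ k) → i ≡ j
decode-injective {zero}  0F 0F e = refl
decode-injective {suc m} i  j  e = trans (sym (FinP.combine-remQuot {suc m} (m !) i))
    (trans (cong₂ Fin.combine first= (decode-injective _ _ rest=)) (FinP.combine-remQuot {suc m} (m !) j))
  where
  first= : proj₁ (Fin.remQuot {suc m} (m !) i) ≡ proj₁ (Fin.remQuot {suc m} (m !) j)
  first= = e 0F
  rest= : ∀ k → decode {m} (proj₂ (Fin.remQuot {suc m} (m !) i)) ⟨$⟩ʳ k ≡ decode (proj₂ (Fin.remQuot {suc m} (m !) j)) ⟨$⟩ʳ k
  rest= k = FinP.punchIn-injective (proj₁ (Fin.remQuot {suc m} (m !) i)) _ _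
    (trans (sym (insert-punchIn 0F _ (decode (proj₂ (Fin.remQuot {suc m} (m !) i))) k)) (trans (e (Fin.suc k))
      (trans (insert-punchIn 0F _ (decode (proj₂ (Fin.remQuot {suc m} (m !) j))) k)
        (cong (λ q → Fin.punchIn q (decode (proj₂ (Fin.remQuot {suc m} (m !) j)) ⟨$⟩ʳ k)) (sym first=)))))

-- A full cycle amounts to the order in which it visits the letters from `0F` on, that is, to a
-- permutation fixing `0F`, coded by its effect on the other `m` letters. Injections in both
-- directions give the number of cycles.
module CountCycles (m : ℕ) where

  private
    n : ℕ
    n = suc m

  open FullCycles n
  open Rotation n

  private module Y = FinSet cycles

  module _ (c : Fin n → Fin n) (full : Full c) where

    listing : Fin n → Fin n
    listing k = iter c (toℕ k) 0F

    listing-injective : ∀ k l → listing k ≡ listing l → k ≡ l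
    listing-injective = surjective⇒injective listing (full 0F)

    -- The n-th iterate is some listed letter. Were it the one at k + 1, cancelling one step would
    -- repeat the letter at k at position `m`, although k is smaller than `m`.
    period : iter c n 0F ≡ 0F
    period = go (proj₁ (full 0F (iter c n 0F))) (proj₂ (full 0F (iter c n 0F)))
      where
      go : ∀ k → listing k ≡ iter c n 0F → iter c n 0F ≡ 0F
      go 0F          e = sym e
      go (Fin.suc k) e = ⊥-elim (ℕP.<⇒≢ (FinP.toℕ<n k) (trans (sym (FinP.toℕ-inject₁ k)) (trans (cong toℕ
        (listing-injective (Fin.inject₁ k) (Fin.fromℕ m) (trans (cong (λ i → iter c i 0F) (FinP.toℕ-inject₁ k))
          (trans (surjective⇒injective c (Full-hits full) _ _ e) (cong (λ i → iter c i 0F) (sym (FinP.toℕ-fromℕ m)))))))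
        (FinP.toℕ-fromℕ m))))

    listing-permutation : Permutation n n
    listing-permutation = permutation listing (λ y → proj₁ (full 0F y)) (λ y → proj₂ (full 0F y))
      (λ k → listing-injective _ _ (proj₂ (full 0F (listing k))))

    c-listing : ∀ k → c (listing k) ≡ listing (rot 1 k)
    c-listing k = go (ℕP.m≤n⇒m<n∨m≡n (FinP.toℕ<n k))
      where
      go : suc (toℕ k) ℕ.< n ⊎ suc (toℕ k) ≡ n → c (listing k) ≡ listing (rot 1 k)
      go (inj₁ k+1<n) = cong (λ i → iter c i 0F) (sym (trans (toℕ-rot 1 k) (trans (cong (ℕ._% n) (ℕP.+-comm (toℕ k) 1)) (m<n⇒m%n≡m k+1<n))))
      go (inj₂ k+1≡n) = trans (cong (λ i → iter c i 0F) k+1≡n) (trans period (cong (λ i → iter c i 0F)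
        (sym (trans (toℕ-rot 1 k) (trans (cong (ℕ._% n) (trans (ℕP.+-comm (toℕ k) 1) k+1≡n)) ([m+n]%n≡m%n 0 n))))))

  code : Y.Carrier → Fin (m !)
  code (c , t) = encode (remove 0F (listing-permutation (c ∙_) (isFull⇒Full c t)))

  code-injective : ∀ y y′ → code y ≡ code y′ → y ≡ y′
  code-injective (c , t) (c′ , t′) e = Y-≡ (λ x → let (k , q) = full 0F x in
      trans (cong (c ∙_) (sym q)) (trans (c-listing (c ∙_) full k) (trans (listing= (rot 1 k))
        (trans (sym (c-listing (c′ ∙_) full′ k)) (cong (c′ ∙_) (trans (sym (listing= k)) q))))))
    where
    full = isFull⇒Full c t
    full′ = isFull⇒Full c′ t′
    π = listing-permutation (c ∙_) full
    π′ = listing-permutation (c′ ∙_) full′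
    listing= : ∀ k → listing (c ∙_) full k ≡ listing (c′ ∙_) full′ k
    listing= 0F          = refl
    listing= (Fin.suc k) = trans (suc-remove π k) (trans (cong Fin.suc (encode-injective (remove 0F π) (remove 0F π′) e k)) (sym (suc-remove π′ k)))

  module _ (φ : Permutation n n) where

    cycle : Fin n → Fin n
    cycle x = φ ⟨$⟩ʳ rot 1 (φ ⟨$⟩ˡ x)

    cycle-iter : ∀ k q → iter cycle k (φ ⟨$⟩ʳ q) ≡ φ ⟨$⟩ʳ iter (rot 1) k q
    cycle-iter k q = sym (iter-map (φ ⟨$⟩ʳ_) {rot 1} {cycle} (λ q → cong (λ z → φ ⟨$⟩ʳ rot 1 z) (sym (Perm′.inverseˡ φ))) k q)

    cycle-full : Full cycle
    cycle-full x y = k , trans (cong (iter cycle (toℕ k)) (sym (Perm′.inverseʳ φ)))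
        (trans (cycle-iter (toℕ k) q) (trans (cong (φ ⟨$⟩ʳ_) (trans (iter-rot (toℕ k) q) (trans (rot-comm k q) (rot-inverse′ (toℕ q) q′ (ℕP.<⇒≤ (FinP.toℕ<n q))))))
          (Perm′.inverseʳ φ)))
      where
      q = φ ⟨$⟩ˡ x
      q′ = φ ⟨$⟩ˡ y
      k = rot (n ℕ.∸ toℕ q) q′

    cycle-0 : ∀ k → iter cycle (toℕ k) (φ ⟨$⟩ʳ 0F) ≡ φ ⟨$⟩ʳ k
    cycle-0 k = trans (cycle-iter (toℕ k) 0F) (cong (φ ⟨$⟩ʳ_) (trans (iter-rot (toℕ k) 0F) (trans (rot-comm k 0F) (rot-0 k))))

  fromCode : Fin (m !) → Y.Carrier
  fromCode i = tabulate (cycle φ) , Full⇒isFull (tabulate (cycle φ)) (λ x y →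
      let (k , e) = cycle-full φ x y in k , trans (iter-tabulate (toℕ k) x) e)
    where
    φ = lift₀ (decode {m} i)
    iter-tabulate : ∀ k x → iter (tabulate (cycle φ) ∙_) k x ≡ iter (cycle φ) k x
    iter-tabulate k x = iter-map id {tabulate (cycle φ) ∙_} {cycle φ} (lookup∘tabulate (cycle φ)) k x

  -- `lift₀` fixes `0F`, so the iterates of the cycle from `0F` run through the values of the
  -- permutation in order and determine it.
  fromCode-injective : ∀ i j → fromCode i ≡ fromCode j → i ≡ j
  fromCode-injective i j e = decode-injective i j (λ k → FinP.suc-injective (trans (sym (cycle-0 φ (Fin.suc k)))
      (trans (iter-≗ (toℕ (Fin.suc k)) 0F) (cycle-0 φ′ (Fin.suc k)))))
    where
    φ = lift₀ (decode {m} i)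
    φ′ = lift₀ (decode {m} j)
    cycle= : ∀ x → cycle φ x ≡ cycle φ′ x
    cycle= x = trans (sym (lookup∘tabulate (cycle φ) x)) (trans (cong (λ y → proj₁ y ∙ x) e) (lookup∘tabulate (cycle φ′) x))
    iter-≗ : ∀ k x → iter (cycle φ) k x ≡ iter (cycle φ′) k x
    iter-≗ = iter-map id {cycle φ} {cycle φ′} cycle=

  #cycles : Y.size ≡ m !
  #cycles = ℕP.≤-antisym
    (FinP.injective⇒≤ {f = code ∘ Y.from} (λ {i} {j} e → trans (sym (Y.to-from i)) (trans (cong Y.to (code-injective _ _ e)) (Y.to-from j))))
    (FinP.injective⇒≤ {f = Y.to ∘ fromCode} (λ {i} {j} e → fromCode-injective i j (Y.to-injective e)))

prime∤! : ∀ {p} → Prime p → ∀ m → m ℕ.< p → ¬ p ∣ m !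
prime∤! pr zero    _   = ∤-1 pr
prime∤! pr (suc m) m<p = ∤-* pr (λ d → ℕP.<⇒≱ m<p (∣⇒≤ d)) (prime∤! pr m (ℕP.<-trans (ℕP.n<1+n m) m<p))

-- Sufficiency and the equivalence

invertible-functions : ∀ {n p} .{{_ : ℕ.NonZero n}} → Prime p → Prime n ⊎ (Composite n × ¬ (p ∣ n)) →
  (fm : FunctionsModConstants n) → FlasqueClassPInvertible p (FunctionsModConstants.lattice fm)
invertible-functions {suc m} {p} pr cond fm =
  Resolution.P fm , C.F , Resolution.P-isGLattice fm , C.F-isGLattice , C.exact , Resolution.P-isPermutation fm , F-isFlasque fm
  , int⇒pInvertible pr C.F (int (p ∣? suc m) cond)
  where
  module C = Cokernel fm
  int : Dec (p ∣ suc m) → Prime (suc m) ⊎ (Composite (suc m) × ¬ (p ∣ suc m)) → IntInvertible p C.F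
  int (no p∤n)  _                  = Invertibility.invertible-p∤n fm p∤n
  int (yes p∣n) (inj₂ (_ , p∤n))   = ⊥-elim (p∤n p∣n)
  int (yes p∣n) (inj₁ pn)          = cyclic (prime⇒irreducible pn p∣n)
    where
    cyclic : p ≡ 1 ⊎ p ≡ suc m → IntInvertible p C.F
    cyclic (inj₁ p≡1) = ⊥-elim (∤-1 pr (divides 1 (sym (trans (ℕP.*-identityˡ p) p≡1))))
    cyclic (inj₂ p≡n) = CyclicSplitting.invertible-cycles fm (λ d → prime∤! pr m (subst (m ℕ.<_) (sym p≡n) (ℕP.n<1+n m))
      (subst (p ∣_) (CountCycles.#cycles m) d))

-- A₂ is trivial and J 2 has rank zero.
invertible-J2 : ∀ p → FlasqueClassPInvertible p (J 2)
invertible-J2 p = O , O , O-lattice , O-lattice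
  , ((λ ()) , (λ ()) , (λ _ _ ()) , (λ _ _ ()) , (λ _ _ ()) , (λ _ → (λ ()) , λ ()) , (λ _ ()) , (λ _ _ → (λ ()) , λ ()))
  , O-permutation , (λ _ _ _ → (λ _ ()) , λ ())
  , (O , O-lattice , O-permutation , (λ ()) , (λ ()) , (λ ()) , (λ ()) , (λ _ _ ()) , (λ _ _ ()) , λ ())
  where
  O : RawLattice 2
  O = record { rank = 0 ; act = λ _ () }
  O-lattice : IsGLattice O
  O-lattice = (λ ()) , λ _ _ _ _ ()
  O-permutation : IsPermutation O
  O-permutation = (λ ()) , (λ ()) , (λ ()) , (λ ()) , λ _ _ → (λ ()) , λ ()

invertible : ∀ n p → 2 ℕ.≤ n → Prime p → Prime n ⊎ (Composite n × ¬ (p ∣ n)) → FlasqueClassPInvertible p (J n)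
invertible n p 2≤n pr cond = go (ℕP.m≤n⇒m<n∨m≡n 2≤n)
  where
  go : 2 ℕ.< n ⊎ 2 ≡ n → FlasqueClassPInvertible p (J n)
  go (inj₂ refl) = invertible-J2 p
  go (inj₁ 3≤n)  = let (fm , eq) = J-functions-≥3 n 3≤n in
    subst (FlasqueClassPInvertible p) eq (invertible-functions {{ℕ.>-nonZero (ℕP.<-trans (ℕ.s≤s ℕ.z≤n) 2≤n)}} pr cond fm)

theorem4p7 : (n p : ℕ) → 2 ≤ n → Prime p →
    FlasqueClassPInvertible p (J n) ⇔ (Prime n ⊎ (Composite n × ¬ (p ∣ n)))
theorem4p7 n p 2≤n pr = mk⇔ (forward (prime? n)) (invertible n p 2≤n pr)
  where
  forward : Dec (Prime n) → FlasqueClassPInvertible p (J n) → Prime n ⊎ (Composite n × ¬ (p ∣ n))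
  forward (yes pn) _   = inj₁ pn
  forward (no ¬pn) inv = inj₂ (¬prime⇒composite {{ℕ.n>1⇒nonTrivial 2≤n}} ¬pn , λ p∣n → ¬invertible n p 2≤n pr ¬pn p∣n inv)
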